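{- Let $G$ be a metric group with $|G|=N>4$ and let $E\colon G\to\mathbb{C}$ be a finite quantum dilogarithm for $G$, with constant $C\in\mathbb{C}^\times$. Then: (i) $E(0)^2=\sqrt N\,E(0)+1$ and $C=-\widehat E(0)$; (ii) $E(u)E(-u)=\langle u\rangle^{ -1}$ for all $u\in G$, $u\ne0$; (iii) $\widehat E(u)=\lambda\langle u\rangle E(u)$ for all $u\in G$, where $\lambda=\widehat E(0)/E(0)$ satisfies $\lambda^3=\frac1{\sqrt N}\sum_{x\in G}\langle x\rangle^{ -1}$; (iv) the function $\widetilde E(u)=\langle u\rangle E(u)$ satisfies, for all $x,y\in G$, the dual pentagon equation $$\langle x;y\rangle^{ -1}\widetilde E(x)\widetilde E(y)=\widetilde C+\frac1{\sqrt N}\sum_{z\in G}\widetilde E(y-z)\widetilde E(z)\langle z\rangle^{ -1}\widetilde E(x-z)$$ with $\widetilde C=\lambda^{ -2}C$.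
   Context: A metric group is a finite abelian group $G$ together with a function $\langle\cdot\rangle\colon G\to\mathbb{C}^\times$ such that $\langle x\rangle=\langle -x\rangle$ for all $x$ and $\langle x;y\rangle:=\dfrac{\langle x+y\rangle}{\langle x\rangle\langle y\rangle}$ is a non-degenerate bicharacter on $G$. For $N=|G|$ the Fourier transform of $f\colon G\to\mathbb{C}$ is $\widehat f(y)=\frac1{\sqrt N}\sum_{x\in G}f(x)\langle x;-y\rangle$. A finite quantum dilogarithm for a metric group $G$ with $|G|>1$ is a function $E\colon G\to\mathbb{C}$ such that for some non-zero constant $C\in\mathbb{C}^\times$ and all $x,y\in G$, $$\langle x;y\rangle E(x)E(y)=C+\frac1{\sqrt N}\sum_{z\in G}E(y-z)E(z)\langle z\rangle E(x-z).$$ -}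

module Defs where

open import Level using (0ℓ; _⊔_) renaming (suc to lsuc)
open import Data.Nat.Base as ℕ using (ℕ; zero; suc)
import Data.Nat.Properties as ℕ
import Data.Nat.Solver as ℕ-Solver
open import Data.Integer.Base as ℤ using (+_)
import Data.Integer.Properties as ℤ
open import Data.Rational.Base as ℚ using (ℚ; 0ℚ; 1ℚ; ½; ∣_∣)
import Data.Rational.Properties as ℚ
open import Data.Rational.Unnormalised.Base as ℚᵘ using (ℚᵘ; mkℚᵘ; *≤*; *<*; *≡*)
import Data.Rational.Unnormalised.Properties as ℚᵘ
import Data.Rational.Solver as ℚ
open import Data.Fin.Base using (Fin)
open import Data.Fin.Properties using (nonZeroIndex)
open import Data.Product using (∃; _×_; _,_; proj₁)
open import Function.Bundles using (Inverse)
open import Relation.Nullary using (yes; no)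
open import Relation.Binary using (IsEquivalence; Setoid)
open import Relation.Binary.PropositionalEquality as ≡ using (_≡_; refl)
open import Algebra.Bundles using (AbelianGroup; CommutativeRing)
open import Algebra.Definitions using (Invertible)
import Algebra.Properties.CommutativeMonoid.Sum as Sum

IsCauchy : (ℕ → ℚ) → Set
IsCauchy f = ∀ ε → 0ℚ ℚ.< ε →
  ∃ λ M → ∀ m n → M ℕ.≤ m → M ℕ.≤ n → ∣ f m ℚ.- f n ∣ ℚ.< ε

-- Without eta, and with operations given by copatterns below, arithmetic
-- expressions stay folded during unification.
record ℝ : Set where
  no-eta-equality
  field
    seq    : ℕ → ℚ
    cauchy : IsCauchy seq

open ℝ public

infix 4 _≈ᴿ_
record _≈ᴿ_ (x y : ℝ) : Set where
  constructor mk≈ᴿ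
  field
    close : ∀ ε → 0ℚ ℚ.< ε →
      ∃ λ M → ∀ n → M ℕ.≤ n → ∣ seq x n ℚ.- seq y n ∣ ℚ.< ε

open _≈ᴿ_ public

private
  open ℚ.+-*-Solver

  half-pos : ∀ {ε} → 0ℚ ℚ.< ε → 0ℚ ℚ.< ½ ℚ.* ε
  half-pos 0<ε = ℚ.*-monoʳ-<-pos ½ 0<ε

  half+half : ∀ ε → ½ ℚ.* ε ℚ.+ ½ ℚ.* ε ≡ ε
  half+half ε = ≡.trans (≡.sym (ℚ.*-distribʳ-+ ε ½ ½)) (ℚ.*-identityˡ ε)

  half<  : ∀ {ε} → 0ℚ ℚ.< ε → ½ ℚ.* ε ℚ.< ε
  half< {ε} 0<ε = begin-strict
    ½ ℚ.* ε                 ≡⟨ ℚ.+-identityˡ (½ ℚ.* ε) ⟨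
    0ℚ ℚ.+ ½ ℚ.* ε          <⟨ ℚ.+-monoˡ-< (½ ℚ.* ε) (half-pos 0<ε) ⟩
    ½ ℚ.* ε ℚ.+ ½ ℚ.* ε     ≡⟨ half+half ε ⟩
    ε                       ∎
    where open ℚ.≤-Reasoning

  divide : ∀ {ε B} → 0ℚ ℚ.< ε → 0ℚ ℚ.< B → ∃ λ δ → 0ℚ ℚ.< δ × δ ℚ.* B ≡ ε
  divide {ε} {B} 0<ε 0<B = ε ℚ.* B⁻¹ , 0<δ , eq
    where
    instance
      B-pos = ℚ.positive 0<B
      ε-pos = ℚ.positive 0<ε
      B≢0   = ℚ.pos⇒nonZero B
    B⁻¹ = ℚ.1/ B
    0<δ = ℚ.positive⁻¹ (ε ℚ.* B⁻¹) {{ℚ.pos*pos⇒pos ε B⁻¹ {{ℚ.1/pos⇒pos B}}}}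
    eq : ε ℚ.* B⁻¹ ℚ.* B ≡ ε
    eq = ≡.trans (ℚ.*-assoc ε B⁻¹ B)
           (≡.trans (≡.cong (ε ℚ.*_) (ℚ.*-inverseˡ B)) (ℚ.*-identityʳ ε))

  ∣0∣< : ∀ {p ε} → 0ℚ ℚ.< ε → p ≡ 0ℚ → ∣ p ∣ ℚ.< ε
  ∣0∣< 0<ε refl = 0<ε

  ∣-∣-sym : ∀ p q → ∣ p ℚ.- q ∣ ≡ ∣ q ℚ.- p ∣
  ∣-∣-sym p q = ≡.trans
    (≡.cong ∣_∣ (solve 2 (λ p q → p :- q := :- (q :- p)) refl p q))
    (ℚ.∣-p∣≡∣p∣ (q ℚ.- p))

  sum-small : ∀ {p q ε} r → r ≡ p ℚ.+ q →
              ∣ p ∣ ℚ.< ½ ℚ.* ε → ∣ q ∣ ℚ.< ½ ℚ.* ε → ∣ r ∣ ℚ.< ε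
  sum-small {p} {q} {ε} r refl p< q< = begin-strict
    ∣ p ℚ.+ q ∣             ≤⟨ ℚ.∣p+q∣≤∣p∣+∣q∣ p q ⟩
    ∣ p ∣ ℚ.+ ∣ q ∣         <⟨ ℚ.+-mono-< p< q< ⟩
    ½ ℚ.* ε ℚ.+ ½ ℚ.* ε     ≡⟨ half+half ε ⟩
    ε                       ∎
    where open ℚ.≤-Reasoning

  ∣*∣-bound : ∀ {p q A δ} → ∣ p ∣ ℚ.≤ δ → ∣ q ∣ ℚ.≤ A → ∣ p ℚ.* q ∣ ℚ.≤ δ ℚ.* A
  ∣*∣-bound {p} {q} {A} {δ} p≤ q≤ = begin
    ∣ p ℚ.* q ∣      ≡⟨ ℚ.∣p*q∣≡∣p∣*∣q∣ p q ⟩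
    ∣ p ∣ ℚ.* ∣ q ∣  ≤⟨ ℚ.*-monoʳ-≤-nonNeg ∣ q ∣ {{ℚ.∣-∣-nonNeg q}} p≤ ⟩
    δ ℚ.* ∣ q ∣      ≤⟨ ℚ.*-monoˡ-≤-nonNeg δ {{δ≥0}} q≤ ⟩
    δ ℚ.* A          ∎
    where
    open ℚ.≤-Reasoning
    δ≥0 = ℚ.nonNegative (ℚ.≤-trans (ℚ.0≤∣p∣ p) p≤)

  product-small : ∀ {A B δ} a b u v →
    ∣ a ℚ.- b ∣ ℚ.< δ → ∣ u ℚ.- v ∣ ℚ.< δ → ∣ u ∣ ℚ.≤ A → ∣ b ∣ ℚ.≤ B →
    ∣ a ℚ.* u ℚ.- b ℚ.* v ∣ ℚ.≤ δ ℚ.* (A ℚ.+ B)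
  product-small {A} {B} {δ} a b u v ab uv u≤ b≤ = begin
    ∣ a ℚ.* u ℚ.- b ℚ.* v ∣
      ≡⟨ ≡.cong ∣_∣ (solve 4 (λ a b u v →
           a :* u :- b :* v := (a :- b) :* u :+ (u :- v) :* b) refl a b u v) ⟩
    ∣ (a ℚ.- b) ℚ.* u ℚ.+ (u ℚ.- v) ℚ.* b ∣
      ≤⟨ ℚ.∣p+q∣≤∣p∣+∣q∣ ((a ℚ.- b) ℚ.* u) ((u ℚ.- v) ℚ.* b) ⟩
    ∣ (a ℚ.- b) ℚ.* u ∣ ℚ.+ ∣ (u ℚ.- v) ℚ.* b ∣
      ≤⟨ ℚ.+-mono-≤ (∣*∣-bound {a ℚ.- b} {u} (ℚ.<⇒≤ ab) u≤)
                    (∣*∣-bound {u ℚ.- v} {b} (ℚ.<⇒≤ uv) b≤) ⟩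
    δ ℚ.* A ℚ.+ δ ℚ.* B
      ≡⟨ ℚ.*-distribˡ-+ δ A B ⟨
    δ ℚ.* (A ℚ.+ B) ∎
    where open ℚ.≤-Reasoning

  bounded : ∀ x → ∃ λ A → 0ℚ ℚ.< A × ∃ λ M → ∀ n → M ℕ.≤ n → ∣ seq x n ∣ ℚ.≤ A
  bounded x with cauchy x 1ℚ (ℚ.positive⁻¹ 1ℚ)
  ... | M , c = 1ℚ ℚ.+ ∣ seq x M ∣ ,
                ℚ.+-mono-<-≤ (ℚ.positive⁻¹ 1ℚ) (ℚ.0≤∣p∣ (seq x M)) ,
                M , bound
    where
    open ℚ.≤-Reasoning
    bound : ∀ n → M ℕ.≤ n → ∣ seq x n ∣ ℚ.≤ 1ℚ ℚ.+ ∣ seq x M ∣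
    bound n M≤n = begin
      ∣ seq x n ∣
        ≡⟨ ≡.cong ∣_∣ (solve 2 (λ a b → a := (a :- b) :+ b) refl (seq x n) (seq x M)) ⟩
      ∣ (seq x n ℚ.- seq x M) ℚ.+ seq x M ∣
        ≤⟨ ℚ.∣p+q∣≤∣p∣+∣q∣ (seq x n ℚ.- seq x M) (seq x M) ⟩
      ∣ seq x n ℚ.- seq x M ∣ ℚ.+ ∣ seq x M ∣
        ≤⟨ ℚ.+-monoˡ-≤ ∣ seq x M ∣ (ℚ.<⇒≤ (c n M M≤n ℕ.≤-refl)) ⟩
      1ℚ ℚ.+ ∣ seq x M ∣ ∎

  ⊔ˡ : ∀ {m n k} → m ℕ.⊔ n ℕ.≤ k → m ℕ.≤ k
  ⊔ˡ {m} {n} = ℕ.m⊔n≤o⇒m≤o m n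

  ⊔ʳ : ∀ {m n k} → m ℕ.⊔ n ℕ.≤ k → n ℕ.≤ k
  ⊔ʳ {m} {n} = ℕ.m⊔n≤o⇒n≤o m n

abstract
  const-cauchy : ∀ q → IsCauchy (λ _ → q)
  const-cauchy q ε 0<ε = 0 , λ _ _ _ _ → ∣0∣< 0<ε (ℚ.+-inverseʳ q)

  +-cauchy : ∀ x y → IsCauchy (λ n → seq x n ℚ.+ seq y n)
  +-cauchy x y ε 0<ε
    with M , f ← cauchy x (½ ℚ.* ε) (half-pos 0<ε)
       | L , g ← cauchy y (½ ℚ.* ε) (half-pos 0<ε)
    = M ℕ.⊔ L , λ m n p q → sum-small _
        (solve 4 (λ a b c d → (a :+ b) :- (c :+ d) := (a :- c) :+ (b :- d)) refl
          (seq x m) (seq y m) (seq x n) (seq y n))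
        (f m n (⊔ˡ p) (⊔ˡ q)) (g m n (⊔ʳ {M} p) (⊔ʳ {M} q))

  neg-cauchy : ∀ x → IsCauchy (λ n → ℚ.- seq x n)
  neg-cauchy x ε 0<ε with M , f ← cauchy x ε 0<ε
    = M , λ m n p q → ≡.subst (ℚ._< ε)
        (≡.cong ∣_∣ (solve 2 (λ a b → b :- a := :- a :- (:- b)) refl (seq x m) (seq x n)))
        (f n m q p)

  *-cauchy : ∀ x y → IsCauchy (λ n → seq x n ℚ.* seq y n)
  *-cauchy x y ε 0<ε =
    let B , 0<B , K , x≤B = bounded x
        A , 0<A , J , y≤A = bounded y
        δ , 0<δ , δ-eq    = divide (half-pos 0<ε) (ℚ.+-mono-< 0<A 0<B)
        M , f = cauchy x δ 0<δ
        L , g = cauchy y δ 0<δ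
    in (K ℕ.⊔ J) ℕ.⊔ (M ℕ.⊔ L) , λ m n p q → ℚ.≤-<-trans
         (product-small (seq x m) (seq x n) (seq y m) (seq y n)
           (f m n (⊔ˡ (⊔ʳ {K ℕ.⊔ J} p)) (⊔ˡ (⊔ʳ {K ℕ.⊔ J} q)))
           (g m n (⊔ʳ {M} (⊔ʳ {K ℕ.⊔ J} p)) (⊔ʳ {M} (⊔ʳ {K ℕ.⊔ J} q)))
           (y≤A m (⊔ʳ {K} (⊔ˡ p)))
           (x≤B n (⊔ˡ (⊔ˡ q))))
         (≡.subst (ℚ._< ε) (≡.sym δ-eq) (half< 0<ε))

infixl 6 _+ᴿ_
infixl 7 _*ᴿ_
infix  8 -ᴿ_

fromℚ : ℚ → ℝ
seq    (fromℚ q) _ = q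
cauchy (fromℚ q) = const-cauchy q

_+ᴿ_ _*ᴿ_ : ℝ → ℝ → ℝ
seq    (x +ᴿ y) n = seq x n ℚ.+ seq y n
cauchy (x +ᴿ y) = +-cauchy x y
seq    (x *ᴿ y) n = seq x n ℚ.* seq y n
cauchy (x *ᴿ y) = *-cauchy x y

-ᴿ_ : ℝ → ℝ
seq    (-ᴿ x) n = ℚ.- seq x n
cauchy (-ᴿ x) = neg-cauchy x

abstract
  pointwise : ∀ {x y} → (∀ n → seq x n ≡ seq y n) → x ≈ᴿ y
  pointwise {x} {y} e = mk≈ᴿ λ ε 0<ε → 0 , λ n _ →
    ∣0∣< 0<ε (≡.trans (≡.cong (ℚ._- seq y n) (e n)) (ℚ.+-inverseʳ (seq y n)))

  ≈ᴿ-refl : ∀ {x} → x ≈ᴿ x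
  ≈ᴿ-refl = pointwise λ _ → refl

  ≈ᴿ-sym : ∀ {x y} → x ≈ᴿ y → y ≈ᴿ x
  ≈ᴿ-sym {x} {y} p = mk≈ᴿ λ ε 0<ε →
    let M , f = close p ε 0<ε in
    M , λ n M≤n → ≡.subst (ℚ._< ε) (∣-∣-sym (seq x n) (seq y n)) (f n M≤n)

  ≈ᴿ-trans : ∀ {x y z} → x ≈ᴿ y → y ≈ᴿ z → x ≈ᴿ z
  ≈ᴿ-trans {x} {y} {z} p q = mk≈ᴿ λ ε 0<ε →
    let M , f = close p (½ ℚ.* ε) (half-pos 0<ε)
        L , g = close q (½ ℚ.* ε) (half-pos 0<ε)
    in M ℕ.⊔ L , λ n h → sum-small _
         (solve 3 (λ a b c → a :- c := (a :- b) :+ (b :- c)) refl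
           (seq x n) (seq y n) (seq z n))
         (f n (⊔ˡ h)) (g n (⊔ʳ {M} h))

  +ᴿ-cong : ∀ {x y u v} → x ≈ᴿ y → u ≈ᴿ v → x +ᴿ u ≈ᴿ y +ᴿ v
  +ᴿ-cong {x} {y} {u} {v} p q = mk≈ᴿ λ ε 0<ε →
    let M , f = close p (½ ℚ.* ε) (half-pos 0<ε)
        L , g = close q (½ ℚ.* ε) (half-pos 0<ε)
    in M ℕ.⊔ L , λ n h → sum-small _
         (solve 4 (λ a b c d → (a :+ b) :- (c :+ d) := (a :- c) :+ (b :- d)) refl
           (seq x n) (seq u n) (seq y n) (seq v n))
         (f n (⊔ˡ h)) (g n (⊔ʳ {M} h))

  -ᴿ-cong : ∀ {x y} → x ≈ᴿ y → -ᴿ x ≈ᴿ -ᴿ y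
  -ᴿ-cong {x} {y} p = mk≈ᴿ λ ε 0<ε →
    let M , f = close (≈ᴿ-sym p) ε 0<ε in
    M , λ n h → ≡.subst (ℚ._< ε)
      (≡.cong ∣_∣ (solve 2 (λ a b → b :- a := :- a :- (:- b)) refl (seq x n) (seq y n)))
      (f n h)

  *ᴿ-cong : ∀ {x y u v} → x ≈ᴿ y → u ≈ᴿ v → x *ᴿ u ≈ᴿ y *ᴿ v
  *ᴿ-cong {x} {y} {u} {v} p q = mk≈ᴿ λ ε 0<ε →
    let B , 0<B , K , y≤B = bounded y
        A , 0<A , J , u≤A = bounded u
        δ , 0<δ , δ-eq    = divide (half-pos 0<ε) (ℚ.+-mono-< 0<A 0<B)
        M , f = close p δ 0<δ
        L , g = close q δ 0<δ
    in (K ℕ.⊔ J) ℕ.⊔ (M ℕ.⊔ L) , λ n h → ℚ.≤-<-trans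
         (product-small (seq x n) (seq y n) (seq u n) (seq v n)
           (f n (⊔ˡ (⊔ʳ {K ℕ.⊔ J} h)))
           (g n (⊔ʳ {M} (⊔ʳ {K ℕ.⊔ J} h)))
           (u≤A n (⊔ʳ {K} (⊔ˡ h)))
           (y≤B n (⊔ˡ (⊔ˡ h))))
         (≡.subst (ℚ._< ε) (≡.sym δ-eq) (half< 0<ε))

isqrt : ℕ → ℕ
isqrt zero = 0
isqrt (suc m) with suc (isqrt m) ℕ.* suc (isqrt m) ℕ.≤? suc m
... | yes _ = suc (isqrt m)
... | no  _ = isqrt m

private
  isqrt-lower : ∀ m → isqrt m ℕ.* isqrt m ℕ.≤ m
  isqrt-lower zero = ℕ.z≤n
  isqrt-lower (suc m) with suc (isqrt m) ℕ.* suc (isqrt m) ℕ.≤? suc m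
  ... | yes h = h
  ... | no  _ = ℕ.≤-trans (isqrt-lower m) (ℕ.n≤1+n m)

  isqrt-upper : ∀ m → m ℕ.< suc (isqrt m) ℕ.* suc (isqrt m)
  isqrt-upper zero = ℕ.s≤s ℕ.z≤n
  isqrt-upper (suc m) with suc (isqrt m) ℕ.* suc (isqrt m) ℕ.≤? suc m
  ... | no  h = ℕ.≰⇒> h
  ... | yes h = ℕ.≤-<-trans (isqrt-upper m)
                  (ℕ.*-mono-< (ℕ.n<1+n (suc (isqrt m))) (ℕ.n<1+n (suc (isqrt m))))

√-num : ℕ → ℕ → ℕ
√-num n k = isqrt (n ℕ.* (suc k ℕ.* suc k))

-- The largest multiple of 1/(k+1) not exceeding √n.
√-seq : ℕ → ℕ → ℚ
√-seq n k = + √-num n k ℚ./ suc k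

private
  module √-Bounds (n : ℕ) where
    open ℕ-Solver.+-*-Solver using ()
      renaming (solve to solveℕ; _:*_ to _⊗_; _:=_ to _⊜_)

    rearrange : ∀ a b → (a ℕ.* b) ℕ.* (a ℕ.* b) ≡ (a ℕ.* a) ℕ.* (b ℕ.* b)
    rearrange = solveℕ 2 (λ a b → (a ⊗ b) ⊗ (a ⊗ b) ⊜ (a ⊗ a) ⊗ (b ⊗ b)) refl

    num-lower : ∀ k → √-num n k ℕ.* √-num n k ℕ.≤ n ℕ.* (suc k ℕ.* suc k)
    num-lower k = isqrt-lower (n ℕ.* (suc k ℕ.* suc k))

    num-upper : ∀ k → n ℕ.* (suc k ℕ.* suc k) ℕ.< suc (√-num n k) ℕ.* suc (√-num n k)
    num-upper k = isqrt-upper (n ℕ.* (suc k ℕ.* suc k))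

    cross : ∀ k l → √-num n k ℕ.* suc l ℕ.< suc (√-num n l) ℕ.* suc k
    cross k l = ℕ.≰⇒> λ h → ℕ.n≮n _ (begin-strict
      (b ℕ.* K) ℕ.* (b ℕ.* K)          ≤⟨ ℕ.*-mono-≤ h h ⟩
      (a ℕ.* L) ℕ.* (a ℕ.* L)          ≡⟨ rearrange a L ⟩
      (a ℕ.* a) ℕ.* (L ℕ.* L)          ≤⟨ ℕ.*-monoˡ-≤ (L ℕ.* L) (num-lower k) ⟩
      (n ℕ.* (K ℕ.* K)) ℕ.* (L ℕ.* L)  ≡⟨ solveℕ 3 (λ n k l → (n ⊗ k) ⊗ l ⊜ (n ⊗ l) ⊗ k) refl
                                            n (K ℕ.* K) (L ℕ.* L) ⟩
      (n ℕ.* (L ℕ.* L)) ℕ.* (K ℕ.* K)  <⟨ ℕ.*-monoˡ-< (K ℕ.* K) (num-upper l) ⟩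
      (b ℕ.* b) ℕ.* (K ℕ.* K)          ≡⟨ rearrange b K ⟨
      (b ℕ.* K) ℕ.* (b ℕ.* K)          ∎)
      where
      open ℕ.≤-Reasoning
      a = √-num n k
      b = suc (√-num n l)
      K = suc k
      L = suc l

  frac : ℕ → ℕ → ℚᵘ
  frac a k = mkℚᵘ (+ a) k

  fromℚᵘ-mono-≤ : ∀ {p q} → p ℚᵘ.≤ q → ℚ.fromℚᵘ p ℚ.≤ ℚ.fromℚᵘ q
  fromℚᵘ-mono-≤ {p} {q} h = ℚ.toℚᵘ-cancel-≤
    (ℚᵘ.≤-respˡ-≃ (ℚᵘ.≃-sym (ℚ.toℚᵘ-fromℚᵘ p))
      (ℚᵘ.≤-respʳ-≃ (ℚᵘ.≃-sym (ℚ.toℚᵘ-fromℚᵘ q)) h))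

  fromℚᵘ-mono-< : ∀ {p q} → p ℚᵘ.< q → ℚ.fromℚᵘ p ℚ.< ℚ.fromℚᵘ q
  fromℚᵘ-mono-< {p} {q} h = ℚ.toℚᵘ-cancel-<
    (ℚᵘ.<-respˡ-≃ (ℚᵘ.≃-sym (ℚ.toℚᵘ-fromℚᵘ p))
      (ℚᵘ.<-respʳ-≃ (ℚᵘ.≃-sym (ℚ.toℚᵘ-fromℚᵘ q)) h))

  fromℚᵘ-homo-* : ∀ p q → ℚ.fromℚᵘ (p ℚᵘ.* q) ≡ ℚ.fromℚᵘ p ℚ.* ℚ.fromℚᵘ q
  fromℚᵘ-homo-* p q = ℚ.toℚᵘ-injective (ℚᵘ.≃-trans (ℚ.toℚᵘ-fromℚᵘ (p ℚᵘ.* q))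
    (ℚᵘ.≃-sym (ℚᵘ.≃-trans (ℚ.toℚᵘ-homo-* (ℚ.fromℚᵘ p) (ℚ.fromℚᵘ q))
      (ℚᵘ.*-cong (ℚ.toℚᵘ-fromℚᵘ p) (ℚ.toℚᵘ-fromℚᵘ q)))))

  fromℚᵘ-homo-+ : ∀ p q → ℚ.fromℚᵘ (p ℚᵘ.+ q) ≡ ℚ.fromℚᵘ p ℚ.+ ℚ.fromℚᵘ q
  fromℚᵘ-homo-+ p q = ℚ.toℚᵘ-injective (ℚᵘ.≃-trans (ℚ.toℚᵘ-fromℚᵘ (p ℚᵘ.+ q))
    (ℚᵘ.≃-sym (ℚᵘ.≃-trans (ℚ.toℚᵘ-homo-+ (ℚ.fromℚᵘ p) (ℚ.fromℚᵘ q))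
      (ℚᵘ.+-cong (ℚ.toℚᵘ-fromℚᵘ p) (ℚ.toℚᵘ-fromℚᵘ q)))))

  frac-mono-≤ : ∀ {a b k l} → a ℕ.* suc l ℕ.≤ b ℕ.* suc k →
                + a ℚ./ suc k ℚ.≤ + b ℚ./ suc l
  frac-mono-≤ {a} {b} {k} {l} h = fromℚᵘ-mono-≤ {frac a k} {frac b l}
    (*≤* (≡.subst₂ ℤ._≤_ (ℤ.pos-* a (suc l)) (ℤ.pos-* b (suc k)) (ℤ.+≤+ h)))

  frac-mono-< : ∀ {a b k l} → a ℕ.* suc l ℕ.< b ℕ.* suc k →
                + a ℚ./ suc k ℚ.< + b ℚ./ suc l
  frac-mono-< {a} {b} {k} {l} h = fromℚᵘ-mono-< {frac a k} {frac b l}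
    (*<* (≡.subst₂ ℤ._<_ (ℤ.pos-* a (suc l)) (ℤ.pos-* b (suc k)) (ℤ.+<+ h)))

  frac-sq : ∀ a k → (+ a ℚ./ suc k) ℚ.* (+ a ℚ./ suc k)
                  ≡ + (a ℕ.* a) ℚ./ (suc k ℕ.* suc k)
  frac-sq a k = ≡.trans (≡.sym (fromℚᵘ-homo-* (frac a k) (frac a k)))
    (ℚ.fromℚᵘ-cong {frac a k ℚᵘ.* frac a k} {frac (a ℕ.* a) (k ℕ.+ k ℕ.* suc k)}
      (*≡* (≡.cong (ℤ._* + (suc k ℕ.* suc k)) (≡.sym (ℤ.pos-* a a)))))

  frac-suc : ∀ a k → + suc a ℚ./ suc k ≡ (+ a ℚ./ suc k) ℚ.+ (+ 1 ℚ./ suc k)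
  frac-suc a k = ≡.trans
    (ℚ.fromℚᵘ-cong {frac (suc a) k} {frac a k ℚᵘ.+ frac 1 k} (*≡* eq))
    (fromℚᵘ-homo-+ (frac a k) (frac 1 k))
    where
    open ≡.≡-Reasoning
    K = suc k
    eq : + suc a ℤ.* + (K ℕ.* K) ≡ (+ a ℤ.* + K ℤ.+ + 1 ℤ.* + K) ℤ.* + K
    eq = begin
      + suc a ℤ.* + (K ℕ.* K)               ≡⟨ ≡.cong (+ suc a ℤ.*_) (ℤ.pos-* K K) ⟩
      + suc a ℤ.* (+ K ℤ.* + K)             ≡⟨ ℤ.*-assoc (+ suc a) (+ K) (+ K) ⟨
      (+ suc a ℤ.* + K) ℤ.* + K             ≡⟨ ≡.cong (λ x → (x ℤ.* + K) ℤ.* + K) (ℤ.+-comm (+ 1) (+ a)) ⟩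
      ((+ a ℤ.+ + 1) ℤ.* + K) ℤ.* + K       ≡⟨ ≡.cong (ℤ._* + K) (ℤ.*-distribʳ-+ (+ K) (+ a) (+ 1)) ⟩
      (+ a ℤ.* + K ℤ.+ + 1 ℤ.* + K) ℤ.* + K ∎

  archimedean : ∀ {ε} → 0ℚ ℚ.< ε → ∃ λ M → ∀ k → M ℕ.≤ k → + 1 ℚ./ suc k ℚ.< ε
  archimedean {ε} 0<ε with ε | ℚ.positive 0<ε
  ... | ℚ.mkℚ (ℤ.+[1+ p ]) d c | _ = suc d , λ k d<k →
    ≡.subst (+ 1 ℚ./ suc k ℚ.<_) (ℚ.fromℚᵘ-toℚᵘ (ℚ.mkℚ ℤ.+[1+ p ] d c))
      (frac-mono-< {1} {suc p} {k} {d} (begin-strict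
        1 ℕ.* suc d         ≡⟨ ℕ.*-identityˡ (suc d) ⟩
        suc d               ≤⟨ d<k ⟩
        k                   <⟨ ℕ.n<1+n k ⟩
        suc k               ≤⟨ ℕ.m≤m+n (suc k) (p ℕ.* suc k) ⟩
        suc p ℕ.* suc k     ∎))
    where open ℕ.≤-Reasoning

  module _ (n : ℕ) where
    open √-Bounds n
    open ℚ.≤-Reasoning

    s t e : ℕ → ℚ
    s = √-seq n
    t k = + suc (√-num n k) ℚ./ suc k
    e k = + 1 ℚ./ suc k

    s<t : ∀ k l → s k ℚ.< s l ℚ.+ e l
    s<t k l = ≡.subst (s k ℚ.<_) (frac-suc (√-num n l) l)
      (frac-mono-< {√-num n k} {suc (√-num n l)} {k} {l} (cross k l))

    s-s<e : ∀ k l → s k ℚ.- s l ℚ.< e l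
    s-s<e k l = begin-strict
      s k ℚ.- s l             <⟨ ℚ.+-monoˡ-< (ℚ.- s l) (s<t k l) ⟩
      s l ℚ.+ e l ℚ.- s l     ≡⟨ solve 2 (λ a b → a :+ b :- a := b) refl (s l) (e l) ⟩
      e l                     ∎

    √-cauchy′ : IsCauchy (√-seq n)
    √-cauchy′ ε 0<ε with archimedean 0<ε
    ... | M , e<ε = M , λ m k M≤m M≤k → small m k M≤m M≤k (ℚ.∣p∣≡p∨∣p∣≡-p (s m ℚ.- s k))
      where
      open import Data.Sum using (_⊎_; inj₁; inj₂)
      small : ∀ m k → M ℕ.≤ m → M ℕ.≤ k →
              ∣ s m ℚ.- s k ∣ ≡ s m ℚ.- s k ⊎ ∣ s m ℚ.- s k ∣ ≡ ℚ.- (s m ℚ.- s k) →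
              ∣ s m ℚ.- s k ∣ ℚ.< ε
      small m k M≤m M≤k (inj₁ h) = begin-strict
        ∣ s m ℚ.- s k ∣   ≡⟨ h ⟩
        s m ℚ.- s k       <⟨ s-s<e m k ⟩
        e k               <⟨ e<ε k M≤k ⟩
        ε                 ∎
      small m k M≤m M≤k (inj₂ h) = begin-strict
        ∣ s m ℚ.- s k ∣    ≡⟨ h ⟩
        ℚ.- (s m ℚ.- s k)  ≡⟨ solve 2 (λ a b → :- (a :- b) := b :- a) refl (s m) (s k) ⟩
        s k ℚ.- s m        <⟨ s-s<e k m ⟩
        e m                <⟨ e<ε m M≤m ⟩
        ε                  ∎

    n/1 : ℚ
    n/1 = + n ℚ./ 1

    square-lower : ∀ k → s k ℚ.* s k ℚ.≤ n/1
    square-lower k = ≡.subst (ℚ._≤ n/1) (≡.sym (frac-sq (√-num n k) k))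
      (frac-mono-≤ {√-num n k ℕ.* √-num n k} {n} {k ℕ.+ k ℕ.* suc k} {0}
        (≡.subst (ℕ._≤ n ℕ.* (suc k ℕ.* suc k)) (≡.sym (ℕ.*-identityʳ _)) (num-lower k)))

    square-upper : ∀ k → n/1 ℚ.< (s k ℚ.+ e k) ℚ.* (s k ℚ.+ e k)
    square-upper k = ≡.subst (λ x → n/1 ℚ.< x ℚ.* x) (frac-suc (√-num n k) k)
      (≡.subst (n/1 ℚ.<_) (≡.sym (frac-sq (suc (√-num n k)) k))
        (frac-mono-< {n} {suc (√-num n k) ℕ.* suc (√-num n k)} {0} {k ℕ.+ k ℕ.* suc k}
          (≡.subst (n ℕ.* (suc k ℕ.* suc k) ℕ.<_) (≡.sym (ℕ.*-identityʳ _)) (num-upper k))))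

    B : ℚ
    B = (t 0 ℚ.+ t 0) ℚ.+ 1ℚ

    0<e : ∀ k → 0ℚ ℚ.< e k
    0<e k = frac-mono-< {0} {1} {0} {k} (ℕ.s≤s ℕ.z≤n)

    e≤1 : ∀ k → e k ℚ.≤ 1ℚ
    e≤1 k = frac-mono-≤ {1} {1} {k} {0} (ℕ.s≤s ℕ.z≤n)

    s<t₀ : ∀ k → s k ℚ.< t 0
    s<t₀ k = frac-mono-< {√-num n k} {suc (√-num n 0)} {k} {0} (cross k 0)

    0<t₀ : 0ℚ ℚ.< t 0
    0<t₀ = frac-mono-< {0} {suc (√-num n 0)} {0} {0} (ℕ.s≤s ℕ.z≤n)

    0<B : 0ℚ ℚ.< B
    0<B = ℚ.+-mono-< (ℚ.+-mono-< 0<t₀ 0<t₀) (ℚ.positive⁻¹ 1ℚ)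

    gap : ∀ k → ∣ s k ℚ.* s k ℚ.- n/1 ∣ ℚ.≤ e k ℚ.* B
    gap k = begin
      ∣ s k ℚ.* s k ℚ.- n/1 ∣          ≡⟨ ∣-∣-sym (s k ℚ.* s k) n/1 ⟩
      ∣ n/1 ℚ.- s k ℚ.* s k ∣          ≡⟨ ℚ.0≤p⇒∣p∣≡p 0≤gap ⟩
      n/1 ℚ.- s k ℚ.* s k              ≤⟨ ℚ.+-monoˡ-≤ (ℚ.- (s k ℚ.* s k)) (ℚ.<⇒≤ (square-upper k)) ⟩
      (s k ℚ.+ e k) ℚ.* (s k ℚ.+ e k) ℚ.- s k ℚ.* s k
        ≡⟨ solve 2 (λ s e → (s :+ e) :* (s :+ e) :- s :* s := e :* ((s :+ s) :+ e)) refl (s k) (e k) ⟩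
      e k ℚ.* ((s k ℚ.+ s k) ℚ.+ e k)
        ≤⟨ ℚ.*-monoˡ-≤-nonNeg (e k) {{ℚ.nonNegative (ℚ.<⇒≤ (0<e k))}}
             (ℚ.+-mono-≤ (ℚ.+-mono-≤ (ℚ.<⇒≤ (s<t₀ k)) (ℚ.<⇒≤ (s<t₀ k))) (e≤1 k)) ⟩
      e k ℚ.* B ∎
      where
      0≤gap : 0ℚ ℚ.≤ n/1 ℚ.- s k ℚ.* s k
      0≤gap = ≡.subst (ℚ._≤ n/1 ℚ.- s k ℚ.* s k) (ℚ.+-inverseʳ (s k ℚ.* s k))
        (ℚ.+-monoˡ-≤ (ℚ.- (s k ℚ.* s k)) (square-lower k))

    close′ : ∀ ε → 0ℚ ℚ.< ε →
      ∃ λ M → ∀ k → M ℕ.≤ k → ∣ s k ℚ.* s k ℚ.- n/1 ∣ ℚ.< ε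
    close′ ε 0<ε =
      let δ , 0<δ , eq = divide 0<ε 0<B
          M , e<δ      = archimedean 0<δ
      in M , λ k M≤k → begin-strict
        ∣ s k ℚ.* s k ℚ.- n/1 ∣  ≤⟨ gap k ⟩
        e k ℚ.* B                <⟨ ℚ.*-monoˡ-<-pos B {{ℚ.positive 0<B}} (e<δ k M≤k) ⟩
        δ ℚ.* B                  ≡⟨ eq ⟩
        ε                        ∎

abstract
  √-cauchy : ∀ n → IsCauchy (√-seq n)
  √-cauchy = √-cauchy′

√ : ℕ → ℝ
seq    (√ n) = √-seq n
cauchy (√ n) = √-cauchy n

abstract
  √-square : ∀ n → √ n *ᴿ √ n ≈ᴿ fromℚ (+ n ℚ./ 1)
  √-square n = mk≈ᴿ (close′ n)

record ℂ : Set where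
  no-eta-equality
  field
    re im : ℝ

open ℂ public

infix 4 _≈ᶜ_ _,ᶜ_
record _≈ᶜ_ (z w : ℂ) : Set where
  constructor _,ᶜ_
  field
    re≈ : re z ≈ᴿ re w
    im≈ : im z ≈ᴿ im w

open _≈ᶜ_ public

infixl 6 _+ᶜ_
infixl 7 _*ᶜ_
infix  8 -ᶜ_

_+ᶜ_ _*ᶜ_ : ℂ → ℂ → ℂ
re (z +ᶜ w) = re z +ᴿ re w
im (z +ᶜ w) = im z +ᴿ im w
re (z *ᶜ w) = re z *ᴿ re w +ᴿ -ᴿ (im z *ᴿ im w)
im (z *ᶜ w) = re z *ᴿ im w +ᴿ im z *ᴿ re w

-ᶜ_ : ℂ → ℂ
re (-ᶜ z) = -ᴿ re z
im (-ᶜ z) = -ᴿ im z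

fromℝ : ℝ → ℂ
re (fromℝ x) = x
im (fromℝ x) = fromℚ 0ℚ

0ᶜ 1ᶜ : ℂ
0ᶜ = fromℝ (fromℚ 0ℚ)
1ᶜ = fromℝ (fromℚ 1ℚ)

private
  *-assoc-re : ∀ a b c d e f →
    (a ℚ.* c ℚ.+ ℚ.- (b ℚ.* d)) ℚ.* e ℚ.+ ℚ.- ((a ℚ.* d ℚ.+ b ℚ.* c) ℚ.* f)
      ≡ a ℚ.* (c ℚ.* e ℚ.+ ℚ.- (d ℚ.* f)) ℚ.+ ℚ.- (b ℚ.* (c ℚ.* f ℚ.+ d ℚ.* e))
  *-assoc-re = solve 6 (λ a b c d e f →
    (a :* c :+ :- (b :* d)) :* e :+ :- ((a :* d :+ b :* c) :* f)
      := a :* (c :* e :+ :- (d :* f)) :+ :- (b :* (c :* f :+ d :* e))) refl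

  *-assoc-im : ∀ a b c d e f →
    (a ℚ.* c ℚ.+ ℚ.- (b ℚ.* d)) ℚ.* f ℚ.+ (a ℚ.* d ℚ.+ b ℚ.* c) ℚ.* e
      ≡ a ℚ.* (c ℚ.* f ℚ.+ d ℚ.* e) ℚ.+ b ℚ.* (c ℚ.* e ℚ.+ ℚ.- (d ℚ.* f))
  *-assoc-im = solve 6 (λ a b c d e f →
    (a :* c :+ :- (b :* d)) :* f :+ (a :* d :+ b :* c) :* e
      := a :* (c :* f :+ d :* e) :+ b :* (c :* e :+ :- (d :* f))) refl

  *-identity-re : ∀ a b →
    1ℚ ℚ.* a ℚ.+ ℚ.- (0ℚ ℚ.* b)
      ≡ a
  *-identity-re = solve 2 (λ a b →
    con 1ℚ :* a :+ :- (con 0ℚ :* b)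
      := a) refl

  *-identity-im : ∀ a b →
    1ℚ ℚ.* b ℚ.+ 0ℚ ℚ.* a
      ≡ b
  *-identity-im = solve 2 (λ a b →
    con 1ℚ :* b :+ con 0ℚ :* a
      := b) refl

  distrib-re : ∀ a b c d e f →
    a ℚ.* (c ℚ.+ e) ℚ.+ ℚ.- (b ℚ.* (d ℚ.+ f))
      ≡ (a ℚ.* c ℚ.+ ℚ.- (b ℚ.* d)) ℚ.+ (a ℚ.* e ℚ.+ ℚ.- (b ℚ.* f))
  distrib-re = solve 6 (λ a b c d e f →
    a :* (c :+ e) :+ :- (b :* (d :+ f))
      := (a :* c :+ :- (b :* d)) :+ (a :* e :+ :- (b :* f))) refl

  distrib-im : ∀ a b c d e f →
    a ℚ.* (d ℚ.+ f) ℚ.+ b ℚ.* (c ℚ.+ e)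
      ≡ (a ℚ.* d ℚ.+ b ℚ.* c) ℚ.+ (a ℚ.* f ℚ.+ b ℚ.* e)
  distrib-im = solve 6 (λ a b c d e f →
    a :* (d :+ f) :+ b :* (c :+ e)
      := (a :* d :+ b :* c) :+ (a :* f :+ b :* e)) refl

  *-comm-re : ∀ a b c d →
    a ℚ.* c ℚ.+ ℚ.- (b ℚ.* d)
      ≡ c ℚ.* a ℚ.+ ℚ.- (d ℚ.* b)
  *-comm-re = solve 4 (λ a b c d →
    a :* c :+ :- (b :* d)
      := c :* a :+ :- (d :* b)) refl

  *-comm-im : ∀ a b c d →
    a ℚ.* d ℚ.+ b ℚ.* c
      ≡ c ℚ.* b ℚ.+ d ℚ.* a
  *-comm-im = solve 4 (λ a b c d →
    a :* d :+ b :* c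
      := c :* b :+ d :* a) refl

abstract
  ≈ᶜ-isEquivalence : IsEquivalence _≈ᶜ_
  ≈ᶜ-isEquivalence = record
    { refl  = ≈ᴿ-refl ,ᶜ ≈ᴿ-refl
    ; sym   = λ p → ≈ᴿ-sym (re≈ p) ,ᶜ ≈ᴿ-sym (im≈ p)
    ; trans = λ p q → ≈ᴿ-trans (re≈ p) (re≈ q) ,ᶜ ≈ᴿ-trans (im≈ p) (im≈ q)
    }

  +ᶜ-cong : ∀ {x y u v} → x ≈ᶜ y → u ≈ᶜ v → x +ᶜ u ≈ᶜ y +ᶜ v
  +ᶜ-cong p q = +ᴿ-cong (re≈ p) (re≈ q) ,ᶜ +ᴿ-cong (im≈ p) (im≈ q)

  -ᶜ-cong : ∀ {x y} → x ≈ᶜ y → -ᶜ x ≈ᶜ -ᶜ y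
  -ᶜ-cong p = -ᴿ-cong (re≈ p) ,ᶜ -ᴿ-cong (im≈ p)

  *ᶜ-cong : ∀ {x y u v} → x ≈ᶜ y → u ≈ᶜ v → x *ᶜ u ≈ᶜ y *ᶜ v
  *ᶜ-cong p q =
    +ᴿ-cong (*ᴿ-cong (re≈ p) (re≈ q)) (-ᴿ-cong (*ᴿ-cong (im≈ p) (im≈ q))) ,ᶜ
    +ᴿ-cong (*ᴿ-cong (re≈ p) (im≈ q)) (*ᴿ-cong (im≈ p) (re≈ q))

  +ᶜ-assoc : ∀ z w v → (z +ᶜ w) +ᶜ v ≈ᶜ z +ᶜ (w +ᶜ v)
  +ᶜ-assoc z w v =
    pointwise (λ n → ℚ.+-assoc (seq (re z) n) (seq (re w) n) (seq (re v) n)) ,ᶜ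
    pointwise (λ n → ℚ.+-assoc (seq (im z) n) (seq (im w) n) (seq (im v) n))

  +ᶜ-comm : ∀ z w → z +ᶜ w ≈ᶜ w +ᶜ z
  +ᶜ-comm z w =
    pointwise (λ n → ℚ.+-comm (seq (re z) n) (seq (re w) n)) ,ᶜ
    pointwise (λ n → ℚ.+-comm (seq (im z) n) (seq (im w) n))

  +ᶜ-identityˡ : ∀ z → 0ᶜ +ᶜ z ≈ᶜ z
  +ᶜ-identityˡ z =
    pointwise (λ n → ℚ.+-identityˡ (seq (re z) n)) ,ᶜ
    pointwise (λ n → ℚ.+-identityˡ (seq (im z) n))

  +ᶜ-inverseˡ : ∀ z → -ᶜ z +ᶜ z ≈ᶜ 0ᶜ
  +ᶜ-inverseˡ z =
    pointwise (λ n → ℚ.+-inverseˡ (seq (re z) n)) ,ᶜ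
    pointwise (λ n → ℚ.+-inverseˡ (seq (im z) n))

  *ᶜ-assoc : ∀ z w v → (z *ᶜ w) *ᶜ v ≈ᶜ z *ᶜ (w *ᶜ v)
  *ᶜ-assoc z w v =
    pointwise (λ n → *-assoc-re (seq (re z) n) (seq (im z) n) (seq (re w) n) (seq (im w) n) (seq (re v) n) (seq (im v) n)) ,ᶜ
    pointwise (λ n → *-assoc-im (seq (re z) n) (seq (im z) n) (seq (re w) n) (seq (im w) n) (seq (re v) n) (seq (im v) n))

  *ᶜ-comm : ∀ z w → z *ᶜ w ≈ᶜ w *ᶜ z
  *ᶜ-comm z w =
    pointwise (λ n → *-comm-re (seq (re z) n) (seq (im z) n) (seq (re w) n) (seq (im w) n)) ,ᶜ
    pointwise (λ n → *-comm-im (seq (re z) n) (seq (im z) n) (seq (re w) n) (seq (im w) n))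

  *ᶜ-identityˡ : ∀ z → 1ᶜ *ᶜ z ≈ᶜ z
  *ᶜ-identityˡ z =
    pointwise (λ n → *-identity-re (seq (re z) n) (seq (im z) n)) ,ᶜ
    pointwise (λ n → *-identity-im (seq (re z) n) (seq (im z) n))

  *ᶜ-distribˡ-+ᶜ : ∀ z w v → z *ᶜ (w +ᶜ v) ≈ᶜ z *ᶜ w +ᶜ z *ᶜ v
  *ᶜ-distribˡ-+ᶜ z w v =
    pointwise (λ n → distrib-re (seq (re z) n) (seq (im z) n) (seq (re w) n) (seq (im w) n) (seq (re v) n) (seq (im v) n)) ,ᶜ
    pointwise (λ n → distrib-im (seq (re z) n) (seq (im z) n) (seq (re w) n) (seq (im w) n) (seq (re v) n) (seq (im v) n))

private
  ≈ᶜ-setoid : Setoid 0ℓ 0ℓ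
  ≈ᶜ-setoid = record { isEquivalence = ≈ᶜ-isEquivalence }

  open import Algebra.Consequences.Setoid ≈ᶜ-setoid
    using (comm∧idˡ⇒id; comm∧invˡ⇒inv; comm∧distrˡ⇒distr)

ℂ-commutativeRing : CommutativeRing 0ℓ 0ℓ
ℂ-commutativeRing = record
  { Carrier = ℂ
  ; _≈_ = _≈ᶜ_
  ; _+_ = _+ᶜ_
  ; _*_ = _*ᶜ_
  ; -_ = -ᶜ_
  ; 0# = 0ᶜ
  ; 1# = 1ᶜ
  ; isCommutativeRing = record
    { isRing = record
      { +-isAbelianGroup = record
        { isGroup = record
          { isMonoid = record
            { isSemigroup = record
              { isMagma = record
                { isEquivalence = ≈ᶜ-isEquivalence
                ; ∙-cong = +ᶜ-cong
                }
              ; assoc = +ᶜ-assoc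
              }
            ; identity = comm∧idˡ⇒id +ᶜ-comm +ᶜ-identityˡ
            }
          ; inverse = comm∧invˡ⇒inv +ᶜ-comm +ᶜ-inverseˡ
          ; ⁻¹-cong = -ᶜ-cong
          }
        ; comm = +ᶜ-comm
        }
      ; *-cong = *ᶜ-cong
      ; *-assoc = *ᶜ-assoc
      ; *-identity = comm∧idˡ⇒id *ᶜ-comm *ᶜ-identityˡ
      ; distrib = comm∧distrˡ⇒distr +ᶜ-cong *ᶜ-comm *ᶜ-distribˡ-+ᶜ
      }
    ; *-comm = *ᶜ-comm
    }
  }

open CommutativeRing ℂ-commutativeRing public
  using (_≈_; _+_; _*_; -_; 0#; 1#)
open import Algebra.Properties.Semiring.Exp (CommutativeRing.semiring ℂ-commutativeRing) public
  using (_^_)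

-- Membership of ℂ^×, constructively: x ≉ 0# alone does not provide an
-- inverse.  The inverse is unique up to _≈_, so 1/_ does not depend on the
-- witness.
IsUnit : ℂ → Set
IsUnit = Invertible _≈_ 1# _*_

infix 9 1/_
1/_ : ∀ {z} → IsUnit z → ℂ
1/_ = proj₁

*-isUnit : ∀ {z w} → IsUnit z → IsUnit w → IsUnit (z * w)
*-isUnit {z} {w} (z⁻¹ , zˡ , zʳ) (w⁻¹ , wˡ , wʳ) = z⁻¹ * w⁻¹ ,
  C.trans (interchange z⁻¹ w⁻¹ z w) (C.trans (C.*-cong zˡ wˡ) (C.*-identityˡ 1#)) ,
  C.trans (interchange z w z⁻¹ w⁻¹) (C.trans (C.*-cong zʳ wʳ) (C.*-identityˡ 1#))
  where
  module C = CommutativeRing ℂ-commutativeRing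
  open import Algebra.Properties.CommutativeSemigroup C.*-commutativeSemigroup
    using (interchange)

1/-isUnit : ∀ {z} (u : IsUnit z) → IsUnit (1/ u)
1/-isUnit {z} (z⁻¹ , zˡ , zʳ) = z , zʳ , zˡ

√ᶜ : ℕ → ℂ
√ᶜ n = fromℝ (√ n)

private
  fromℚᶜ : ℚ → ℂ
  fromℚᶜ q = fromℝ (fromℚ q)

abstract
  √ᶜ-inverse : ∀ n .{{_ : ℕ.NonZero n}} → √ᶜ n * (√ᶜ n * fromℚᶜ (+ 1 ℚ./ n)) ≈ 1#
  √ᶜ-inverse n@(suc m) =
    ≈ᴿ-trans
      (pointwise (λ k → solve 2 (λ a q →
        a :* (a :* q :+ :- (con 0ℚ :* con 0ℚ)) :+ :- (con 0ℚ :* (a :* con 0ℚ :+ con 0ℚ :* q))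
          := (a :* a) :* q) refl (√-seq n k) (+ 1 ℚ./ n)))
      (≈ᴿ-trans
        (*ᴿ-cong (√-square n) (≈ᴿ-refl {fromℚ (+ 1 ℚ./ n)}))
        (pointwise (λ _ → n*1/n)))
    ,ᶜ
    pointwise (λ k → solve 2 (λ a q →
      a :* (a :* con 0ℚ :+ con 0ℚ :* q) :+ con 0ℚ :* (a :* q :+ :- (con 0ℚ :* con 0ℚ))
        := con 0ℚ) refl (√-seq n k) (+ 1 ℚ./ n))
    where
    n*1/n : (+ n ℚ./ 1) ℚ.* (+ 1 ℚ./ n) ≡ 1ℚ
    n*1/n = ≡.trans (≡.sym (fromℚᵘ-homo-* (frac n 0) (frac 1 m)))
      (ℚ.fromℚᵘ-cong {frac n 0 ℚᵘ.* frac 1 m} {frac 1 0} (*≡* (begin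
        (+ n ℤ.* + 1) ℤ.* + 1   ≡⟨ ℤ.*-identityʳ (+ n ℤ.* + 1) ⟩
        + n ℤ.* + 1             ≡⟨ ℤ.*-identityʳ (+ n) ⟩
        + n                     ≡⟨ ≡.cong +_ (ℕ.*-identityˡ n) ⟨
        + (1 ℕ.* n)             ≡⟨ ℤ.*-identityˡ (+ (1 ℕ.* n)) ⟨
        + 1 ℤ.* + (1 ℕ.* n)     ∎)))
      where open ≡.≡-Reasoning

√ᶜ-isUnit : ∀ n .{{_ : ℕ.NonZero n}} → IsUnit (√ᶜ n)
√ᶜ-isUnit n = inv , C.trans (C.*-comm inv (√ᶜ n)) (√ᶜ-inverse n) , √ᶜ-inverse n
  where
  module C = CommutativeRing ℂ-commutativeRing
  inv = √ᶜ n * fromℚᶜ (+ 1 ℚ./ n)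

record MetricGroup c ℓ : Set (lsuc (c ⊔ ℓ)) where
  field
    group : AbelianGroup c ℓ

  open AbelianGroup group public using (Carrier) renaming
    ( _≈_ to _≈ᴳ_; _∙_ to _+ᴳ_; ε to 0ᴳ; _⁻¹ to -ᴳ_; setoid to setoidᴳ )

  infixl 6 _-ᴳ_
  _-ᴳ_ : Carrier → Carrier → Carrier
  x -ᴳ y = x +ᴳ (-ᴳ y)

  field
    N           : ℕ
    enumeration : Inverse setoidᴳ (≡.setoid (Fin N))

    ⟨_⟩         : Carrier → ℂ
    ⟨⟩-cong     : ∀ {x y} → x ≈ᴳ y → ⟨ x ⟩ ≈ ⟨ y ⟩
    ⟨⟩-isUnit   : ∀ x → IsUnit ⟨ x ⟩
    ⟨⟩-even     : ∀ x → ⟨ x ⟩ ≈ ⟨ -ᴳ x ⟩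

  ⟨_⟩⁻¹ : Carrier → ℂ
  ⟨ x ⟩⁻¹ = 1/ ⟨⟩-isUnit x

  ⟨_⨾_⟩ : Carrier → Carrier → ℂ
  ⟨ x ⨾ y ⟩ = ⟨ x +ᴳ y ⟩ * 1/ *-isUnit (⟨⟩-isUnit x) (⟨⟩-isUnit y)

  ⟨⨾⟩-isUnit : ∀ x y → IsUnit ⟨ x ⨾ y ⟩
  ⟨⨾⟩-isUnit x y = *-isUnit (⟨⟩-isUnit (x +ᴳ y))
                            (1/-isUnit (*-isUnit (⟨⟩-isUnit x) (⟨⟩-isUnit y)))

  ⟨_⨾_⟩⁻¹ : Carrier → Carrier → ℂ
  ⟨ x ⨾ y ⟩⁻¹ = 1/ ⟨⨾⟩-isUnit x y

  field
    bicharacterˡ  : ∀ x y z → ⟨ x +ᴳ y ⨾ z ⟩ ≈ ⟨ x ⨾ z ⟩ * ⟨ y ⨾ z ⟩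
    bicharacterʳ  : ∀ x y z → ⟨ x ⨾ y +ᴳ z ⟩ ≈ ⟨ x ⨾ y ⟩ * ⟨ x ⨾ z ⟩
    nondegenerate : ∀ x → (∀ y → ⟨ x ⨾ y ⟩ ≈ 1#) → x ≈ᴳ 0ᴳ

  ∑ : (Carrier → ℂ) → ℂ
  ∑ f = sum {N} (λ i → f (Inverse.from enumeration i))
    where
    open Sum (CommutativeRing.+-commutativeMonoid ℂ-commutativeRing) using (sum)

  infix 2 ∑-syntax
  ∑-syntax : (Carrier → ℂ) → ℂ
  ∑-syntax = ∑
  syntax ∑-syntax (λ x → e) = ∑[ x ] e

  √N : ℂ
  √N = √ᶜ N

  1/√N : ℂ
  1/√N = 1/ √ᶜ-isUnit N {{nonZeroIndex (Inverse.to enumeration 0ᴳ)}}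

  fourier : (Carrier → ℂ) → (Carrier → ℂ)
  fourier f y = 1/√N * (∑[ x ] f x * ⟨ x ⨾ -ᴳ y ⟩)

record IsFiniteQuantumDilogarithm {c ℓ} (G : MetricGroup c ℓ)
         (E : MetricGroup.Carrier G → ℂ) (C : ℂ) : Set (c ⊔ ℓ) where
  open MetricGroup G
  field
    nontrivial : 1 ℕ.< N
    E-cong     : ∀ {x y} → x ≈ᴳ y → E x ≈ E y
    C-isUnit   : IsUnit C
    pentagon   : ∀ x y →
      ⟨ x ⨾ y ⟩ * E x * E y ≈
        C + 1/√N * (∑[ z ] E (y -ᴳ z) * E z * ⟨ z ⟩ * E (x -ᴳ z))

module Submission where

{-
Write Ê for the Fourier transform of E, Δ k for √N times the indicator of k = 0,
and W y for the Fourier transform of z ↦ E(y - z) E(z) ⟨z⟩.  Transforming the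
pentagon equation in x gives
  Ê(k - y) E(y) = C Δ(k) + Ê(k) W(y, k),
and z ↦ y - z in the sum gives ⟨k⟩ W(y, k) = ⟨y - k⟩ W(y, y - k).  Playing these
against each other shows that E and Ê vanish nowhere off 0, that Ê(k) Ê(-k) / ⟨k⟩
is constant there, and hence that, with constants λ and a,
  Ê(y) = λ ⟨y⟩ E(y)  and  ⟨y⟩ E(y) E(-y) = a  (y ≠ 0).
Put p = E(0) and r = Ê(0) / λ; then p² = √N p + a and r² = √N a r + a.
Now all values of W are known, and inverting the Fourier transform yields, with
d = a (r - p) / √N,
  (a p - r) E(y) = d (1 + ⟨y⟩⁻¹),  (a - 1) E(u) E(v) = d (⟨u⟩⁻¹ + ⟨v⟩⁻¹)
for y, u, v and u + v nonzero.  If d ≠ 0 these force ⟨·⟩ to be constant off 0,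
and for N > 4 the bicharacter is then trivial, contradicting nondegeneracy.
So r = p, and the two quadratic equations give a = 1.  The rest is Fourier
calculus.

Constructively, equations between complex numbers are stable under double
negation, so they may be proved by contradiction.
-}

open import Defs
open import Algebra.Bundles using (AbelianGroup; CommutativeRing)
import Algebra.Properties.AbelianGroup as AbelianGroupProperties
open import Data.Empty using (⊥; ⊥-elim)
open import Data.Fin.Base using (Fin; zero; suc)
import Data.Fin.Properties as Fin
open import Data.Fin.Permutation using (permutation)
open import Data.Integer.Base as ℤ using (+_)
import Data.Integer.Properties as ℤ
open import Data.Nat.Base as ℕ using (ℕ; zero; suc)
import Data.Nat.Properties as ℕ
open import Data.Product using (∃; Σ-syntax; _×_; _,_; proj₁; proj₂)
open import Data.Rational.Base as ℚ using (ℚ; 0ℚ; 1ℚ; ½; ∣_∣)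
import Data.Rational.Properties as ℚ
import Data.Rational.Solver as ℚ
import Data.Rational.Unnormalised.Base as ℚᵘ
import Data.Rational.Unnormalised.Properties as ℚᵘ
open import Data.Sum.Base using (_⊎_; inj₁; inj₂)
open import Data.Vec.Base using (Vec; []; _∷_; lookup)
open import Function.Bundles using (Inverse)
import Relation.Binary.Reasoning.Setoid as SetoidReasoning
open import Relation.Binary.PropositionalEquality as ≡ using (_≡_; _≢_; refl)
open import Relation.Nullary using (¬_; Dec; yes; no)
import Relation.Nullary.Decidable as Dec

module R where
  open CommutativeRing ℂ-commutativeRing public
    hiding (Carrier; _≈_; _+_; _*_; -_; 0#; 1#)
  open import Algebra.Properties.Semiring.Sum semiring public
    using (sum; sum-cong-≋; sum-permute; sum-replicate-zero; ∑-comm; ∑-distrib-+; *-distribˡ-sum)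
  open import Algebra.Properties.Ring ring public
    using (+-cancelʳ; +-inverseˡ-unique; x≈y⇒x∙y⁻¹≈ε; x∙y⁻¹≈ε⇒x≈y; -‿distribʳ-*)
  open import Algebra.Solver.Ring.NaturalCoefficients.Default commutativeSemiring public
    using (solve; _:=_; _:+_; _:*_; con)

-- Cauchy reals: stable equality, no zero divisors, and the transfer to `ℂ`.

module Completeness where

  open ℚ.+-*-Solver

  0<½* : ∀ {ε} → 0ℚ ℚ.< ε → 0ℚ ℚ.< ½ ℚ.* ε
  0<½* 0<ε = ℚ.*-monoʳ-<-pos ½ 0<ε

  ½+½ : ∀ ε → ½ ℚ.* ε ℚ.+ ½ ℚ.* ε ≡ ε
  ½+½ ε = ≡.trans (≡.sym (ℚ.*-distribʳ-+ ε ½ ½)) (ℚ.*-identityˡ ε)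

  *-pos : ∀ {p q} → 0ℚ ℚ.< p → 0ℚ ℚ.< q → 0ℚ ℚ.< p ℚ.* q
  *-pos {p} {q} 0<p 0<q =
    ℚ.positive⁻¹ (p ℚ.* q) {{ℚ.pos*pos⇒pos p {{ℚ.positive 0<p}} q {{ℚ.positive 0<q}}}}

  ∣*∣-lower : ∀ {p q δ η} → 0ℚ ℚ.< δ → δ ℚ.≤ ∣ p ∣ → η ℚ.≤ ∣ q ∣ → δ ℚ.* η ℚ.≤ ∣ p ℚ.* q ∣
  ∣*∣-lower {p} {q} {δ} {η} 0<δ δ≤ η≤ = begin
    δ ℚ.* η          ≤⟨ ℚ.*-monoˡ-≤-nonNeg δ {{ℚ.nonNegative (ℚ.<⇒≤ 0<δ)}} η≤ ⟩
    δ ℚ.* ∣ q ∣      ≤⟨ ℚ.*-monoʳ-≤-nonNeg ∣ q ∣ {{ℚ.∣-∣-nonNeg q}} δ≤ ⟩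
    ∣ p ∣ ℚ.* ∣ q ∣  ≡⟨ ℚ.∣p*q∣≡∣p∣*∣q∣ p q ⟨
    ∣ p ℚ.* q ∣      ∎
    where open ℚ.≤-Reasoning

  ∣square∣ : ∀ p → ∣ p ℚ.* p ∣ ≡ p ℚ.* p
  ∣square∣ p with ℚ.∣p∣≡p∨∣p∣≡-p p
  ... | inj₁ e = ≡.trans (ℚ.∣p*q∣≡∣p∣*∣q∣ p p) (≡.cong₂ ℚ._*_ e e)
  ... | inj₂ e = ≡.trans (ℚ.∣p*q∣≡∣p∣*∣q∣ p p) (≡.trans (≡.cong₂ ℚ._*_ e e)
                   (solve 1 (λ p → (:- p) :* (:- p) := p :* p) refl p))

  ∣square∣≤∣sum-of-squares∣ : ∀ p q → ∣ p ℚ.* p ∣ ℚ.≤ ∣ p ℚ.* p ℚ.+ q ℚ.* q ∣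
  ∣square∣≤∣sum-of-squares∣ p q = begin
    ∣ p ℚ.* p ∣                ≡⟨ ∣square∣ p ⟩
    p ℚ.* p                    ≡⟨ ℚ.+-identityʳ (p ℚ.* p) ⟨
    p ℚ.* p ℚ.+ 0ℚ             ≤⟨ ℚ.+-monoʳ-≤ (p ℚ.* p) (0≤square q) ⟩
    p ℚ.* p ℚ.+ q ℚ.* q        ≡⟨ ℚ.0≤p⇒∣p∣≡p (ℚ.+-mono-≤ (0≤square p) (0≤square q)) ⟨
    ∣ p ℚ.* p ℚ.+ q ℚ.* q ∣    ∎
    where
    open ℚ.≤-Reasoning
    0≤square : ∀ p → 0ℚ ℚ.≤ p ℚ.* p
    0≤square p = ≡.subst (0ℚ ℚ.≤_) (∣square∣ p) (ℚ.0≤∣p∣ (p ℚ.* p))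

  -- Stated for bare sequences, so that `close` of an equation `x ≈ᴿ y` computes to
  -- `Below (seq (x +ᴿ -ᴿ y))`. `AwayFrom0` carries an explicit bound: it is apartness from 0, not
  -- mere inequality.
  Below AwayFrom0 : (ℕ → ℚ) → ℚ → Set
  Below       f ε = ∃ λ M → ∀ n → M ℕ.≤ n → ∣ f n ∣ ℚ.< ε
  AwayFrom0 f δ = 0ℚ ℚ.< δ × ∃ λ M → ∀ n → M ℕ.≤ n → δ ℚ.≤ ∣ f n ∣

  -- Past the Cauchy index for ε/4 the tail stays within ε/4 of `seq x M`, so comparing that one
  -- rational with ε/2 is enough. The alternatives are not exclusive, which is what makes them
  -- decidable.
  dichotomy : ∀ x {ε} → 0ℚ ℚ.< ε → Below (seq x) ε ⊎ ∃ (AwayFrom0 (seq x))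
  dichotomy x {ε} 0<ε with cauchy x (½ ℚ.* (½ ℚ.* ε)) (0<½* (0<½* 0<ε))
  ... | M , c with ∣ seq x M ∣ ℚ.<? ½ ℚ.* ε
  ...   | yes small = inj₁ (M , λ n M≤n → begin-strict
          ∣ seq x n ∣
            ≡⟨ ≡.cong ∣_∣ (solve 2 (λ a b → a := (a :- b) :+ b) refl (seq x n) (seq x M)) ⟩
          ∣ (seq x n ℚ.- seq x M) ℚ.+ seq x M ∣
            ≤⟨ ℚ.∣p+q∣≤∣p∣+∣q∣ (seq x n ℚ.- seq x M) (seq x M) ⟩
          ∣ seq x n ℚ.- seq x M ∣ ℚ.+ ∣ seq x M ∣
            <⟨ ℚ.+-mono-< (c n M M≤n ℕ.≤-refl) small ⟩
          ½ ℚ.* (½ ℚ.* ε) ℚ.+ ½ ℚ.* ε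
            ≡⟨ ≡.cong (ℚ._+ ½ ℚ.* ε) (ℚ.+-identityˡ (½ ℚ.* (½ ℚ.* ε))) ⟨
          0ℚ ℚ.+ ½ ℚ.* (½ ℚ.* ε) ℚ.+ ½ ℚ.* ε
            ≤⟨ ℚ.+-monoˡ-≤ (½ ℚ.* ε) (ℚ.+-monoˡ-≤ (½ ℚ.* (½ ℚ.* ε)) (ℚ.<⇒≤ (0<½* (0<½* 0<ε)))) ⟩
          ½ ℚ.* (½ ℚ.* ε) ℚ.+ ½ ℚ.* (½ ℚ.* ε) ℚ.+ ½ ℚ.* ε
            ≡⟨ ≡.cong (ℚ._+ ½ ℚ.* ε) (½+½ (½ ℚ.* ε)) ⟩
          ½ ℚ.* ε ℚ.+ ½ ℚ.* ε
            ≡⟨ ½+½ ε ⟩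
          ε ∎)
    where open ℚ.≤-Reasoning
  ...   | no large = inj₂ (½ ℚ.* (½ ℚ.* ε) , 0<½* (0<½* 0<ε) , M , λ n M≤n →
          ℚ.≮⇒≥ λ n-small → large (begin-strict
            ∣ seq x M ∣
              ≡⟨ ≡.cong ∣_∣ (solve 2 (λ a b → a := (a :- b) :+ b) refl (seq x M) (seq x n)) ⟩
            ∣ (seq x M ℚ.- seq x n) ℚ.+ seq x n ∣
              ≤⟨ ℚ.∣p+q∣≤∣p∣+∣q∣ (seq x M ℚ.- seq x n) (seq x n) ⟩
            ∣ seq x M ℚ.- seq x n ∣ ℚ.+ ∣ seq x n ∣
              <⟨ ℚ.+-mono-< (c M n ℕ.≤-refl M≤n) n-small ⟩
            ½ ℚ.* (½ ℚ.* ε) ℚ.+ ½ ℚ.* (½ ℚ.* ε)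
              ≡⟨ ½+½ (½ ℚ.* ε) ⟩
            ½ ℚ.* ε ∎))
    where open ℚ.≤-Reasoning

  below∧away⇒⊥ : ∀ {f δ} → Below f δ → AwayFrom0 f δ → ⊥
  below∧away⇒⊥ (M , b) (_ , L , a) =
    ℚ.<-irrefl refl (ℚ.<-≤-trans (b (M ℕ.⊔ L) (ℕ.m≤m⊔n M L)) (a (M ℕ.⊔ L) (ℕ.m≤n⊔m M L)))

  0ᴿ-below : ∀ {x ε} → x ≈ᴿ fromℚ 0ℚ → 0ℚ ℚ.< ε → Below (seq x) ε
  0ᴿ-below {x} {ε} x≈0 0<ε with close x≈0 _ 0<ε
  ... | M , c = M , λ n M≤n → ≡.subst (λ t → ∣ t ∣ ℚ.< ε) (ℚ.+-identityʳ (seq x n)) (c n M≤n)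

  0ᴿ-from-below : ∀ x → (∀ {ε} → 0ℚ ℚ.< ε → Below (seq x) ε) → x ≈ᴿ fromℚ 0ℚ
  0ᴿ-from-below x b = mk≈ᴿ λ ε 0<ε → let M , c = b 0<ε in
    M , λ n M≤n → ≡.subst (λ t → ∣ t ∣ ℚ.< ε) (≡.sym (ℚ.+-identityʳ (seq x n))) (c n M≤n)

  -- At each ε `dichotomy` leaves only the small alternative, so a negative hypothesis yields a
  -- positive conclusion without Markov's principle.
  0ᴿ-from-¬away : ∀ x → ¬ ∃ (AwayFrom0 (seq x)) → x ≈ᴿ fromℚ 0ℚ
  0ᴿ-from-¬away x ¬away = 0ᴿ-from-below x below
    where
    below : ∀ {ε} → 0ℚ ℚ.< ε → Below (seq x) ε
    below 0<ε with dichotomy x 0<ε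
    ... | inj₁ b    = b
    ... | inj₂ away = ⊥-elim (¬away away)

  -- Apartness of the difference from 0 would refute `x ≈ᴿ y`, and a doubly negated equation already
  -- excludes that.
  ≈ᴿ-stable : ∀ {x y} → ¬ ¬ x ≈ᴿ y → x ≈ᴿ y
  ≈ᴿ-stable {x} {y} ¬¬eq = mk≈ᴿ λ ε 0<ε → below 0<ε
    where
    below : ∀ {ε} → 0ℚ ℚ.< ε → Below (seq (x +ᴿ -ᴿ y)) ε
    below 0<ε with dichotomy (x +ᴿ -ᴿ y) 0<ε
    ... | inj₁ b             = b
    ... | inj₂ (δ , 0<δ , a) = ⊥-elim (¬¬eq λ eq → below∧away⇒⊥ (close eq δ 0<δ) (0<δ , a))

  -- Lower bounds multiply: two factors apart from 0 have a product apart from 0. The negated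
  -- hypothesis on `x` suffices because `y ≈ᴿ fromℚ 0ℚ` follows once `y` is not apart from 0.
  *ᴿ-domain : ∀ {x y} → x *ᴿ y ≈ᴿ fromℚ 0ℚ → ¬ x ≈ᴿ fromℚ 0ℚ → y ≈ᴿ fromℚ 0ℚ
  *ᴿ-domain {x} {y} xy≈0 x≉0 = 0ᴿ-from-¬away y λ { (δ , 0<δ , M , y-away) →
    x≉0 (0ᴿ-from-¬away x λ { (η , 0<η , L , x-away) →
      below∧away⇒⊥ (0ᴿ-below xy≈0 (*-pos 0<η 0<δ))
        (*-pos 0<η 0<δ , M ℕ.⊔ L , λ n h → ∣*∣-lower {seq x n} {seq y n} 0<η
           (x-away n (ℕ.m⊔n≤o⇒n≤o M L h)) (y-away n (ℕ.m⊔n≤o⇒m≤o M L h))) }) }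

  sum-of-squares≈0 : ∀ {x y} → x *ᴿ x +ᴿ y *ᴿ y ≈ᴿ fromℚ 0ℚ → x ≈ᴿ fromℚ 0ℚ
  sum-of-squares≈0 {x} {y} eq = 0ᴿ-from-¬away x λ { (δ , 0<δ , M , away) →
    below∧away⇒⊥ (0ᴿ-below eq (*-pos 0<δ 0<δ))
      (*-pos 0<δ 0<δ , M , λ n h → ℚ.≤-trans
        (∣*∣-lower {seq x n} {seq x n} 0<δ (away n h) (away n h))
        (∣square∣≤∣sum-of-squares∣ (seq x n) (seq y n))) }

  ≈-stable : ∀ {z w} → ¬ ¬ z ≈ w → z ≈ w
  ≈-stable ¬¬eq = ≈ᴿ-stable (λ ¬p → ¬¬eq λ eq → ¬p (re≈ eq)) ,ᶜ
                  ≈ᴿ-stable (λ ¬p → ¬¬eq λ eq → ¬p (im≈ eq))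

  norm² : ℂ → ℝ
  norm² z = re z *ᴿ re z +ᴿ im z *ᴿ im z

  norm²≈0 : ∀ {z} → norm² z ≈ᴿ fromℚ 0ℚ → z ≈ 0#
  norm²≈0 {z} eq = sum-of-squares≈0 eq ,ᶜ sum-of-squares≈0 {im z} {re z} (≈ᴿ-trans
    (pointwise λ n → ℚ.+-comm (seq (im z) n ℚ.* seq (im z) n) (seq (re z) n ℚ.* seq (re z) n)) eq)

  norm²-* : ∀ z w → norm² z *ᴿ norm² w ≈ᴿ norm² (z *ᶜ w)
  norm²-* z w = pointwise λ n → solve 4 (λ a b c d →
      (a :* a :+ b :* b) :* (c :* c :+ d :* d)
        := (a :* c :+ :- (b :* d)) :* (a :* c :+ :- (b :* d))
           :+ (a :* d :+ b :* c) :* (a :* d :+ b :* c))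
    refl (seq (re z) n) (seq (im z) n) (seq (re w) n) (seq (im w) n)

  norm²-0 : ∀ {z} → z ≈ 0# → norm² z ≈ᴿ fromℚ 0ℚ
  norm²-0 (a ,ᶜ b) = ≈ᴿ-trans (+ᴿ-cong (*ᴿ-cong a a) (*ᴿ-cong b b)) (pointwise λ _ → refl)

  -- Multiplicativity of the squared modulus reduces this to the reals. It replaces division, since
  -- `¬ z ≈ 0#` supplies no inverse of `z`.
  *-domain : ∀ {z w} → z * w ≈ 0# → ¬ z ≈ 0# → w ≈ 0#
  *-domain {z} {w} zw≈0 z≉0 = norm²≈0 (*ᴿ-domain (≈ᴿ-trans (norm²-* z w) (norm²-0 zw≈0))
    (λ eq → z≉0 (norm²≈0 eq)))

  1≉0 : ¬ 1# ≈ 0#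
  1≉0 eq with close (re≈ eq) 1ℚ (ℚ.positive⁻¹ 1ℚ)
  ... | M , c = ℚ.<-irrefl refl (c M ℕ.≤-refl)

  suc/1 : ∀ n → + suc n ℚ./ 1 ≡ 1ℚ ℚ.+ (+ n ℚ./ 1)
  suc/1 n = ℚ.toℚᵘ-injective (begin-equality
    ℚ.toℚᵘ (+ suc n ℚ./ 1)              ≃⟨ ℚ.toℚᵘ-fromℚᵘ (ℚᵘ.mkℚᵘ (+ suc n) 0) ⟩
    ℚᵘ.mkℚᵘ (+ suc n) 0                 ≃⟨ ℚᵘ.*≡* (≡.cong (λ t → (+ 1 ℤ.+ t) ℤ.* + 1) (≡.sym (ℤ.*-identityʳ (+ n)))) ⟩
    ℚᵘ.1ℚᵘ ℚᵘ.+ ℚᵘ.mkℚᵘ (+ n) 0         ≃⟨ ℚᵘ.+-congʳ ℚᵘ.1ℚᵘ (ℚ.toℚᵘ-fromℚᵘ (ℚᵘ.mkℚᵘ (+ n) 0)) ⟨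
    ℚᵘ.1ℚᵘ ℚᵘ.+ ℚ.toℚᵘ (+ n ℚ./ 1)      ≃⟨ ℚ.toℚᵘ-homo-+ 1ℚ (+ n ℚ./ 1) ⟨
    ℚ.toℚᵘ (1ℚ ℚ.+ (+ n ℚ./ 1))         ∎)
    where open ℚᵘ.≤-Reasoning

  sum-1 : ∀ n → R.sum {n} (λ _ → 1#) ≈ fromℝ (fromℚ (+ n ℚ./ 1))
  sum-1 zero    = R.refl
  sum-1 (suc n) = R.trans (R.+-congˡ (sum-1 n))
    (pointwise (λ _ → ≡.sym (suc/1 n)) ,ᶜ pointwise (λ _ → refl))

  √ᶜ-square : ∀ n → √ᶜ n * √ᶜ n ≈ R.sum {n} (λ _ → 1#)
  √ᶜ-square n = R.trans
    (≈ᴿ-trans (pointwise λ k → ℚ.+-identityʳ (√-seq n k ℚ.* √-seq n k)) (√-square n)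
      ,ᶜ pointwise (λ k → solve 1 (λ a → a :* con 0ℚ :+ con 0ℚ :* a := con 0ℚ) refl (√-seq n k)))
    (R.sym (sum-1 n))

open Completeness using (*-domain; ≈-stable; 1≉0; √ᶜ-square)
open R using (_:*_; _:+_; _:=_; con)

-- Cancellation and linear combinations of equations in `ℂ`.

*-cancelˡ : ∀ {z w v} → ¬ z ≈ 0# → z * w ≈ z * v → w ≈ v
*-cancelˡ {z} {w} {v} z≉0 eq = R.x∙y⁻¹≈ε⇒x≈y w v (*-domain (R.trans
  (R.trans (R.distribˡ z w (- v)) (R.+-congˡ (R.sym (R.-‿distribʳ-* z v))))
  (R.x≈y⇒x∙y⁻¹≈ε eq)) z≉0)

isUnit⇒≉0 : ∀ {z} → IsUnit z → ¬ z ≈ 0#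
isUnit⇒≉0 (z⁻¹ , _ , inv) z≈0 = 1≉0 (R.trans (R.sym inv) (R.trans (R.*-congʳ z≈0) (R.zeroˡ z⁻¹)))

*-≉0 : ∀ {z w} → ¬ z ≈ 0# → ¬ w ≈ 0# → ¬ z * w ≈ 0#
*-≉0 z≉0 w≉0 eq = w≉0 (*-domain eq z≉0)

infixr 5.5 _·_
infixl 5 _⊕_

_·_ : ∀ c {z w} → z ≈ w → c * z ≈ c * w
c · p = R.*-congˡ p

_⊕_ : ∀ {z w u v} → z ≈ w → u ≈ v → z + u ≈ w + v
p ⊕ q = R.+-cong p q

-- If u ≈ v is a linear combination of the hypotheses, then z ≈ w follows from
-- z - w ≡ u - v.  This identity is stated without subtraction, as the solver
-- works over semirings.
linear : ∀ {z w u v} → u ≈ v → z + v ≈ w + u → z ≈ w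
linear {z} {w} {u} {v} p eq = R.+-cancelʳ v z w (R.trans eq (R.+-congˡ p))

-- The hypothesis says that the square of `1# + - s` vanishes. Were that number nonzero, cancelling
-- it once would make it zero; stability of equality concludes.
4s≈[1+s]²⇒s≈1 : ∀ {s} → s + s + s + s ≈ (1# + s) * (1# + s) → s ≈ 1#
4s≈[1+s]²⇒s≈1 {s} eq = R.sym (R.x∙y⁻¹≈ε⇒x≈y 1# s (≈-stable λ 1-s≉0 → 1-s≉0 (*-domain (linear
  (1# · R.sym eq ⊕ 1# + 1# + - s · R.-‿inverseʳ s ⊕ s · R.sym (R.-‿inverseʳ s))
  (R.solve 2 (λ s n →
     (con 1 :+ n) :* (con 1 :+ n)
       :+ (con 1 :* (s :+ s :+ s :+ s) :+ (con 1 :+ con 1 :+ n) :* con 0 :+ s :* (s :+ n))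
       := con 0 :+ (con 1 :* ((con 1 :+ s) :* (con 1 :+ s)) :+ (con 1 :+ con 1 :+ n) :* (s :+ n)
         :+ s :* con 0)) R.refl s (- s))) 1-s≉0)))

sum-single : ∀ {n} (f : Fin n → ℂ) i → (∀ j → j ≢ i → f j ≈ 0#) → R.sum f ≈ f i
sum-single {suc n} f zero    off = R.trans (R.+-congˡ (R.trans
  (R.sum-cong-≋ λ j → off (suc j) λ ()) (R.sum-replicate-zero n))) (R.+-identityʳ (f zero))
sum-single {suc n} f (suc i) off = R.trans
  (R.+-cong (off zero λ ()) (sum-single (λ j → f (suc j)) i λ j j≢i → off (suc j) λ { refl → j≢i refl }))
  (R.+-identityˡ (f (suc i)))

-- The bicharacter of a metric group.

module Characters {c ℓ} (G : MetricGroup c ℓ) where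

  open MetricGroup G renaming (⟨_⟩ to γ; ⟨_⟩⁻¹ to γ⁻¹)
  module 𝔾 where
    open AbelianGroup group public
      using ( refl; reflexive; sym; trans; assoc; comm; ∙-cong; ∙-congˡ; ∙-congʳ; ⁻¹-cong
            ; identityˡ; identityʳ; inverseˡ; inverseʳ )
    open AbelianGroupProperties group public
      using (ε⁻¹≈ε; ⁻¹-involutive; ⁻¹-anti-homo-∙; ⁻¹-∙-comm; x∙y⁻¹≈ε⇒x≈y; x≈y⇒x∙y⁻¹≈ε; inverseʳ-unique)

  -ᴳ-cong : ∀ {x y u v} → x ≈ᴳ y → u ≈ᴳ v → x -ᴳ u ≈ᴳ y -ᴳ v
  -ᴳ-cong p q = 𝔾.∙-cong p (𝔾.⁻¹-cong q)

  x-0≈x : ∀ x → x -ᴳ 0ᴳ ≈ᴳ x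
  x-0≈x x = 𝔾.trans (𝔾.∙-congˡ 𝔾.ε⁻¹≈ε) (𝔾.identityʳ x)

  0-x≈-x : ∀ x → 0ᴳ -ᴳ x ≈ᴳ -ᴳ x
  0-x≈-x x = 𝔾.identityˡ (-ᴳ x)

  -[x-y]≈y-x : ∀ x y → -ᴳ (x -ᴳ y) ≈ᴳ y -ᴳ x
  -[x-y]≈y-x x y = 𝔾.trans (𝔾.⁻¹-anti-homo-∙ x (-ᴳ y)) (𝔾.∙-congʳ (𝔾.⁻¹-involutive y))

  [x+y]-y≈x : ∀ x y → (x +ᴳ y) -ᴳ y ≈ᴳ x
  [x+y]-y≈x x y = 𝔾.trans (𝔾.assoc x y (-ᴳ y)) (𝔾.trans (𝔾.∙-congˡ (𝔾.inverseʳ y)) (𝔾.identityʳ x))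

  [x-y]+y≈x : ∀ x y → (x -ᴳ y) +ᴳ y ≈ᴳ x
  [x-y]+y≈x x y = 𝔾.trans (𝔾.assoc x (-ᴳ y) y) (𝔾.trans (𝔾.∙-congˡ (𝔾.inverseˡ y)) (𝔾.identityʳ x))

  y-[y-x]≈x : ∀ x y → y -ᴳ (y -ᴳ x) ≈ᴳ x
  y-[y-x]≈x x y = 𝔾.trans (𝔾.∙-congˡ (-[x-y]≈y-x y x)) (𝔾.trans (𝔾.comm y (x -ᴳ y)) ([x-y]+y≈x x y))

  [x-y]-x≈-y : ∀ x y → (x -ᴳ y) -ᴳ x ≈ᴳ -ᴳ y
  [x-y]-x≈-y x y = 𝔾.trans (𝔾.∙-congʳ (𝔾.comm x (-ᴳ y))) ([x+y]-y≈x (-ᴳ y) x)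

  x-[y+z]≈[x-z]-y : ∀ x y z → x -ᴳ (y +ᴳ z) ≈ᴳ (x -ᴳ z) -ᴳ y
  x-[y+z]≈[x-z]-y x y z = 𝔾.trans (𝔾.∙-congˡ (𝔾.⁻¹-anti-homo-∙ y z)) (𝔾.sym (𝔾.assoc x (-ᴳ z) (-ᴳ y)))

  -x≉0 : ∀ {x} → ¬ x ≈ᴳ 0ᴳ → ¬ -ᴳ x ≈ᴳ 0ᴳ
  -x≉0 {x} x≉0 eq = x≉0 (𝔾.trans (𝔾.sym (𝔾.⁻¹-involutive x)) (𝔾.trans (𝔾.⁻¹-cong eq) 𝔾.ε⁻¹≈ε))

  x-y≉0 : ∀ {x y} → ¬ x ≈ᴳ y → ¬ x -ᴳ y ≈ᴳ 0ᴳ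
  x-y≉0 {x} {y} x≉y eq = x≉y (𝔾.x∙y⁻¹≈ε⇒x≈y x y eq)

  infix 4 _≟ᴳ_
  _≟ᴳ_ : ∀ x y → Dec (x ≈ᴳ y)
  x ≟ᴳ y = Dec.map′
    (λ eq → 𝔾.trans (𝔾.sym (strictlyInverseʳ x)) (𝔾.trans (from-cong eq) (strictlyInverseʳ y)))
    to-cong (to x Fin.≟ to y)
    where open Inverse enumeration

  γ-inverse : ∀ x → γ x * γ⁻¹ x ≈ 1#
  γ-inverse x = proj₂ (proj₂ (⟨⟩-isUnit x))

  γ≉0 : ∀ x → ¬ γ x ≈ 0#
  γ≉0 x = isUnit⇒≉0 (⟨⟩-isUnit x)

  γ⁻¹-unique : ∀ {x z} → γ x * z ≈ 1# → z ≈ γ⁻¹ x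
  γ⁻¹-unique {x} eq = *-cancelˡ (γ≉0 x) (R.trans eq (R.sym (γ-inverse x)))

  γ⁻¹-cong : ∀ {x y} → x ≈ᴳ y → γ⁻¹ x ≈ γ⁻¹ y
  γ⁻¹-cong {x} {y} eq = γ⁻¹-unique (R.trans (R.*-congʳ (⟨⟩-cong (𝔾.sym eq))) (γ-inverse x))

  opaque
    χ : Carrier → Carrier → ℂ
    χ = ⟨_⨾_⟩

    χ-def : ∀ x y → χ x y ≈ ⟨ x ⨾ y ⟩
    χ-def x y = R.refl

    χ-cong : ∀ {x y u v} → x ≈ᴳ y → u ≈ᴳ v → χ x u ≈ χ y v
    χ-cong p q = R.*-cong (⟨⟩-cong (𝔾.∙-cong p q)) (R.*-cong (γ⁻¹-cong p) (γ⁻¹-cong q))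

    χ-sym : ∀ x y → χ x y ≈ χ y x
    χ-sym x y = R.*-cong (⟨⟩-cong (𝔾.comm x y)) (R.*-comm (γ⁻¹ x) (γ⁻¹ y))

    γ-+ : ∀ x y → γ (x +ᴳ y) ≈ χ x y * (γ x * γ y)
    γ-+ x y = R.sym (begin
      χ x y * (γ x * γ y)
        ≈⟨ R.solve 5 (λ s a b a′ b′ → (s :* (a′ :* b′)) :* (a :* b) := s :* ((a :* a′) :* (b :* b′)))
             R.refl (γ (x +ᴳ y)) (γ x) (γ y) (γ⁻¹ x) (γ⁻¹ y) ⟩
      γ (x +ᴳ y) * ((γ x * γ⁻¹ x) * (γ y * γ⁻¹ y))
        ≈⟨ R.*-congˡ (R.trans (R.*-cong (γ-inverse x) (γ-inverse y)) (R.*-identityˡ 1#)) ⟩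
      γ (x +ᴳ y) * 1#   ≈⟨ R.*-identityʳ (γ (x +ᴳ y)) ⟩
      γ (x +ᴳ y)        ∎)
      where
      open SetoidReasoning R.setoid

    χ-+ˡ : ∀ x y z → χ (x +ᴳ y) z ≈ χ x z * χ y z
    χ-+ˡ = bicharacterˡ

    χ-+ʳ : ∀ x y z → χ x (y +ᴳ z) ≈ χ x y * χ x z
    χ-+ʳ = bicharacterʳ

    χ-nondegenerate : ∀ {x} → (∀ y → χ x y ≈ 1#) → x ≈ᴳ 0ᴳ
    χ-nondegenerate {x} = nondegenerate x

  χ-inverse : ∀ x y → χ x y * ⟨ x ⨾ y ⟩⁻¹ ≈ 1#
  χ-inverse x y = R.trans (R.*-congʳ (χ-def x y)) (proj₂ (proj₂ (⟨⨾⟩-isUnit x y)))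

  χ≉0 : ∀ x y → ¬ χ x y ≈ 0#
  χ≉0 x y eq = isUnit⇒≉0 (⟨⨾⟩-isUnit x y) (R.trans (R.sym (χ-def x y)) eq)

  χ-0ˡ : ∀ y → χ 0ᴳ y ≈ 1#
  χ-0ˡ y = *-cancelˡ (χ≉0 0ᴳ y) (R.trans (R.sym (χ-+ˡ 0ᴳ 0ᴳ y))
    (R.trans (χ-cong (𝔾.identityˡ 0ᴳ) 𝔾.refl) (R.sym (R.*-identityʳ (χ 0ᴳ y)))))

  χ-0ʳ : ∀ x → χ x 0ᴳ ≈ 1#
  χ-0ʳ x = R.trans (χ-sym x 0ᴳ) (χ-0ˡ x)

  γ0≈1 : γ 0ᴳ ≈ 1#
  γ0≈1 = *-cancelˡ (γ≉0 0ᴳ) (begin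
    γ 0ᴳ * γ 0ᴳ              ≈⟨ R.*-identityˡ _ ⟨
    1# * (γ 0ᴳ * γ 0ᴳ)       ≈⟨ R.*-congʳ (χ-0ˡ 0ᴳ) ⟨
    χ 0ᴳ 0ᴳ * (γ 0ᴳ * γ 0ᴳ)  ≈⟨ γ-+ 0ᴳ 0ᴳ ⟨
    γ (0ᴳ +ᴳ 0ᴳ)             ≈⟨ ⟨⟩-cong (𝔾.identityˡ 0ᴳ) ⟩
    γ 0ᴳ                     ≈⟨ R.*-identityʳ (γ 0ᴳ) ⟨
    γ 0ᴳ * 1#                ∎)
    where open SetoidReasoning R.setoid

  γ-ᴳ : ∀ x y → γ (x -ᴳ y) ≈ χ x (-ᴳ y) * (γ x * γ y)
  γ-ᴳ x y = R.trans (γ-+ x (-ᴳ y)) (R.*-congˡ (R.*-congˡ (R.sym (⟨⟩-even y))))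

  γ[x-y]≈γ[y-x] : ∀ x y → γ (x -ᴳ y) ≈ γ (y -ᴳ x)
  γ[x-y]≈γ[y-x] x y = R.trans (⟨⟩-even (x -ᴳ y)) (⟨⟩-cong (-[x-y]≈y-x x y))

  χ-inverseʳ : ∀ x y → χ x (-ᴳ y) * χ x y ≈ 1#
  χ-inverseʳ x y = R.trans (R.sym (χ-+ʳ x (-ᴳ y) y))
    (R.trans (χ-cong 𝔾.refl (𝔾.inverseˡ y)) (χ-0ʳ x))

  χ-inverseˡ : ∀ x y → χ (-ᴳ x) y * χ x y ≈ 1#
  χ-inverseˡ x y = R.trans (R.sym (χ-+ˡ (-ᴳ x) x y))
    (R.trans (χ-cong (𝔾.inverseˡ x) 𝔾.refl) (χ-0ˡ y))

  χ-neg : ∀ x y → χ (-ᴳ x) y ≈ χ x (-ᴳ y)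
  χ-neg x y = *-cancelˡ (χ≉0 x y) (R.trans (R.*-comm (χ x y) (χ (-ᴳ x) y))
    (R.trans (χ-inverseˡ x y) (R.trans (R.sym (χ-inverseʳ x y)) (R.*-comm (χ x (-ᴳ y)) (χ x y)))))

  χ-inverse-unique : ∀ x y → χ x (-ᴳ y) ≈ ⟨ x ⨾ y ⟩⁻¹
  χ-inverse-unique x y = *-cancelˡ (χ≉0 x y) (R.trans (R.*-comm (χ x y) (χ x (-ᴳ y)))
    (R.trans (χ-inverseʳ x y) (R.sym (χ-inverse x y))))

  -- Normalised sums and the Fourier transform.

  Congruent : (Carrier → ℂ) → Set _
  Congruent f = ∀ {x y} → x ≈ᴳ y → f x ≈ f y

  √N*1/√N≈1 : √N * 1/√N ≈ 1#
  √N*1/√N≈1 = proj₂ (proj₂ (√ᶜ-isUnit N {{Fin.nonZeroIndex (Inverse.to enumeration 0ᴳ)}}))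

  √N≉0 : ¬ √N ≈ 0#
  √N≉0 = isUnit⇒≉0 (√ᶜ-isUnit N {{Fin.nonZeroIndex (Inverse.to enumeration 0ᴳ)}})

  open Inverse enumeration using (to; from; to-cong; from-cong; strictlyInverseˡ; strictlyInverseʳ)

  ∑-cong : ∀ {f g} → (∀ x → f x ≈ g x) → ∑ f ≈ ∑ g
  ∑-cong eq = R.sum-cong-≋ {N} λ i → eq (from i)

  opaque
    -- Opaque, like χ, so that unification recovers f from ∫ f.
    ∫ : (Carrier → ℂ) → ℂ
    ∫ f = 1/√N * ∑ f

    ∫-def : ∀ f → ∫ f ≈ 1/√N * ∑ f
    ∫-def f = R.refl

    ∫-cong : ∀ {f g} → (∀ x → f x ≈ g x) → ∫ f ≈ ∫ g
    ∫-cong eq = R.*-congˡ (R.sum-cong-≋ λ i → eq (from i))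

    ∫-+ : ∀ f g → ∫ (λ x → f x + g x) ≈ ∫ f + ∫ g
    ∫-+ f g = R.trans (R.*-congˡ (R.∑-distrib-+ {N} (λ i → f (from i)) (λ i → g (from i))))
      (R.distribˡ 1/√N (∑ f) (∑ g))

    ∫-*ˡ : ∀ z f → ∫ (λ x → z * f x) ≈ z * ∫ f
    ∫-*ˡ z f = R.trans (R.*-congˡ (R.sym (R.*-distribˡ-sum {N} z (λ i → f (from i)))))
      (R.solve 3 (λ d z s → d :* (z :* s) := z :* (d :* s)) R.refl 1/√N z (∑ f))

    ∫-swap : ∀ (f : Carrier → Carrier → ℂ) → ∫ (λ x → ∫ (f x)) ≈ ∫ (λ y → ∫ (λ x → f x y))
    ∫-swap f = R.*-congˡ (R.trans (R.sym (R.*-distribˡ-sum {N} 1/√N λ i → ∑ (f (from i))))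
      (R.trans (R.*-congˡ (R.∑-comm {N} {N} λ i j → f (from i) (from j)))
        (R.*-distribˡ-sum {N} 1/√N λ j → ∑ λ x → f x (from j))))

    -- The map x ↦ a - x is its own inverse, so one index map and one identity make the permutation.
    -- Negation and translation are then composed from reflections.
    ∫-reflect : ∀ {f} → Congruent f → ∀ a → ∫ (λ x → f (a -ᴳ x)) ≈ ∫ f
    ∫-reflect {f} f-cong a = R.*-congˡ (R.sym (R.trans
      (R.sum-permute (λ i → f (from i)) (permutation π π ππ ππ))
      (R.sum-cong-≋ λ i → f-cong (strictlyInverseʳ (a -ᴳ from i)))))
      where
      π : Fin N → Fin N
      π i = to (a -ᴳ from i)
      ππ : ∀ i → π (π i) ≡ i
      ππ i = ≡.trans (to-cong (𝔾.trans (-ᴳ-cong 𝔾.refl (strictlyInverseʳ (a -ᴳ from i)))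
        (y-[y-x]≈x (from i) a))) (strictlyInverseˡ i)

    ∫-single : ∀ {f} → Congruent f → ∀ a → (∀ x → ¬ x ≈ᴳ a → f x ≈ 0#) → ∫ f ≈ 1/√N * f a
    ∫-single {f} f-cong a off = R.*-congˡ (R.trans
      (sum-single (λ i → f (from i)) (to a) λ j j≢ → off (from j) λ eq →
        j≢ (≡.trans (≡.sym (strictlyInverseˡ j)) (to-cong eq)))
      (f-cong (strictlyInverseʳ a)))

    ∫-1 : ∫ (λ _ → 1#) ≈ √N
    ∫-1 = R.trans (R.*-congˡ (R.sym (√ᶜ-square N))) (linear (√N · √N*1/√N≈1)
      (R.solve 2 (λ s d → d :* (s :* s) :+ s :* con 1 := s :+ s :* (s :* d)) R.refl √N 1/√N))

  ∫-negate : ∀ {f} → Congruent f → ∫ (λ x → f (-ᴳ x)) ≈ ∫ f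
  ∫-negate f-cong = R.trans (∫-cong λ x → f-cong (𝔾.sym (0-x≈-x x))) (∫-reflect f-cong 0ᴳ)

  ∫-translate : ∀ {f} → Congruent f → ∀ a → ∫ (λ x → f (x +ᴳ a)) ≈ ∫ f
  ∫-translate {f} f-cong a = R.trans
    (R.sym (∫-negate {λ x → f (x +ᴳ a)} λ p → f-cong (𝔾.∙-congʳ p)))
    (R.trans (∫-cong λ x → f-cong (𝔾.comm (-ᴳ x) a)) (∫-reflect f-cong a))

  ∫-constant : ∀ z → ∫ (λ _ → z) ≈ z * √N
  ∫-constant z = R.trans (∫-cong λ _ → R.sym (R.*-identityʳ z))
    (R.trans (∫-*ˡ z (λ _ → 1#)) (R.*-congˡ ∫-1))

  𝓕 : (Carrier → ℂ) → Carrier → ℂ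
  𝓕 f y = ∫ λ x → f x * χ x (-ᴳ y)

  -- Kept as the integral of a character instead of a case distinction, the shape that swapping two
  -- integrals produces.
  Δ : Carrier → ℂ
  Δ k = ∫ (χ k)

  Δ-cong : Congruent Δ
  Δ-cong p = ∫-cong λ x → χ-cong p 𝔾.refl

  Δ-0 : ∀ {k} → k ≈ᴳ 0ᴳ → Δ k ≈ √N
  Δ-0 k≈0 = R.trans (∫-cong λ x → R.trans (χ-cong k≈0 𝔾.refl) (χ-0ˡ x)) ∫-1

  -- A nontrivial value χ k a ≉ 1 kills Δ k, as χ k a * Δ k ≈ Δ k.
  Δ-≉0 : ∀ {k} → ¬ k ≈ᴳ 0ᴳ → Δ k ≈ 0#
  Δ-≉0 {k} k≉0 = ≈-stable λ Δ≉0 → k≉0 (χ-nondegenerate λ a →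
    *-cancelˡ Δ≉0 (begin
      Δ k * χ k a                  ≈⟨ R.*-comm (Δ k) (χ k a) ⟩
      χ k a * Δ k                  ≈⟨ ∫-*ˡ (χ k a) (χ k) ⟨
      ∫ (λ x → χ k a * χ k x)      ≈⟨ ∫-cong (λ x → R.trans (R.*-comm (χ k a) (χ k x)) (R.sym (χ-+ʳ k x a))) ⟩
      ∫ (λ x → χ k (x +ᴳ a))       ≈⟨ ∫-translate {χ k} (χ-cong 𝔾.refl) a ⟩
      Δ k                          ≈⟨ R.*-identityʳ (Δ k) ⟨
      Δ k * 1#                     ∎))
    where open SetoidReasoning R.setoid

  Δ-neg : ∀ k → Δ (-ᴳ k) ≈ Δ k
  Δ-neg k = R.trans (∫-cong λ x → χ-neg k x) (∫-negate {χ k} (χ-cong 𝔾.refl))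

  ∫-sift : ∀ {f} → Congruent f → ∀ a → ∫ (λ x → f x * Δ (a -ᴳ x)) ≈ f a
  ∫-sift {f} f-cong a = begin
    ∫ (λ x → f x * Δ (a -ᴳ x))
      ≈⟨ ∫-single (λ p → R.*-cong (f-cong p) (Δ-cong (-ᴳ-cong 𝔾.refl p))) a
           (λ x x≉a → R.trans (R.*-congˡ (Δ-≉0 (x-y≉0 λ a≈x → x≉a (𝔾.sym a≈x)))) (R.zeroʳ (f x))) ⟩
    1/√N * (f a * Δ (a -ᴳ a))
      ≈⟨ R.*-congˡ (R.*-congˡ (Δ-0 (𝔾.inverseʳ a))) ⟩
    1/√N * (f a * √N)
      ≈⟨ R.solve 3 (λ d z s → d :* (z :* s) := (s :* d) :* z) R.refl 1/√N (f a) √N ⟩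
    (√N * 1/√N) * f a
      ≈⟨ R.*-congʳ √N*1/√N≈1 ⟩
    1# * f a
      ≈⟨ R.*-identityˡ (f a) ⟩
    f a ∎
    where open SetoidReasoning R.setoid

  fourier≈𝓕 : ∀ f y → fourier f y ≈ 𝓕 f y
  fourier≈𝓕 f y = R.trans (R.*-congˡ (∑-cong λ x → R.*-congˡ {f x} (R.sym (χ-def x (-ᴳ y))))) (R.sym (∫-def _))

  𝓕-cong : ∀ {f g} → (∀ x → f x ≈ g x) → ∀ y → 𝓕 f y ≈ 𝓕 g y
  𝓕-cong eq y = ∫-cong λ x → R.*-congʳ (eq x)

  𝓕-congruent : ∀ f → Congruent (𝓕 f)
  𝓕-congruent f p = ∫-cong λ x → R.*-congˡ (χ-cong 𝔾.refl (𝔾.⁻¹-cong p))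

  𝓕-1 : ∀ k → 𝓕 (λ _ → 1#) k ≈ Δ k
  𝓕-1 k = R.trans (∫-cong λ x → R.trans (R.*-identityˡ _) (χ-sym x (-ᴳ k))) (Δ-neg k)

  -- After the integrals are swapped, the two characters in `k` merge into `χ (w -ᴳ x) k`, whose
  -- integral is the point mass `Δ (w -ᴳ x)`.
  𝓕-inversion : ∀ {f} → Congruent f → ∀ w → ∫ (λ k → 𝓕 f k * χ w k) ≈ f w
  𝓕-inversion {f} f-cong w = begin
    ∫ (λ k → 𝓕 f k * χ w k)
      ≈⟨ ∫-cong (λ k → R.trans (R.*-comm (𝓕 f k) (χ w k)) (R.sym (∫-*ˡ (χ w k) _))) ⟩
    ∫ (λ k → ∫ λ x → χ w k * (f x * χ x (-ᴳ k)))
      ≈⟨ ∫-swap _ ⟩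
    ∫ (λ x → ∫ λ k → χ w k * (f x * χ x (-ᴳ k)))
      ≈⟨ ∫-cong (λ x → R.trans (∫-cong λ k → pointwise-eq x k) (∫-*ˡ (f x) (χ (w -ᴳ x)))) ⟩
    ∫ (λ x → f x * Δ (w -ᴳ x))
      ≈⟨ ∫-sift f-cong w ⟩
    f w ∎
    where
    open SetoidReasoning R.setoid
    pointwise-eq : ∀ x k → χ w k * (f x * χ x (-ᴳ k)) ≈ f x * χ (w -ᴳ x) k
    pointwise-eq x k = begin
      χ w k * (f x * χ x (-ᴳ k))  ≈⟨ R.solve 3 (λ a b c → a :* (b :* c) := b :* (a :* c)) R.refl (χ w k) (f x) (χ x (-ᴳ k)) ⟩
      f x * (χ w k * χ x (-ᴳ k))  ≈⟨ R.*-congˡ (R.*-congˡ (χ-neg x k)) ⟨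
      f x * (χ w k * χ (-ᴳ x) k)  ≈⟨ R.*-congˡ (χ-+ˡ w (-ᴳ x) k) ⟨
      f x * χ (w -ᴳ x) k          ∎

  ∫-0 : ∀ {f} → (∀ x → f x ≈ 0#) → ∫ f ≈ 0#
  ∫-0 f≈0 = R.trans (∫-cong f≈0) (R.trans (∫-constant 0#) (R.zeroˡ √N))

  ∫-*ʳ : ∀ f z → ∫ (λ x → f x * z) ≈ ∫ f * z
  ∫-*ʳ f z = R.trans (∫-cong λ x → R.*-comm (f x) z) (R.trans (∫-*ˡ z f) (R.*-comm z (∫ f)))

  -- Swap the integrals and translate `x` by `z`; the character then factors. Convolution and
  -- transform both carry `1/√N`, so no constant appears.
  𝓕-convolution : ∀ {g} → Congruent g → ∀ f k →
                  𝓕 (λ x → ∫ λ z → f z * g (x -ᴳ z)) k ≈ 𝓕 g k * 𝓕 f k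
  𝓕-convolution {g} g-cong f k = begin
    ∫ (λ x → ∫ (λ z → f z * g (x -ᴳ z)) * χ x (-ᴳ k))
      ≈⟨ ∫-cong (λ x → R.sym (∫-*ʳ _ (χ x (-ᴳ k)))) ⟩
    ∫ (λ x → ∫ λ z → f z * g (x -ᴳ z) * χ x (-ᴳ k))
      ≈⟨ ∫-swap _ ⟩
    ∫ (λ z → ∫ λ x → f z * g (x -ᴳ z) * χ x (-ᴳ k))
      ≈⟨ ∫-cong (λ z → R.trans (R.sym (∫-translate {λ x → f z * g (x -ᴳ z) * χ x (-ᴳ k)}
           (λ p → R.*-cong (R.*-congˡ (g-cong (-ᴳ-cong p 𝔾.refl))) (χ-cong p 𝔾.refl)) z))
           (R.trans (∫-cong λ x → shifted x z) (∫-*ˡ (f z * χ z (-ᴳ k)) _))) ⟩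
    ∫ (λ z → f z * χ z (-ᴳ k) * 𝓕 g k)
      ≈⟨ R.trans (∫-*ʳ _ (𝓕 g k)) (R.*-comm (𝓕 f k) (𝓕 g k)) ⟩
    𝓕 g k * 𝓕 f k ∎
    where
    open SetoidReasoning R.setoid
    shifted : ∀ x z → f z * g ((x +ᴳ z) -ᴳ z) * χ (x +ᴳ z) (-ᴳ k)
                    ≈ f z * χ z (-ᴳ k) * (g x * χ x (-ᴳ k))
    shifted x z = R.trans
      (R.*-cong (R.*-congˡ (g-cong ([x+y]-y≈x x z))) (χ-+ˡ x z (-ᴳ k)))
      (R.solve 4 (λ a b c d → (a :* b) :* (c :* d) := (a :* d) :* (b :* c)) R.refl
        (f z) (g x) (χ x (-ᴳ k)) (χ z (-ᴳ k)))

  𝓕-𝓕 : ∀ {f} → Congruent f → ∀ x → 𝓕 (𝓕 f) x ≈ f (-ᴳ x)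
  𝓕-𝓕 {f} f-cong x = R.trans (∫-cong λ k → R.*-congˡ (χ-sym k (-ᴳ x))) (𝓕-inversion f-cong (-ᴳ x))

  -- If the listed points covered the group, choosing a listed point for each of the `N` indices
  -- would contradict the pigeonhole principle; the search is finite, hence a witness.
  ∃-avoiding : ∀ {n} → n ℕ.< N → (xs : Fin n → Carrier) → ∃ λ x → ∀ i → ¬ x ≈ᴳ xs i
  ∃-avoiding {n} n<N xs = from (proj₁ missed) , λ i eq → proj₂ missed (i , eq)
    where
    missed : ∃ λ j → ¬ ∃ λ i → from j ≈ᴳ xs i
    missed = Fin.¬∀⟶∃¬ N _ (λ j → Fin.any? λ i → from j ≟ᴳ xs i) λ hit →
      let j , k , j<k , eq = Fin.pigeonhole n<N (λ j → proj₁ (hit j))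
          from-eq = 𝔾.trans (proj₂ (hit j)) (𝔾.trans
            (𝔾.reflexive (≡.cong xs eq)) (𝔾.sym (proj₂ (hit k))))
      in Fin.<⇒≢ j<k (≡.trans (≡.sym (strictlyInverseˡ j)) (≡.trans (to-cong from-eq) (strictlyInverseˡ k)))

-- The pentagon equation in Fourier space.

module Dilogarithm {c ℓ} (G : MetricGroup c ℓ) (E : MetricGroup.Carrier G → ℂ) (C : ℂ)
                   (isFQD : IsFiniteQuantumDilogarithm G E C) where

  open MetricGroup G renaming (⟨_⟩ to γ; ⟨_⟩⁻¹ to γ⁻¹)
  open IsFiniteQuantumDilogarithm isFQD
  open Characters G

  p : ℂ
  p = E 0ᴳ

  opaque
    Ê : Carrier → ℂ
    Ê = 𝓕 E

    Ê-def : ∀ k → Ê k ≈ 𝓕 E k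
    Ê-def k = R.refl

    Ê-cong : Congruent Ê
    Ê-cong = 𝓕-congruent E

  q : ℂ
  q = Ê 0ᴳ

  h : Carrier → Carrier → ℂ
  h y z = E (y -ᴳ z) * E z * γ z

  opaque
    W : Carrier → Carrier → ℂ
    W y k = 𝓕 (h y) k

    W-def : ∀ y k → W y k ≈ 𝓕 (h y) k
    W-def y k = R.refl

    W-cong : ∀ {y y′ k k′} → y ≈ᴳ y′ → k ≈ᴳ k′ → W y k ≈ W y′ k′
    W-cong {y} {y′} {k} p q = R.trans
      (𝓕-cong (λ z → R.*-congʳ (R.*-congʳ (E-cong (-ᴳ-cong p 𝔾.refl)))) k) (𝓕-congruent (h y′) q)

  h-cong : ∀ y → Congruent (h y)
  h-cong y eq = R.*-cong (R.*-cong (E-cong (-ᴳ-cong 𝔾.refl eq)) (E-cong eq)) (⟨⟩-cong eq)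

  C√N≉0 : ¬ C * √N ≈ 0#
  C√N≉0 = *-≉0 (isUnit⇒≉0 C-isUnit) √N≉0

  -- In this form the right side is, up to the constant, a convolution of `h y` with `E` in the
  -- variable `x`, ready for `𝓕-convolution`.
  ∫-pentagon : ∀ x y → χ x y * E x * E y ≈ C + ∫ (λ z → h y z * E (x -ᴳ z))
  ∫-pentagon x y = R.trans (R.*-congʳ (R.*-congʳ (χ-def x y)))
    (R.trans (pentagon x y) (R.+-congˡ (R.sym (∫-def _))))

  -- The Fourier transform of the pentagon equation in x.
  transformed-pentagon : ∀ k y → Ê (k -ᴳ y) * E y ≈ C * Δ k + Ê k * W y k
  transformed-pentagon k y = begin
    Ê (k -ᴳ y) * E y
      ≈⟨ R.*-congʳ (Ê-def (k -ᴳ y)) ⟩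
    𝓕 E (k -ᴳ y) * E y
      ≈⟨ ∫-*ʳ (λ x → E x * χ x (-ᴳ (k -ᴳ y))) (E y) ⟨
    ∫ (λ x → E x * χ x (-ᴳ (k -ᴳ y)) * E y)
      ≈⟨ ∫-cong integrand ⟩
    ∫ (λ x → C * (1# * χ x (-ᴳ k)) + ∫ (λ z → h y z * E (x -ᴳ z)) * χ x (-ᴳ k))
      ≈⟨ ∫-+ (λ x → C * (1# * χ x (-ᴳ k))) _ ⟩
    ∫ (λ x → C * (1# * χ x (-ᴳ k))) + 𝓕 (λ x → ∫ λ z → h y z * E (x -ᴳ z)) k
      ≈⟨ R.+-cong (R.trans (∫-*ˡ C (λ x → 1# * χ x (-ᴳ k))) (R.*-congˡ (𝓕-1 k)))
           (R.trans (𝓕-convolution E-cong (h y) k)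
             (R.*-cong (R.sym (Ê-def k)) (R.sym (W-def y k)))) ⟩
    C * Δ k + Ê k * W y k ∎
    where
    open SetoidReasoning R.setoid
    integrand : ∀ x → E x * χ x (-ᴳ (k -ᴳ y)) * E y
                    ≈ C * (1# * χ x (-ᴳ k)) + ∫ (λ z → h y z * E (x -ᴳ z)) * χ x (-ᴳ k)
    integrand x = begin
      E x * χ x (-ᴳ (k -ᴳ y)) * E y
        ≈⟨ R.*-congʳ (R.*-congˡ (R.trans (χ-cong 𝔾.refl (-[x-y]≈y-x k y)) (χ-+ʳ x y (-ᴳ k)))) ⟩
      E x * (χ x y * χ x (-ᴳ k)) * E y
        ≈⟨ R.solve 4 (λ a b c d → a :* (b :* c) :* d := (b :* a :* d) :* c) R.refl
             (E x) (χ x y) (χ x (-ᴳ k)) (E y) ⟩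
      (χ x y * E x * E y) * χ x (-ᴳ k)
        ≈⟨ R.*-congʳ (∫-pentagon x y) ⟩
      (C + ∫ (λ z → h y z * E (x -ᴳ z))) * χ x (-ᴳ k)
        ≈⟨ R.solve 3 (λ c i x → (c :+ i) :* x := c :* (con 1 :* x) :+ i :* x) R.refl
             C (∫ (λ z → h y z * E (x -ᴳ z))) (χ x (-ᴳ k)) ⟩
      C * (1# * χ x (-ᴳ k)) + ∫ (λ z → h y z * E (x -ᴳ z)) * χ x (-ᴳ k) ∎

  -- Substitute z ↦ y - z in W y k.
  W-symmetry : ∀ y k → γ k * W y k ≈ γ (y -ᴳ k) * W y (y -ᴳ k)
  W-symmetry y k = begin
    γ k * W y k
      ≈⟨ R.trans (R.*-congˡ (W-def y k)) (R.sym (∫-*ˡ (γ k) (λ z → h y z * χ z (-ᴳ k)))) ⟩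
    ∫ (λ z → γ k * (h y z * χ z (-ᴳ k)))
      ≈⟨ ∫-reflect {λ z → γ k * (h y z * χ z (-ᴳ k))}
           (λ p → R.*-congˡ (R.*-cong (h-cong y p) (χ-cong p 𝔾.refl))) y ⟨
    ∫ (λ z → γ k * (h y (y -ᴳ z) * χ (y -ᴳ z) (-ᴳ k)))
      ≈⟨ ∫-cong integrand ⟩
    ∫ (λ z → γ (y -ᴳ k) * (h y z * χ z (-ᴳ (y -ᴳ k))))
      ≈⟨ R.trans (∫-*ˡ (γ (y -ᴳ k)) (λ z → h y z * χ z (-ᴳ (y -ᴳ k))))
           (R.*-congˡ (R.sym (W-def y (y -ᴳ k)))) ⟩
    γ (y -ᴳ k) * W y (y -ᴳ k) ∎
    where
    open SetoidReasoning R.setoid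
    gauss : ∀ z → χ (y -ᴳ z) (-ᴳ k) * (γ (y -ᴳ z) * γ k)
                ≈ χ z (-ᴳ (y -ᴳ k)) * (γ z * γ (y -ᴳ k))
    gauss z = begin
      χ (y -ᴳ z) (-ᴳ k) * (γ (y -ᴳ z) * γ k)  ≈⟨ γ-ᴳ (y -ᴳ z) k ⟨
      γ (y -ᴳ z -ᴳ k)                         ≈⟨ ⟨⟩-cong (𝔾.trans (𝔾.assoc y (-ᴳ z) (-ᴳ k))
                                                   (𝔾.trans (𝔾.∙-congˡ (𝔾.comm (-ᴳ z) (-ᴳ k)))
                                                     (𝔾.sym (𝔾.assoc y (-ᴳ k) (-ᴳ z))))) ⟩
      γ (y -ᴳ k -ᴳ z)                         ≈⟨ γ[x-y]≈γ[y-x] (y -ᴳ k) z ⟩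
      γ (z -ᴳ (y -ᴳ k))                       ≈⟨ γ-ᴳ z (y -ᴳ k) ⟩
      χ z (-ᴳ (y -ᴳ k)) * (γ z * γ (y -ᴳ k))  ∎
    integrand : ∀ z → γ k * (h y (y -ᴳ z) * χ (y -ᴳ z) (-ᴳ k))
                    ≈ γ (y -ᴳ k) * (h y z * χ z (-ᴳ (y -ᴳ k)))
    integrand z = R.trans (R.*-congˡ (R.*-congʳ (R.*-congʳ (R.*-congʳ (E-cong (y-[y-x]≈x z y))))))
      (linear (E z * E (y -ᴳ z) · gauss z)
        (R.solve 8 (λ a b gyz gk χ₁ χ₂ gz gyk →
          gk :* (a :* b :* gyz :* χ₁) :+ a :* b :* (χ₂ :* (gz :* gyk))
            := gyk :* (b :* a :* gz :* χ₂) :+ a :* b :* (χ₁ :* (gyz :* gk))) R.refl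
          (E z) (E (y -ᴳ z)) (γ (y -ᴳ z)) (γ k) (χ (y -ᴳ z) (-ᴳ k))
          (χ z (-ᴳ (y -ᴳ k))) (γ z) (γ (y -ᴳ k))))

  W-diagonal : ∀ y → γ y * W y y ≈ W y 0ᴳ
  W-diagonal y = R.trans (W-symmetry y y) (R.trans
    (R.*-cong (R.trans (⟨⟩-cong (𝔾.inverseʳ y)) γ0≈1) (W-cong 𝔾.refl (𝔾.inverseʳ y)))
    (R.*-identityˡ (W y 0ᴳ)))

  ÊE-≉0 : ∀ {k} → ¬ k ≈ᴳ 0ᴳ → ∀ y → Ê (k -ᴳ y) * E y ≈ Ê k * W y k
  ÊE-≉0 {k} k≉0 y = R.trans (transformed-pentagon k y) (R.trans
    (R.+-congʳ (R.trans (R.*-congˡ (Δ-≉0 k≉0)) (R.zeroʳ C))) (R.+-identityˡ (Ê k * W y k)))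

  ÊE-0 : ∀ y → Ê (-ᴳ y) * E y ≈ C * √N + q * W y 0ᴳ
  ÊE-0 y = R.trans (R.*-congʳ (Ê-cong (𝔾.sym (0-x≈-x y)))) (R.trans
    (transformed-pentagon 0ᴳ y) (R.+-congʳ (R.*-congˡ (Δ-0 𝔾.refl))))

  -- Take `k = y` in the transformed pentagon and multiply by `γ y`: `W-diagonal` trades `W y y` for
  -- `W y 0ᴳ`.
  qE-≉0 : ∀ {y} → ¬ y ≈ᴳ 0ᴳ → q * (E y * γ y) ≈ Ê y * W y 0ᴳ
  qE-≉0 {y} y≉0 = linear
    (γ y · R.trans (R.*-congʳ (Ê-cong (𝔾.sym (𝔾.inverseʳ y)))) (ÊE-≉0 y≉0 y) ⊕ Ê y · W-diagonal y)
    (R.solve 6 (λ q e g f wyy w →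
       q :* (e :* g) :+ (g :* (f :* wyy) :+ f :* w) := f :* w :+ (g :* (q :* e) :+ f :* (g :* wyy)))
       R.refl q (E y) (γ y) (Ê y) (W y y) (W y 0ᴳ))

  -- Nonvanishing of `E` and `Ê`, and the products `Ê k * Ê (-ᴳ k)`.

  q≉0 : ¬ q ≈ 0#
  q≉0 q≈0 = C√N≉0 (linear
    (R.sym (ÊE-0 0ᴳ) ⊕ p · R.trans (Ê-cong 𝔾.ε⁻¹≈ε) q≈0 ⊕ W 0ᴳ 0ᴳ · R.sym q≈0)
    (R.solve 5 (λ cs q w e p → cs :+ (e :* p :+ p :* con 0 :+ w :* q)
       := con 0 :+ (cs :+ q :* w :+ p :* e :+ w :* con 0)) R.refl
       (C * √N) q (W 0ᴳ 0ᴳ) (Ê (-ᴳ 0ᴳ)) p))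

  -- Multiply `ÊE-0` by `Ê y` and eliminate `W y 0ᴳ` through `qE-≉0`: `C * √N * Ê y` becomes a
  -- multiple of `E y`.
  E≈0⇒Ê≈0 : ∀ {y} → ¬ y ≈ᴳ 0ᴳ → E y ≈ 0# → Ê y ≈ 0#
  E≈0⇒Ê≈0 {y} y≉0 Ey≈0 = *-domain (linear
    (Ê y · R.sym (ÊE-0 y) ⊕ q · qE-≉0 y≉0 ⊕ Ê y * Ê (-ᴳ y) · Ey≈0 ⊕ q * q * γ y · R.sym Ey≈0)
    (R.solve 7 (λ cs f f′ e g q w →
       cs :* f :+ (f :* (f′ :* e) :+ q :* (f :* w) :+ f :* f′ :* con 0 :+ q :* q :* g :* e)
         := con 0 :+ (f :* (cs :+ q :* w) :+ q :* (q :* (e :* g)) :+ f :* f′ :* e :+ q :* q :* g :* con 0))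
       R.refl (C * √N) (Ê y) (Ê (-ᴳ y)) (E y) (γ y) q (W y 0ᴳ))) C√N≉0

  -- A zero at `k` would kill every product `E (k -ᴳ y) * E y`, hence the integrand of `W k 0ᴳ`;
  -- then `ÊE-0` leaves `C * √N ≈ 0#`.
  E≉0 : ∀ {k} → ¬ k ≈ᴳ 0ᴳ → ¬ E k ≈ 0#
  E≉0 {k} k≉0 Ek≈0 = C√N≉0 (linear
    (R.sym (ÊE-0 k) ⊕ Ê (-ᴳ k) · Ek≈0 ⊕ q · R.sym W≈0)
    (R.solve 5 (λ cs f e q w → cs :+ (f :* e :+ f :* con 0 :+ q :* w)
       := con 0 :+ (cs :+ q :* w :+ f :* e :+ q :* con 0)) R.refl
       (C * √N) (Ê (-ᴳ k)) (E k) q (W k 0ᴳ)))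
    where
    EE≈0 : ∀ y → E (k -ᴳ y) * E y ≈ 0#
    EE≈0 y with y ≟ᴳ k
    ... | yes y≈k = R.trans (R.*-congˡ (R.trans (E-cong y≈k) Ek≈0)) (R.zeroʳ (E (k -ᴳ y)))
    -- `Ê (k -ᴳ y) * E y` vanishes because `Ê k` does, and `qE-≉0` at `k -ᴳ y` carries this over to
    -- `q * γ (k -ᴳ y) * (E (k -ᴳ y) * E y)`.
    ... | no  y≉k = *-domain (linear
      (E y · qE-≉0 k-y≉0 ⊕ W (k -ᴳ y) 0ᴳ · ÊE-≉0 k≉0 y ⊕ W (k -ᴳ y) 0ᴳ * W y k · E≈0⇒Ê≈0 k≉0 Ek≈0)
      (R.solve 8 (λ q g e e′ f w fk w′ →
         q :* g :* (e′ :* e) :+ (e :* (f :* w) :+ w :* (fk :* w′) :+ w :* w′ :* con 0)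
           := con 0 :+ (e :* (q :* (e′ :* g)) :+ w :* (f :* e) :+ w :* w′ :* fk)) R.refl
         q (γ (k -ᴳ y)) (E y) (E (k -ᴳ y)) (Ê (k -ᴳ y)) (W (k -ᴳ y) 0ᴳ) (Ê k) (W y k)))
      (*-≉0 q≉0 (γ≉0 (k -ᴳ y)))
      where
      k-y≉0 = x-y≉0 λ k≈y → y≉k (𝔾.sym k≈y)
    W≈0 : W k 0ᴳ ≈ 0#
    W≈0 = R.trans (W-def k 0ᴳ) (∫-0 λ z → R.trans
      (R.*-congʳ (R.trans (R.*-congʳ (EE≈0 z)) (R.zeroˡ (γ z)))) (R.zeroˡ (χ z (-ᴳ 0ᴳ))))

  Ê≉0 : ∀ {k} → ¬ k ≈ᴳ 0ᴳ → ¬ Ê k ≈ 0#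
  Ê≉0 {k} k≉0 Êk≈0 = *-≉0 q≉0 (*-≉0 (E≉0 k≉0) (γ≉0 k))
    (R.trans (qE-≉0 k≉0) (R.trans (R.*-congʳ Êk≈0) (R.zeroˡ (W k 0ᴳ))))

  -- For `y = k -ᴳ l` the arguments `k` and `-ᴳ l` sum to `y`, so `W-symmetry` links the transformed
  -- pentagons for `Ê l * E y` and `Ê (-ᴳ k) * E y`. Cancelling `E y` requires `k` and `l` to
  -- differ, whence the case split.
  ÊÊ-proportional : ∀ {k l} → ¬ k ≈ᴳ 0ᴳ → ¬ l ≈ᴳ 0ᴳ → Ê l * Ê (-ᴳ l) * γ k ≈ Ê k * Ê (-ᴳ k) * γ l
  ÊÊ-proportional {k} {l} k≉0 l≉0 with k ≟ᴳ l
  ... | yes k≈l = R.*-cong (R.*-cong (Ê-cong (𝔾.sym k≈l)) (Ê-cong (𝔾.⁻¹-cong (𝔾.sym k≈l)))) (⟨⟩-cong k≈l)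
  ... | no  k≉l = *-cancelˡ (E≉0 (x-y≉0 k≉l)) (linear
    (Ê (-ᴳ l) * γ k · at-k ⊕ Ê k * Ê (-ᴳ l) · symmetry ⊕ Ê k * γ l · R.sym at-l)
    (R.solve 9 (λ e f f⁻ g g′ f′ f′⁻ w w′ →
       e :* (f :* f⁻ :* g) :+ (f⁻ :* g :* (f′ :* w) :+ f′ :* f⁻ :* (g′ :* w′) :+ f′ :* g′ :* (f′⁻ :* e))
         := e :* (f′ :* f′⁻ :* g′) :+ (f⁻ :* g :* (f :* e) :+ f′ :* f⁻ :* (g :* w) :+ f′ :* g′ :* (f⁻ :* w′)))
       R.refl (E y) (Ê l) (Ê (-ᴳ l)) (γ k) (γ l) (Ê k) (Ê (-ᴳ k)) (W y k) (W y (-ᴳ l))))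
    where
    y = k -ᴳ l
    at-k : Ê l * E y ≈ Ê k * W y k
    at-k = R.trans (R.*-congʳ (Ê-cong (𝔾.sym (y-[y-x]≈x l k)))) (ÊE-≉0 k≉0 y)
    at-l : Ê (-ᴳ k) * E y ≈ Ê (-ᴳ l) * W y (-ᴳ l)
    at-l = R.trans (R.*-congʳ (Ê-cong (𝔾.sym (𝔾.trans (𝔾.comm (-ᴳ l) (-ᴳ y))
        (𝔾.trans (𝔾.∙-congʳ (-[x-y]≈y-x k l)) ([x-y]-x≈-y l k))))))
      (ÊE-≉0 (-x≉0 l≉0) y)
    symmetry : γ k * W y k ≈ γ l * W y (-ᴳ l)
    symmetry = R.trans (W-symmetry y k) (R.*-cong
      (R.trans (⟨⟩-cong ([x-y]-x≈-y k l)) (R.sym (⟨⟩-even l))) (W-cong 𝔾.refl ([x-y]-x≈-y k l)))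

  -- The constants governing `E` and `Ê`.

  module Constants {y₀} (y₀≉0 : ¬ y₀ ≈ᴳ 0ᴳ) where

    κ : ℂ
    κ = Ê y₀ * Ê (-ᴳ y₀) * γ⁻¹ y₀

    ÊÊ≈κγ : ∀ {y} → ¬ y ≈ᴳ 0ᴳ → Ê y * Ê (-ᴳ y) ≈ κ * γ y
    ÊÊ≈κγ {y} y≉0 = linear
      (Ê y * Ê (-ᴳ y) · R.sym (γ-inverse y₀) ⊕ γ⁻¹ y₀ · ÊÊ-proportional y₀≉0 y≉0)
      (R.solve 7 (λ f f⁻ g s g′ f′ f′⁻ →
         f :* f⁻ :+ (f :* f⁻ :* (g :* s) :+ s :* (f′ :* f′⁻ :* g′))
           := f′ :* f′⁻ :* s :* g′ :+ (f :* f⁻ :* con 1 :+ s :* (f :* f⁻ :* g))) R.refl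
         (Ê y) (Ê (-ᴳ y)) (γ y₀) (γ⁻¹ y₀) (γ y) (Ê y₀) (Ê (-ᴳ y₀)))

    opaque
      -- The quotient `q / p` is not yet available, as `p` might still vanish; this value solves the
      -- equation behind `Ê≈ƛγE`.
      ƛ : ℂ
      ƛ = (κ + - (q * q)) * (1/ C-isUnit * 1/√N)

      ƛ-def : C * √N * ƛ + q * q ≈ κ
      ƛ-def = linear
        (κ + - (q * q) · inverses ⊕ 1# · R.-‿inverseʳ (q * q))
        (R.solve 7 (λ c c⁻¹ s d k n qq →
           c :* s :* ((k :+ n) :* (c⁻¹ :* d)) :+ qq :+ ((k :+ n) :* con 1 :+ con 1 :* con 0)
             := k :+ ((k :+ n) :* ((c :* c⁻¹) :* (s :* d)) :+ con 1 :* (qq :+ n))) R.refl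
           C (1/ C-isUnit) √N 1/√N κ (- (q * q)) (q * q))
        where
        inverses : (C * 1/ C-isUnit) * (√N * 1/√N) ≈ 1#
        inverses = R.trans (R.*-cong (proj₂ (proj₂ C-isUnit)) √N*1/√N≈1) (R.*-identityˡ 1#)

    -- `ÊE-0` times `Ê y`, with `W y 0ᴳ` eliminated by `qE-≉0`, turns into `κ γ E = C √N Ê + q² γ E`
    -- at `y`.
    Ê≈ƛγE : ∀ {y} → ¬ y ≈ᴳ 0ᴳ → Ê y ≈ ƛ * (γ y * E y)
    Ê≈ƛγE {y} y≉0 = *-cancelˡ C√N≉0 (linear
      (Ê y · R.sym (ÊE-0 y) ⊕ q · qE-≉0 y≉0 ⊕ E y · ÊÊ≈κγ y≉0 ⊕ γ y * E y · R.sym ƛ-def)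
      (R.solve 9 (λ cs f f⁻ e g q w k l →
         cs :* f :+ (f :* (f⁻ :* e) :+ q :* (f :* w) :+ e :* (k :* g) :+ g :* e :* (cs :* l :+ q :* q))
           := cs :* (l :* (g :* e))
              :+ (f :* (cs :+ q :* w) :+ q :* (q :* (e :* g)) :+ e :* (f :* f⁻) :+ g :* e :* k)) R.refl
         (C * √N) (Ê y) (Ê (-ᴳ y)) (E y) (γ y) q (W y 0ᴳ) κ ƛ))

    ƛ≉0 : ¬ ƛ ≈ 0#
    ƛ≉0 ƛ≈0 = Ê≉0 y₀≉0 (R.trans (Ê≈ƛγE y₀≉0) (R.trans (R.*-congʳ ƛ≈0) (R.zeroˡ (γ y₀ * E y₀))))

    Ê-≈ƛγE- : ∀ {y} → ¬ y ≈ᴳ 0ᴳ → Ê (-ᴳ y) ≈ ƛ * (γ y * E (-ᴳ y))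
    Ê-≈ƛγE- {y} y≉0 = R.trans (Ê≈ƛγE (-x≉0 y≉0)) (R.*-congˡ (R.*-congʳ (R.sym (⟨⟩-even y))))

    ƛƛγEE≈κ : ∀ {y} → ¬ y ≈ᴳ 0ᴳ → ƛ * ƛ * (γ y * (E y * E (-ᴳ y))) ≈ κ
    ƛƛγEE≈κ {y} y≉0 = *-cancelˡ (γ≉0 y) (linear
      (Ê (-ᴳ y) · R.sym (Ê≈ƛγE y≉0) ⊕ ƛ * (γ y * E y) · R.sym (Ê-≈ƛγE- y≉0) ⊕ 1# · ÊÊ≈κγ y≉0)
      (R.solve 7 (λ g l e e⁻ f f⁻ k →
         g :* (l :* l :* (g :* (e :* e⁻))) :+ (f⁻ :* f :+ l :* (g :* e) :* f⁻ :+ con 1 :* (k :* g))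
           := g :* k :+ (f⁻ :* (l :* (g :* e)) :+ l :* (g :* e) :* (l :* (g :* e⁻)) :+ con 1 :* (f :* f⁻)))
         R.refl (γ y) ƛ (E y) (E (-ᴳ y)) (Ê y) (Ê (-ᴳ y)) κ))

    opaque
      a : ℂ
      a = γ y₀ * (E y₀ * E (-ᴳ y₀))

      γEE≈a : ∀ {y} → ¬ y ≈ᴳ 0ᴳ → γ y * (E y * E (-ᴳ y)) ≈ a
      γEE≈a y≉0 = *-cancelˡ (*-≉0 ƛ≉0 ƛ≉0) (R.trans (ƛƛγEE≈κ y≉0) (R.sym (ƛƛγEE≈κ y₀≉0)))

      a≉0 : ¬ a ≈ 0#
      a≉0 = *-≉0 (γ≉0 y₀) (*-≉0 (E≉0 y₀≉0) (E≉0 (-x≉0 y₀≉0)))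

      -- Plays the part of `q / ƛ` without a division: `ƛ * W y 0ᴳ ≈ q` for every nonzero `y`, so
      -- the choice of `y₀` does not affect it.
      r : ℂ
      r = W y₀ 0ᴳ

      ƛW≈q : ∀ {y} → ¬ y ≈ᴳ 0ᴳ → ƛ * W y 0ᴳ ≈ q
      ƛW≈q {y} y≉0 = *-cancelˡ (*-≉0 (E≉0 y≉0) (γ≉0 y)) (linear
        (1# · R.sym (qE-≉0 y≉0) ⊕ W y 0ᴳ · R.sym (Ê≈ƛγE y≉0))
        (R.solve 6 (λ e g l w q f → e :* g :* (l :* w) :+ (con 1 :* (q :* (e :* g)) :+ w :* f)
           := e :* g :* q :+ (con 1 :* (f :* w) :+ w :* (l :* (g :* e)))) R.refl
           (E y) (γ y) ƛ (W y 0ᴳ) q (Ê y)))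

      W≈r : ∀ {y} → ¬ y ≈ᴳ 0ᴳ → W y 0ᴳ ≈ r
      W≈r y≉0 = *-cancelˡ ƛ≉0 (R.trans (ƛW≈q y≉0) (R.sym (ƛW≈q y₀≉0)))

      ƛr≈q : ƛ * r ≈ q
      ƛr≈q = ƛW≈q y₀≉0

    -- Up to order `h 0ᴳ z` is `γ z * (E z * E (-ᴳ z))`: the constant `a` off 0 and `p * p` at 0.
    -- The correction is a point mass, with `1/√N` because `Δ` is `√N` at 0.
    h₀≈ : ∀ z → h 0ᴳ z ≈ a + (p * p + - a) * 1/√N * Δ z
    h₀≈ z with z ≟ᴳ 0ᴳ
    ... | yes z≈0 = R.trans (h-cong 0ᴳ z≈0) (linear
      (p * γ 0ᴳ · E-cong (𝔾.inverseʳ 0ᴳ) ⊕ p * p · γ0≈1 ⊕ (p * p + - a) * 1/√N · R.sym (Δ-0 z≈0)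
        ⊕ p * p + - a · R.sym √N*1/√N≈1 ⊕ 1# · R.sym (R.-‿inverseʳ a))
      (R.solve 8 (λ e p g a n d δ s →
         e :* p :* g :+ (p :* g :* p :+ p :* p :* con 1 :+ (p :* p :+ n) :* d :* δ
             :+ (p :* p :+ n) :* (s :* d) :+ con 1 :* (a :+ n))
           := a :+ (p :* p :+ n) :* d :* δ :+ (p :* g :* e :+ p :* p :* g :+ (p :* p :+ n) :* d :* s
             :+ (p :* p :+ n) :* con 1 :+ con 1 :* con 0)) R.refl
         (E (0ᴳ -ᴳ 0ᴳ)) p (γ 0ᴳ) a (- a) 1/√N (Δ z) √N))
    ... | no  z≉0 = linear
      (E z * γ z · E-cong (0-x≈-x z) ⊕ 1# · γEE≈a z≉0 ⊕ (p * p + - a) * 1/√N · R.sym (Δ-≉0 z≉0))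
      (R.solve 7 (λ e e⁻ e′ g a b δ →
         e⁻ :* e :* g :+ (e :* g :* e′ :+ con 1 :* a :+ b :* δ)
           := a :+ b :* δ :+ (e :* g :* e⁻ :+ con 1 :* (g :* (e :* e′)) :+ b :* con 0)) R.refl
         (E z) (E (0ᴳ -ᴳ z)) (E (-ᴳ z)) (γ z) a ((p * p + - a) * 1/√N) (Δ z))

    -- The transform exchanges the constant and the point mass of `h₀≈`.
    W₀≈ : ∀ k → W 0ᴳ k ≈ a * Δ k + (p * p + - a) * 1/√N
    W₀≈ k = begin
      W 0ᴳ k
        ≈⟨ R.trans (W-def 0ᴳ k) (𝓕-cong h₀≈ k) ⟩
      ∫ (λ z → (a + b * Δ z) * χ z (-ᴳ k))
        ≈⟨ ∫-cong (λ z → R.trans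
             (R.solve 4 (λ a b δ x → (a :+ b :* δ) :* x := a :* (con 1 :* x) :+ b :* (x :* δ)) R.refl
               a b (Δ z) (χ z (-ᴳ k)))
             (R.+-congˡ (R.*-congˡ (R.*-congˡ (R.sym (R.trans (Δ-cong (0-x≈-x z)) (Δ-neg z))))))) ⟩
      ∫ (λ z → a * (1# * χ z (-ᴳ k)) + b * (χ z (-ᴳ k) * Δ (0ᴳ -ᴳ z)))
        ≈⟨ R.trans (∫-+ _ _) (R.+-cong (∫-*ˡ a _) (∫-*ˡ b _)) ⟩
      a * 𝓕 (λ _ → 1#) k + b * ∫ (λ z → χ z (-ᴳ k) * Δ (0ᴳ -ᴳ z))
        ≈⟨ R.+-cong (R.*-congˡ (𝓕-1 k)) (R.trans
             (R.*-congˡ (R.trans (∫-sift {λ z → χ z (-ᴳ k)} (λ eq → χ-cong eq 𝔾.refl) 0ᴳ) (χ-0ˡ (-ᴳ k))))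
             (R.*-identityʳ b)) ⟩
      a * Δ k + b ∎
      where
      open SetoidReasoning R.setoid
      b = (p * p + - a) * 1/√N

    -- At `y = 0ᴳ` and `k = y₀` the transformed pentagon says `Ê y₀ * p ≈ Ê y₀ * W 0ᴳ y₀`, and off 0
    -- only the constant part of `W₀≈` survives.
    p≈ : p ≈ (p * p + - a) * 1/√N
    p≈ = *-cancelˡ (Ê≉0 y₀≉0) (linear
      (p · Ê-cong (𝔾.sym (x-0≈x y₀)) ⊕ ÊE-≉0 y₀≉0 0ᴳ ⊕ Ê y₀ · W₀≈ y₀ ⊕ Ê y₀ * a · Δ-≉0 y₀≉0)
      (R.solve 7 (λ f p f′ w a δ b →
         f :* p :+ (p :* f′ :+ f :* w :+ f :* (a :* δ :+ b) :+ f :* a :* con 0)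
           := f :* b :+ (p :* f :+ f′ :* p :+ f :* w :+ f :* a :* δ)) R.refl
         (Ê y₀) p (Ê (y₀ -ᴳ 0ᴳ)) (W 0ᴳ y₀) a (Δ y₀) ((p * p + - a) * 1/√N)))

    pp≈√Np+a : p * p ≈ √N * p + a
    pp≈√Np+a = linear
      (√N · R.sym p≈ ⊕ p * p + - a · R.sym √N*1/√N≈1 ⊕ 1# · R.sym (R.-‿inverseʳ a))
      (R.solve 5 (λ p s a n d →
         p :* p :+ (s :* p :+ (p :* p :+ n) :* (s :* d) :+ con 1 :* (a :+ n))
           := s :* p :+ a :+ (s :* ((p :* p :+ n) :* d) :+ (p :* p :+ n) :* con 1 :+ con 1 :* con 0)) R.refl
         p √N a (- a) 1/√N)

    p≉0 : ¬ p ≈ 0#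
    p≉0 p≈0 = a≉0 (linear
      (1# · R.sym pp≈√Np+a ⊕ p · p≈0 ⊕ √N · R.sym p≈0)
      (R.solve 3 (λ a p s → a :+ (con 1 :* (p :* p) :+ p :* con 0 :+ s :* p)
         := con 0 :+ (con 1 :* (s :* p :+ a) :+ p :* p :+ s :* con 0)) R.refl a p √N))

    γEE≈a+pΔ : ∀ x → γ x * (E x * E (-ᴳ x)) ≈ a + p * Δ x
    γEE≈a+pΔ x = linear
      (γ x * E x · E-cong (𝔾.sym (0-x≈-x x)) ⊕ 1# · h₀≈ x ⊕ Δ x · R.sym p≈)
      (R.solve 8 (λ g e e⁻ e′ a b δ p →
         g :* (e :* e⁻) :+ (g :* e :* e′ :+ con 1 :* (a :+ b :* δ) :+ δ :* p)
           := a :+ p :* δ :+ (g :* e :* e⁻ :+ con 1 :* (e′ :* e :* g) :+ δ :* b)) R.refl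
         (γ x) (E x) (E (-ᴳ x)) (E (0ᴳ -ᴳ x)) a ((p * p + - a) * 1/√N) (Δ x) p)

    -- In `ÊE-0` at 0 the left side `q * p` cancels against the constant part of `W 0ᴳ 0ᴳ`; what
    -- remains is a multiple of `√N`.
    C+qa≈0 : C + q * a ≈ 0#
    C+qa≈0 = *-domain (linear
      (1# · R.sym (ÊE-0 0ᴳ) ⊕ p · Ê-cong 𝔾.ε⁻¹≈ε ⊕ q · R.sym (W₀≈ 0ᴳ)
        ⊕ q · p≈ ⊕ q * a · R.sym (Δ-0 𝔾.refl))
      (R.solve 9 (λ s c q a f p w b δ →
         s :* (c :+ q :* a) :+ (con 1 :* (f :* p) :+ p :* q :+ q :* w :+ q :* b :+ q :* a :* δ)
           := con 0 :+ (con 1 :* (c :* s :+ q :* w) :+ p :* f :+ q :* (a :* δ :+ b) :+ q :* p :+ q :* a :* s))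
         R.refl √N C q a (Ê (-ᴳ 0ᴳ)) p (W 0ᴳ 0ᴳ) ((p * p + - a) * 1/√N) (Δ 0ᴳ))) √N≉0

    -- In `ÊE-0` at `y₀` the left side is `ƛ * a`; on the right `C` becomes `- (q * a)` and `q`
    -- becomes `ƛ * r`. Cancel `ƛ`.
    rr≈√Nra+a : r * r ≈ √N * (r * a) + a
    rr≈√Nra+a = *-cancelˡ ƛ≉0 (linear
      (1# · R.sym (ÊE-0 y₀) ⊕ E y₀ · Ê-≈ƛγE- y₀≉0 ⊕ ƛ · γEE≈a y₀≉0 ⊕ √N · R.sym C+qa≈0
        ⊕ √N * a · R.sym ƛr≈q ⊕ q · R.sym (W≈r y₀≉0) ⊕ r · ƛr≈q)
      (R.solve 11 (λ l r s a f e c q g e⁻ w →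
         l :* (r :* r) :+ (con 1 :* (f :* e) :+ e :* (l :* (g :* e⁻)) :+ l :* a :+ s :* (c :+ q :* a)
             :+ s :* a :* (l :* r) :+ q :* w :+ r :* q)
           := l :* (s :* (r :* a) :+ a) :+ (con 1 :* (c :* s :+ q :* w) :+ e :* f :+ l :* (g :* (e :* e⁻))
             :+ s :* con 0 :+ s :* a :* q :+ q :* r :+ r :* (l :* r))) R.refl
         ƛ r √N a (Ê (-ᴳ y₀)) (E y₀) C q (γ y₀) (E (-ᴳ y₀)) (W y₀ 0ᴳ)))

    -- The discrepancy `d` and the values of `W`.

    opaque
      -- At `k = 0ᴳ` the true value of `a * W y k` is `a * r`, while its generic formula gives
      -- `a * p`; this is the mismatch in units of `√N`, the value of `Δ` there.
      d : ℂ
      d = a * (r + - p) * 1/√N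

      d-def : √N * d + a * p ≈ a * r
      d-def = linear
        (a * (r + - p) · √N*1/√N≈1 ⊕ a · R.-‿inverseʳ p)
        (R.solve 6 (λ s a r n t p →
           s :* (a :* (r :+ n) :* t) :+ a :* p :+ (a :* (r :+ n) :* con 1 :+ a :* con 0)
             := a :* r :+ (a :* (r :+ n) :* (s :* t) :+ a :* (p :+ n))) R.refl √N a r (- p) 1/√N p)

    d≈0⇒r≈p : d ≈ 0# → r ≈ p
    d≈0⇒r≈p d≈0 = *-cancelˡ a≉0 (linear (1# · R.sym d-def ⊕ √N · d≈0)
      (R.solve 5 (λ a r p s d → a :* r :+ (con 1 :* (s :* d :+ a :* p) :+ s :* con 0)
        := a :* p :+ (con 1 :* (a :* r) :+ s :* d)) R.refl a r p √N d))

    -- Divide `ÊE-≉0` by `Ê k`, with `Ê` expressed through `E`; `E (-ᴳ k)` stands for `a` over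
    -- `γ k * E k`.
    aW≈-generic : ∀ {y k} → ¬ k ≈ᴳ 0ᴳ → ¬ k ≈ᴳ y →
                  a * W y k ≈ γ (k -ᴳ y) * E (k -ᴳ y) * E (-ᴳ k) * E y
    aW≈-generic {y} {k} k≉0 k≉y = *-cancelˡ ƛ≉0 (linear
      (ƛ * W y k · R.sym (γEE≈a k≉0) ⊕ W y k * E (-ᴳ k) · R.sym (Ê≈ƛγE k≉0)
        ⊕ E (-ᴳ k) · R.sym (ÊE-≉0 k≉0 y) ⊕ E (-ᴳ k) * E y · Ê≈ƛγE (x-y≉0 k≉y))
      (R.solve 10 (λ l a w g e e⁻ f f₁ y t →
         l :* (a :* w) :+ (l :* w :* (g :* (e :* e⁻)) :+ w :* e⁻ :* f :+ e⁻ :* (f₁ :* y)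
             :+ e⁻ :* y :* (l :* t))
           := l :* (t :* e⁻ :* y) :+ (l :* w :* a :+ w :* e⁻ :* (l :* (g :* e)) :+ e⁻ :* (f :* w)
             :+ e⁻ :* y :* f₁)) R.refl
         ƛ a (W y k) (γ k) (E k) (E (-ᴳ k)) (Ê k) (Ê (k -ᴳ y)) (E y) (γ (k -ᴳ y) * E (k -ᴳ y))))

    -- The generic formula can fail only at `k = 0ᴳ` and `k = y`. There `W≈r` and `W-diagonal` give
    -- the value, and the defects `√N * d` and `√N * d * γ⁻¹ y` are the two point masses.
    aW≈ : ∀ {y} → ¬ y ≈ᴳ 0ᴳ → ∀ k →
          a * W y k ≈ γ (k -ᴳ y) * E (k -ᴳ y) * E (-ᴳ k) * E y + d * (Δ (0ᴳ -ᴳ k) + Δ (y -ᴳ k) * γ⁻¹ y)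
    aW≈ {y} y≉0 k with k ≟ᴳ 0ᴳ | k ≟ᴳ y
    ... | yes k≈0 | yes k≈y = ⊥-elim (y≉0 (𝔾.trans (𝔾.sym k≈y) k≈0))
    ... | yes k≈0 | no  k≉y = linear
      (a · R.trans (W-cong 𝔾.refl k≈0) (W≈r y≉0) ⊕ 1# · R.sym term ⊕ p · R.sym (γEE≈a y≉0)
        ⊕ d · R.sym (Δ-0 (𝔾.trans (0-x≈-x k) (𝔾.trans (𝔾.⁻¹-cong k≈0) 𝔾.ε⁻¹≈ε)))
        ⊕ d * γ⁻¹ y · R.sym (Δ-≉0 (x-y≉0 λ y≈k → k≉y (𝔾.sym y≈k))) ⊕ 1# · R.sym d-def)
      (R.solve 13 (λ a w r t g e e⁻ p d δ₀ δ₁ s n →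
         a :* w :+ (a :* r :+ con 1 :* t :+ p :* (g :* (e :* e⁻)) :+ d :* δ₀ :+ d :* s :* δ₁ :+ con 1 :* (n :* d :+ a :* p))
           := t :+ d :* (δ₀ :+ δ₁ :* s) :+ (a :* w :+ con 1 :* (g :* e⁻ :* p :* e) :+ p :* a :+ d :* n :+ d :* s :* con 0 :+ con 1 :* (a :* r)))
         R.refl a (W y k) r (γ (k -ᴳ y) * E (k -ᴳ y) * E (-ᴳ k) * E y) (γ y) (E y) (E (-ᴳ y)) p d
         (Δ (0ᴳ -ᴳ k)) (Δ (y -ᴳ k)) (γ⁻¹ y) √N)
      where
      k-y≈-y : k -ᴳ y ≈ᴳ -ᴳ y
      k-y≈-y = 𝔾.trans (𝔾.∙-congʳ k≈0) (𝔾.identityˡ (-ᴳ y))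
      term : γ (k -ᴳ y) * E (k -ᴳ y) * E (-ᴳ k) * E y ≈ γ y * E (-ᴳ y) * p * E y
      term = R.*-congʳ (R.*-cong
        (R.*-cong (R.trans (⟨⟩-cong k-y≈-y) (R.sym (⟨⟩-even y))) (E-cong k-y≈-y))
        (E-cong (𝔾.trans (𝔾.⁻¹-cong k≈0) 𝔾.ε⁻¹≈ε)))
    ... | no  k≉0 | yes k≈y = *-cancelˡ (γ≉0 y) (linear
      (a · R.trans (R.*-congˡ (W-cong 𝔾.refl k≈y)) (R.trans (W-diagonal y) (W≈r y≉0))
        ⊕ γ y · R.sym term ⊕ p · R.sym (γEE≈a y≉0)
        ⊕ γ y * d · R.sym (Δ-≉0 (x-y≉0 λ 0≈k → k≉0 (𝔾.sym 0≈k)))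
        ⊕ γ y * d * γ⁻¹ y · R.sym (Δ-0 (𝔾.x≈y⇒x∙y⁻¹≈ε (𝔾.sym k≈y)))
        ⊕ d * √N · R.sym (γ-inverse y) ⊕ 1# · R.sym d-def)
      (R.solve 13 (λ a w r t g e e⁻ p d δ₀ δ₁ s n →
         g :* (a :* w) :+ (a :* r :+ g :* t :+ p :* (g :* (e :* e⁻)) :+ g :* d :* δ₀ :+ g :* d :* s :* δ₁
             :+ d :* n :* (g :* s) :+ con 1 :* (n :* d :+ a :* p))
           := g :* (t :+ d :* (δ₀ :+ δ₁ :* s)) :+ (a :* (g :* w) :+ g :* (p :* e⁻ :* e) :+ p :* a
             :+ g :* d :* con 0 :+ g :* d :* s :* n :+ d :* n :* con 1 :+ con 1 :* (a :* r)))
         R.refl a (W y k) r (γ (k -ᴳ y) * E (k -ᴳ y) * E (-ᴳ k) * E y) (γ y) (E y) (E (-ᴳ y)) p d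
         (Δ (0ᴳ -ᴳ k)) (Δ (y -ᴳ k)) (γ⁻¹ y) √N))
      where
      k-y≈0 : k -ᴳ y ≈ᴳ 0ᴳ
      k-y≈0 = 𝔾.x≈y⇒x∙y⁻¹≈ε k≈y
      term : γ (k -ᴳ y) * E (k -ᴳ y) * E (-ᴳ k) * E y ≈ p * E (-ᴳ y) * E y
      term = R.*-congʳ (R.*-cong
        (R.trans (R.*-cong (R.trans (⟨⟩-cong k-y≈0) γ0≈1) (E-cong k-y≈0)) (R.*-identityˡ p))
        (E-cong (𝔾.⁻¹-cong k≈y)))
    ... | no  k≉0 | no  k≉y = linear
      (1# · aW≈-generic k≉0 k≉y ⊕ d · R.sym (Δ-≉0 (x-y≉0 λ 0≈k → k≉0 (𝔾.sym 0≈k)))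
        ⊕ d * γ⁻¹ y · R.sym (Δ-≉0 (x-y≉0 λ y≈k → k≉y (𝔾.sym y≈k))))
      (R.solve 6 (λ w t d δ₀ δ₁ s → w :+ (con 1 :* t :+ d :* δ₀ :+ d :* s :* δ₁)
         := t :+ d :* (δ₀ :+ δ₁ :* s) :+ (con 1 :* w :+ d :* con 0 :+ d :* s :* con 0)) R.refl
         (a * W y k) (γ (k -ᴳ y) * E (k -ᴳ y) * E (-ᴳ k) * E y) d (Δ (0ᴳ -ᴳ k)) (Δ (y -ᴳ k)) (γ⁻¹ y))

    -- The inverse Fourier transform of aW≈.
    ah≈ : ∀ {y} → ¬ y ≈ᴳ 0ᴳ → ∀ w →
          a * h y w ≈ E y * γ y * W (-ᴳ y) (w -ᴳ y) + d * (1# + χ w y * γ⁻¹ y)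
    ah≈ {y} y≉0 w = begin
      a * h y w
        ≈⟨ R.*-congˡ (R.trans (R.sym (𝓕-inversion (h-cong y) w))
             (∫-cong λ k → R.*-congʳ (R.sym (W-def y k)))) ⟩
      a * ∫ (λ k → W y k * χ w k)
        ≈⟨ ∫-*ˡ a _ ⟨
      ∫ (λ k → a * (W y k * χ w k))
        ≈⟨ ∫-cong (λ k → linear (χ w k · aW≈ y≉0 k)
             (R.solve 8 (λ a w x t d δ₀ δ₁ s →
                a :* (w :* x) :+ x :* (t :+ d :* (δ₀ :+ δ₁ :* s))
                  := t :* x :+ (d :* (x :* δ₀) :+ d :* s :* (x :* δ₁)) :+ x :* (a :* w)) R.refl
                a (W y k) (χ w k) (T k) d (Δ (0ᴳ -ᴳ k)) (Δ (y -ᴳ k)) (γ⁻¹ y))) ⟩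
      ∫ (λ k → T k * χ w k + (d * (χ w k * Δ (0ᴳ -ᴳ k)) + d * γ⁻¹ y * (χ w k * Δ (y -ᴳ k))))
        ≈⟨ R.trans (∫-+ _ _) (R.+-congˡ (∫-+ _ _)) ⟩
      ∫ (λ k → T k * χ w k) + (∫ (λ k → d * (χ w k * Δ (0ᴳ -ᴳ k))) + ∫ (λ k → d * γ⁻¹ y * (χ w k * Δ (y -ᴳ k))))
        ≈⟨ R.+-cong ∫T (R.+-cong
             (R.trans (∫-*ˡ d _) (R.*-congˡ (R.trans (∫-sift {χ w} (χ-cong 𝔾.refl) 0ᴳ) (χ-0ʳ w))))
             (R.trans (∫-*ˡ (d * γ⁻¹ y) _) (R.*-congˡ (∫-sift {χ w} (χ-cong 𝔾.refl) y)))) ⟩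
      E y * γ y * W (-ᴳ y) (w -ᴳ y) + (d * 1# + d * γ⁻¹ y * χ w y)
        ≈⟨ R.solve 4 (λ t d s x → t :+ (d :* con 1 :+ d :* s :* x) := t :+ d :* (con 1 :+ x :* s)) R.refl
             (E y * γ y * W (-ᴳ y) (w -ᴳ y)) d (γ⁻¹ y) (χ w y) ⟩
      E y * γ y * W (-ᴳ y) (w -ᴳ y) + d * (1# + χ w y * γ⁻¹ y) ∎
      where
      open SetoidReasoning R.setoid
      T : Carrier → ℂ
      T k = γ (k -ᴳ y) * E (k -ᴳ y) * E (-ᴳ k) * E y
      T-cong : Congruent T
      T-cong eq = R.*-congʳ (R.*-cong
        (R.*-cong (⟨⟩-cong (-ᴳ-cong eq 𝔾.refl)) (E-cong (-ᴳ-cong eq 𝔾.refl))) (E-cong (𝔾.⁻¹-cong eq)))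
      γ[-k-y] : ∀ k → γ (-ᴳ k -ᴳ y) ≈ χ k y * (γ k * γ y)
      γ[-k-y] k = R.trans (⟨⟩-cong (𝔾.⁻¹-∙-comm k y)) (R.trans (R.sym (⟨⟩-even (k +ᴳ y))) (γ-+ k y))
      χ-split : ∀ k → χ k (-ᴳ (w -ᴳ y)) ≈ χ k y * χ w (-ᴳ k)
      χ-split k = R.trans (χ-cong 𝔾.refl (-[x-y]≈y-x w y)) (R.trans (χ-+ʳ k y (-ᴳ w))
        (R.*-congˡ (R.trans (R.sym (χ-neg k w)) (χ-sym (-ᴳ k) w))))
      -- The reflection of `k` turns `T` into `E y * γ y` times `h (-ᴳ y) k` and a character, so the
      -- inverse transform yields a value of `W` again.
      integrand : ∀ k → T (-ᴳ k) * χ w (-ᴳ k) ≈ E y * γ y * (h (-ᴳ y) k * χ k (-ᴳ (w -ᴳ y)))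
      integrand k = begin
        T (-ᴳ k) * χ w (-ᴳ k)
          ≈⟨ R.*-congʳ (R.*-congʳ (R.*-cong (R.*-cong (γ[-k-y] k) (E-cong (𝔾.comm (-ᴳ k) (-ᴳ y))))
               (E-cong (𝔾.⁻¹-involutive k)))) ⟩
        χ k y * (γ k * γ y) * E (-ᴳ y -ᴳ k) * E k * E y * χ w (-ᴳ k)
          ≈⟨ R.solve 7 (λ x gk gy e₁ e₂ e₃ x′ →
               x :* (gk :* gy) :* e₁ :* e₂ :* e₃ :* x′ := e₃ :* gy :* (e₁ :* e₂ :* gk :* (x :* x′))) R.refl
               (χ k y) (γ k) (γ y) (E (-ᴳ y -ᴳ k)) (E k) (E y) (χ w (-ᴳ k)) ⟩
        E y * γ y * (h (-ᴳ y) k * (χ k y * χ w (-ᴳ k)))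
          ≈⟨ R.*-congˡ (R.*-congˡ (χ-split k)) ⟨
        E y * γ y * (h (-ᴳ y) k * χ k (-ᴳ (w -ᴳ y))) ∎
      ∫T : ∫ (λ k → T k * χ w k) ≈ E y * γ y * W (-ᴳ y) (w -ᴳ y)
      ∫T = begin
        ∫ (λ k → T k * χ w k)
          ≈⟨ ∫-negate {λ k → T k * χ w k} (λ eq → R.*-cong (T-cong eq) (χ-cong 𝔾.refl eq)) ⟨
        ∫ (λ k → T (-ᴳ k) * χ w (-ᴳ k))
          ≈⟨ ∫-cong integrand ⟩
        ∫ (λ k → E y * γ y * (h (-ᴳ y) k * χ k (-ᴳ (w -ᴳ y))))
          ≈⟨ R.trans (∫-*ˡ (E y * γ y) _) (R.*-congˡ (R.sym (W-def (-ᴳ y) (w -ᴳ y)))) ⟩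
        E y * γ y * W (-ᴳ y) (w -ᴳ y) ∎

    -- Put `w = 0ᴳ` in `ah≈`; the value of `W` that appears lies on the diagonal at `-ᴳ y`.
    apE≈ : ∀ {y} → ¬ y ≈ᴳ 0ᴳ → a * p * E y ≈ r * E y + d * (1# + γ⁻¹ y)
    apE≈ {y} y≉0 = linear
      (1# · ah≈ y≉0 0ᴳ ⊕ a * p * E y · R.sym γ0≈1
        ⊕ a * p * γ 0ᴳ · R.sym (E-cong (x-0≈x y)) ⊕ d * γ⁻¹ y · χ-0ˡ y ⊕ E y · W-term)
      (R.solve 11 (λ a p e e′ g₀ g w r d s x →
         a :* p :* e :+ (con 1 :* (e :* g :* w :+ d :* (con 1 :+ x :* s)) :+ a :* p :* e :* g₀
             :+ a :* p :* g₀ :* e′ :+ d :* s :* con 1 :+ e :* r)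
           := r :* e :+ d :* (con 1 :+ s) :+ (con 1 :* (a :* (e′ :* p :* g₀)) :+ a :* p :* e :* con 1
             :+ a :* p :* g₀ :* e :+ d :* s :* x :+ e :* (g :* w))) R.refl
         a p (E y) (E (y -ᴳ 0ᴳ)) (γ 0ᴳ) (γ y) (W (-ᴳ y) (0ᴳ -ᴳ y)) r d (γ⁻¹ y) (χ 0ᴳ y))
      where
      W-term : γ y * W (-ᴳ y) (0ᴳ -ᴳ y) ≈ r
      W-term = R.trans (R.*-cong (⟨⟩-even y) (W-cong 𝔾.refl (0-x≈-x y)))
        (R.trans (W-diagonal (-ᴳ y)) (W≈r (-x≉0 y≉0)))

    -- Put `y = u +ᴳ v` and `w = u` in `ah≈`. The value of `W` on the right is generic, hence a
    -- product of values of `E` over `a`, and `γ y * (E y * E (-ᴳ y))` collapses to `a`.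
    aEE≈ : ∀ {u v} → ¬ u ≈ᴳ 0ᴳ → ¬ v ≈ᴳ 0ᴳ → ¬ u +ᴳ v ≈ᴳ 0ᴳ →
           a * E u * E v ≈ E u * E v + d * (γ⁻¹ u + γ⁻¹ v)
    aEE≈ {u} {v} u≉0 v≉0 y≉0 = *-cancelˡ a≉0 (*-cancelˡ (γ≉0 u) (linear
      (a · ah≈ y≉0 u ⊕ a * a * E u * γ u · R.sym (E-cong y-u≈v) ⊕ E y * γ y · W-term
        ⊕ E u * E v * γ u · γEE≈a y≉0 ⊕ a * d · R.sym (γ-inverse u) ⊕ a * d · χ-term)
      (R.solve 14 (λ a d gu su sv eu ev ev′ gy sy ey ey⁻ w x →
         gu :* (a :* (a :* eu :* ev)) :+ (a :* (ey :* gy :* w :+ d :* (con 1 :+ x :* sy))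
             :+ a :* a :* eu :* gu :* ev′ :+ ey :* gy :* (gu :* eu :* ev :* ey⁻)
             :+ eu :* ev :* gu :* a :+ a :* d :* (gu :* su) :+ a :* d :* (gu :* sv))
           := gu :* (a :* (eu :* ev :+ d :* (su :+ sv))) :+ (a :* (a :* (ev′ :* eu :* gu))
             :+ a :* a :* eu :* gu :* ev :+ ey :* gy :* (a :* w) :+ eu :* ev :* gu :* (gy :* (ey :* ey⁻))
             :+ a :* d :* con 1 :+ a :* d :* (x :* sy))) R.refl
         a d (γ u) (γ⁻¹ u) (γ⁻¹ v) (E u) (E v) (E (y -ᴳ u)) (γ y) (γ⁻¹ y) (E y) (E (-ᴳ y))
         (W (-ᴳ y) (u -ᴳ y)) (χ u y))))
      where
      y = u +ᴳ v
      y-u≈v : y -ᴳ u ≈ᴳ v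
      y-u≈v = 𝔾.trans (𝔾.∙-congʳ (𝔾.comm u v)) ([x+y]-y≈x v u)
      u-y≈-v : u -ᴳ y ≈ᴳ -ᴳ v
      u-y≈-v = 𝔾.trans (𝔾.sym (-[x-y]≈y-x y u)) (𝔾.⁻¹-cong y-u≈v)
      u-y--y≈u : (u -ᴳ y) -ᴳ (-ᴳ y) ≈ᴳ u
      u-y--y≈u = [x+y]-y≈x u (-ᴳ y)
      W-term : a * W (-ᴳ y) (u -ᴳ y) ≈ γ u * E u * E v * E (-ᴳ y)
      W-term = R.trans
        (aW≈-generic (λ eq → -x≉0 v≉0 (𝔾.trans (𝔾.sym u-y≈-v) eq))
          (λ eq → u≉0 (𝔾.trans (𝔾.sym u-y--y≈u) (𝔾.x≈y⇒x∙y⁻¹≈ε eq))))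
        (R.*-congʳ (R.*-cong (R.*-cong (⟨⟩-cong u-y--y≈u) (E-cong u-y--y≈u))
          (E-cong (𝔾.trans (-[x-y]≈y-x u y) y-u≈v))))
      -- As `v` is `y -ᴳ u`, the value `γ v` is `γ y * γ u` divided by `χ u y`.
      χ-term : χ u y * γ⁻¹ y ≈ γ u * γ⁻¹ v
      χ-term = *-cancelˡ (γ≉0 v) (linear
        (χ u y * γ⁻¹ y · γv ⊕ χ y (-ᴳ u) * γ⁻¹ y * γ y * γ u · χ-sym u y
          ⊕ γ u * γ⁻¹ y * γ y · χ-inverseʳ y u ⊕ γ u · γ-inverse y ⊕ γ u · R.sym (γ-inverse v))
        (R.solve 8 (λ gu gv gy sy sv x x′ x⁻ →
           gv :* (x :* sy) :+ (x :* sy :* (x⁻ :* (gy :* gu)) :+ x⁻ :* sy :* gy :* gu :* x′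
               :+ gu :* sy :* gy :* con 1 :+ gu :* con 1 :+ gu :* (gv :* sv))
             := gv :* (gu :* sv) :+ (x :* sy :* gv :+ x⁻ :* sy :* gy :* gu :* x
               :+ gu :* sy :* gy :* (x⁻ :* x′) :+ gu :* (gy :* sy) :+ gu :* con 1)) R.refl
           (γ u) (γ v) (γ y) (γ⁻¹ y) (γ⁻¹ v) (χ u y) (χ y u) (χ y (-ᴳ u))))
        where
        γv : γ v ≈ χ y (-ᴳ u) * (γ y * γ u)
        γv = R.trans (⟨⟩-cong (𝔾.sym y-u≈v)) (γ-ᴳ y u)

    γ⁻¹-even : ∀ y → γ⁻¹ (-ᴳ y) ≈ γ⁻¹ y
    γ⁻¹-even y = γ⁻¹-unique (R.trans (R.*-congʳ (⟨⟩-even y)) (γ-inverse (-ᴳ y)))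

    aγ⁻¹≈EE : ∀ {y} → ¬ y ≈ᴳ 0ᴳ → a * γ⁻¹ y ≈ E y * E (-ᴳ y)
    aγ⁻¹≈EE {y} y≉0 = linear (γ⁻¹ y · R.sym (γEE≈a y≉0) ⊕ E y * E (-ᴳ y) · γ-inverse y)
      (R.solve 5 (λ a g s e e⁻ → a :* s :+ (s :* (g :* (e :* e⁻)) :+ e :* e⁻ :* con 1)
        := e :* e⁻ :+ (s :* a :+ e :* e⁻ :* (g :* s))) R.refl a (γ y) (γ⁻¹ y) (E y) (E (-ᴳ y)))

    b : ℂ
    b = a * p + - r

    bE≈ : ∀ {y} → ¬ y ≈ᴳ 0ᴳ → b * E y ≈ d * (1# + γ⁻¹ y)
    bE≈ {y} y≉0 = linear (1# · apE≈ y≉0 ⊕ E y · R.-‿inverseʳ r)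
      (R.solve 6 (λ a p r n e t → (a :* p :+ n) :* e :+ (con 1 :* (r :* e :+ t) :+ e :* con 0)
        := t :+ (con 1 :* (a :* p :* e) :+ e :* (r :+ n))) R.refl a p r (- r) (E y) (d * (1# + γ⁻¹ y)))

    -- Multiply `bE≈` at `y` and at `-ᴳ y`. All values of `γ⁻¹` off 0 thus satisfy one quadratic
    -- equation.
    bbaγ⁻¹≈ : ∀ {y} → ¬ y ≈ᴳ 0ᴳ → b * b * (a * γ⁻¹ y) ≈ d * d * ((1# + γ⁻¹ y) * (1# + γ⁻¹ y))
    bbaγ⁻¹≈ {y} y≉0 = linear
      (b * b · aγ⁻¹≈EE y≉0 ⊕ b * E (-ᴳ y) · bE≈ y≉0
        ⊕ d * (1# + γ⁻¹ y) · R.trans (bE≈ (-x≉0 y≉0)) (R.*-congˡ (R.+-congˡ (γ⁻¹-even y))))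
      (R.solve 6 (λ b t e e⁻ d s →
         b :* b :* t :+ (b :* b :* (e :* e⁻) :+ b :* e⁻ :* (d :* s) :+ d :* s :* (d :* s))
           := d :* d :* (s :* s) :+ (b :* b :* t :+ b :* e⁻ :* (b :* e) :+ d :* s :* (b :* e⁻))) R.refl
         b (a * γ⁻¹ y) (E y) (E (-ᴳ y)) d (1# + γ⁻¹ y))

    -- A nonzero `d` forces a degenerate bicharacter.

    module _ (d≉0 : ¬ d ≈ 0#) where

      -- The value 1 at `w` makes `b * b * a` four times `d * d`, and the quadratic equation then
      -- has 1 as a double root.
      γ⁻¹≈1⇒all : ∀ {w} → ¬ w ≈ᴳ 0ᴳ → γ⁻¹ w ≈ 1# → ∀ {y} → ¬ y ≈ᴳ 0ᴳ → γ⁻¹ y ≈ 1#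
      γ⁻¹≈1⇒all {w} w≉0 s≈1 {y} y≉0 = 4s≈[1+s]²⇒s≈1 (*-cancelˡ (*-≉0 d≉0 d≉0) (linear
        (γ⁻¹ y · R.sym (bbaγ⁻¹≈ w≉0) ⊕ b * b * a * γ⁻¹ y · s≈1 ⊕ 1# · bbaγ⁻¹≈ y≉0
          ⊕ d * d * γ⁻¹ y * (γ⁻¹ w + 1# + 1# + 1#) · R.sym s≈1)
        (R.solve 5 (λ d b a s t →
           d :* d :* (s :+ s :+ s :+ s) :+ (s :* (b :* b :* (a :* t)) :+ b :* b :* a :* s :* con 1
               :+ con 1 :* (d :* d :* ((con 1 :+ s) :* (con 1 :+ s)))
               :+ d :* d :* s :* (t :+ con 1 :+ con 1 :+ con 1) :* t)
             := d :* d :* ((con 1 :+ s) :* (con 1 :+ s))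
               :+ (s :* (d :* d :* ((con 1 :+ t) :* (con 1 :+ t))) :+ b :* b :* a :* s :* t
               :+ con 1 :* (b :* b :* (a :* s))
               :+ d :* d :* s :* (t :+ con 1 :+ con 1 :+ con 1) :* con 1)) R.refl
           d b a (γ⁻¹ y) (γ⁻¹ w))))

      -- For w avoiding 0, - u and - v, comparing aEE≈ with apE≈ at u and v
      -- forces γ⁻¹ w ≈ 1.
      γ⁻¹-constant′ : ∀ {u v w} → ¬ u ≈ᴳ 0ᴳ → ¬ v ≈ᴳ 0ᴳ → ¬ w ≈ᴳ 0ᴳ →
                      ¬ u +ᴳ w ≈ᴳ 0ᴳ → ¬ v +ᴳ w ≈ᴳ 0ᴳ → γ⁻¹ u ≈ γ⁻¹ v
      γ⁻¹-constant′ {u} {v} {w} u≉0 v≉0 w≉0 u+w≉0 v+w≉0 = ≈-stable λ su≉sv →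
        let E≉ : ¬ E u + - E v ≈ 0#
            E≉ eq = su≉sv (*-cancelˡ d≉0 (linear
              (1# · R.sym (bE≈ u≉0) ⊕ b · R.x∙y⁻¹≈ε⇒x≈y (E u) (E v) eq ⊕ 1# · bE≈ v≉0)
              (R.solve 6 (λ d b s t e f →
                 d :* s :+ (con 1 :* (b :* e) :+ b :* f :+ con 1 :* (d :* (con 1 :+ t)))
                   := d :* t :+ (con 1 :* (d :* (con 1 :+ s)) :+ b :* e :+ con 1 :* (b :* f))) R.refl
                 d b (γ⁻¹ u) (γ⁻¹ v) (E u) (E v))))
            -- Multiplied by `E u + - E v`, both `x` and `b` give `d` times the difference of
            -- `γ⁻¹ u` and `γ⁻¹ v`.
            x≈b : x ≈ b
            x≈b = *-cancelˡ E≉ (linear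
              (1# · xE≈ u≉0 u+w≉0 ⊕ 1# · R.sym (xE≈ v≉0 v+w≉0) ⊕ 1# · R.sym (bE≈ u≉0) ⊕ 1# · bE≈ v≉0
                ⊕ x · R.-‿inverseʳ (E v) ⊕ b · R.sym (R.-‿inverseʳ (E v)))
              (R.solve 9 (λ d x b e f n s t r →
                 (e :+ n) :* x :+ (con 1 :* (d :* (s :+ r)) :+ con 1 :* (x :* f) :+ con 1 :* (b :* e)
                     :+ con 1 :* (d :* (con 1 :+ t)) :+ x :* con 0 :+ b :* (f :+ n))
                   := (e :+ n) :* b :+ (con 1 :* (x :* e) :+ con 1 :* (d :* (t :+ r))
                     :+ con 1 :* (d :* (con 1 :+ s)) :+ con 1 :* (b :* f) :+ x :* (f :+ n) :+ b :* con 0))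
                 R.refl d x b (E u) (E v) (- E v) (γ⁻¹ u) (γ⁻¹ v) (γ⁻¹ w)))
            sw≈1 : γ⁻¹ w ≈ 1#
            sw≈1 = *-cancelˡ d≉0 (linear
              (1# · R.sym (xE≈ u≉0 u+w≉0) ⊕ E u · x≈b ⊕ 1# · bE≈ u≉0)
              (R.solve 6 (λ d x b e s r →
                 d :* r :+ (con 1 :* (x :* e) :+ e :* b :+ con 1 :* (d :* (con 1 :+ s)))
                   := d :* con 1 :+ (con 1 :* (d :* (s :+ r)) :+ e :* x :+ con 1 :* (b :* e))) R.refl
                 d x b (E u) (γ⁻¹ u) (γ⁻¹ w)))
        in su≉sv (R.trans (γ⁻¹≈1⇒all w≉0 sw≈1 u≉0) (R.sym (γ⁻¹≈1⇒all w≉0 sw≈1 v≉0)))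
        where
        x : ℂ
        x = (a + - 1#) * E w
        xE≈ : ∀ {y} → ¬ y ≈ᴳ 0ᴳ → ¬ y +ᴳ w ≈ᴳ 0ᴳ → x * E y ≈ d * (γ⁻¹ y + γ⁻¹ w)
        xE≈ {y} y≉0 y+w≉0 = linear
          (1# · aEE≈ y≉0 w≉0 y+w≉0 ⊕ E y * E w · R.-‿inverseʳ 1#)
          (R.solve 5 (λ a n e f t →
             (a :+ n) :* f :* e :+ (con 1 :* (e :* f :+ t) :+ e :* f :* con 0)
               := t :+ (con 1 :* (a :* e :* f) :+ e :* f :* (con 1 :+ n))) R.refl
             a (- 1#) (E y) (E w) (d * (γ⁻¹ y + γ⁻¹ w)))

      module _ (4<N : 4 ℕ.< N) where

        ∃-avoiding-Vec : ∀ {n} → n ℕ.≤ 4 → (xs : Vec Carrier n) → ∃ λ x → ∀ i → ¬ x ≈ᴳ lookup xs i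
        ∃-avoiding-Vec n≤4 xs = ∃-avoiding (ℕ.≤-<-trans n≤4 4<N) (lookup xs)

        +≉0 : ∀ {x y} → ¬ y ≈ᴳ -ᴳ x → ¬ x +ᴳ y ≈ᴳ 0ᴳ
        +≉0 {x} {y} y≉-x eq = y≉-x (𝔾.inverseʳ-unique x y eq)

        γ⁻¹-constant : ∀ {u v} → ¬ u ≈ᴳ 0ᴳ → ¬ v ≈ᴳ 0ᴳ → γ⁻¹ u ≈ γ⁻¹ v
        γ⁻¹-constant {u} {v} u≉0 v≉0 =
          let w , w∉ = ∃-avoiding-Vec (ℕ.n≤1+n 3) (0ᴳ ∷ -ᴳ u ∷ -ᴳ v ∷ [])
          in γ⁻¹-constant′ u≉0 v≉0 (w∉ zero) (+≉0 (w∉ (suc zero))) (+≉0 (w∉ (suc (suc zero))))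

        t : ℂ
        t = γ y₀

        γ≈t : ∀ {u} → ¬ u ≈ᴳ 0ᴳ → γ u ≈ t
        γ≈t {u} u≉0 = linear
          (γ u · R.sym (γ-inverse y₀) ⊕ γ u * γ y₀ · γ⁻¹-constant y₀≉0 u≉0 ⊕ γ y₀ · γ-inverse u)
          (R.solve 4 (λ g h s r → g :+ (g :* (h :* s) :+ g :* h :* r :+ h :* con 1)
            := h :+ (g :* con 1 :+ g :* h :* s :+ h :* (g :* r))) R.refl (γ u) (γ y₀) (γ⁻¹ y₀) (γ⁻¹ u))

        χt≈1 : ∀ {u v} → ¬ u ≈ᴳ 0ᴳ → ¬ v ≈ᴳ 0ᴳ → ¬ u +ᴳ v ≈ᴳ 0ᴳ → χ u v * t ≈ 1#
        χt≈1 {u} {v} u≉0 v≉0 u+v≉0 = *-cancelˡ (γ≉0 y₀) (linear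
          (χ u v * t · R.sym (γ≈t u≉0) ⊕ χ u v * γ u · R.sym (γ≈t v≉0)
            ⊕ 1# · R.sym (γ-+ u v) ⊕ 1# · γ≈t u+v≉0)
          (R.solve 5 (λ t x g h k → t :* (x :* t) :+ (x :* t :* g :+ x :* g :* h :+ con 1 :* k :+ con 1 :* t)
            := t :* con 1 :+ (x :* t :* t :+ x :* g :* t :+ con 1 :* (x :* (g :* h)) :+ con 1 :* k)) R.refl
            t (χ u v) (γ u) (γ v) (γ (u +ᴳ v))))

        -- By `χt≈1` the values `χ y₀ x`, `χ y₀ y` and `χ y₀ (x +ᴳ y)` are all inverse to `t`, while
        -- the third is the product of the other two.
        t≈1 : t ≈ 1#
        t≈1 =
          let x , x∉ = ∃-avoiding-Vec (ℕ.m≤n+m 2 2) (0ᴳ ∷ -ᴳ y₀ ∷ [])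
              -- Avoiding these four elements keeps `y`, `y₀ +ᴳ y`, `x +ᴳ y` and `y₀ +ᴳ (x +ᴳ y)`
              -- nonzero; this is where `4<N` is used in full.
              y , y∉ = ∃-avoiding-Vec ℕ.≤-refl (0ᴳ ∷ -ᴳ y₀ ∷ -ᴳ x ∷ -ᴳ (y₀ +ᴳ x) ∷ [])
              y₀+[x+y]≉0 = λ eq → +≉0 (y∉ (suc (suc (suc zero)))) (𝔾.trans (𝔾.assoc y₀ x y) eq)
          in linear
            (t · R.sym (χt≈1 y₀≉0 (+≉0 (y∉ (suc (suc zero)))) y₀+[x+y]≉0)
              ⊕ t * t · χ-+ʳ y₀ x y
              ⊕ χ y₀ y * t · χt≈1 y₀≉0 (x∉ zero) (+≉0 (x∉ (suc zero)))
              ⊕ 1# · χt≈1 y₀≉0 (y∉ zero) (+≉0 (y∉ (suc zero))))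
            (R.solve 4 (λ t x y z →
               t :+ (t :* (z :* t) :+ t :* t :* (x :* y) :+ y :* t :* con 1 :+ con 1 :* con 1)
                 := con 1 :+ (t :* con 1 :+ t :* t :* z :+ y :* t :* (x :* t) :+ con 1 :* (y :* t))) R.refl
               t (χ y₀ x) (χ y₀ y) (χ y₀ (x +ᴳ y)))

        γ≈1 : ∀ u → γ u ≈ 1#
        γ≈1 u with u ≟ᴳ 0ᴳ
        ... | yes u≈0 = R.trans (⟨⟩-cong u≈0) γ0≈1
        ... | no  u≉0 = R.trans (γ≈t u≉0) t≈1

        degenerate : ⊥
        degenerate = y₀≉0 (χ-nondegenerate λ v → begin
          χ y₀ v                  ≈⟨ R.trans (R.*-congˡ (R.*-identityˡ 1#)) (R.*-identityʳ (χ y₀ v)) ⟨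
          χ y₀ v * (1# * 1#)      ≈⟨ R.*-congˡ (R.*-cong (γ≈1 y₀) (γ≈1 v)) ⟨
          χ y₀ v * (γ y₀ * γ v)   ≈⟨ γ-+ y₀ v ⟨
          γ (y₀ +ᴳ v)             ≈⟨ γ≈1 (y₀ +ᴳ v) ⟩
          1#                      ∎)
          where open SetoidReasoning R.setoid

    -- Consequences of `r ≈ p`: the inversion relation, the cube of `ƛ`, the dual pentagon.

    module _ (4<N : 4 ℕ.< N) where

      r≈p : r ≈ p
      r≈p = d≈0⇒r≈p (≈-stable λ d≉0 → degenerate d≉0 4<N)

      -- Once `r` and `p` agree, their quadratic equations differ only in `√N * p * a` against
      -- `√N * p`, and `p` is nonzero.
      a≈1 : a ≈ 1#
      a≈1 = *-cancelˡ (*-≉0 √N≉0 p≉0) (linear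
        (1# · R.sym rr≈√Nra+a ⊕ 1# · pp≈√Np+a ⊕ √N * a · R.sym r≈p ⊕ r · r≈p ⊕ p · r≈p)
        (R.solve 4 (λ s p r a →
           s :* p :* a :+ (con 1 :* (r :* r) :+ con 1 :* (s :* p :+ a) :+ s :* a :* r :+ r :* p :+ p :* p)
             := s :* p :* con 1 :+ (con 1 :* (s :* (r :* a) :+ a) :+ con 1 :* (p :* p) :+ s :* a :* p
               :+ r :* r :+ p :* r)) R.refl √N p r a))

      pp≈√Np+1 : p * p ≈ √N * p + 1#
      pp≈√Np+1 = R.trans pp≈√Np+a (R.+-congˡ a≈1)

      C+q≈0 : C + q ≈ 0#
      C+q≈0 = R.trans (R.+-congˡ (R.sym (R.trans (R.*-congˡ a≈1) (R.*-identityʳ q)))) C+qa≈0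

      γEE≈1+pΔ : ∀ x → γ x * (E x * E (-ᴳ x)) ≈ 1# + p * Δ x
      γEE≈1+pΔ x = R.trans (γEE≈a+pΔ x) (R.+-congʳ a≈1)

      E*E-≈γ⁻¹ : ∀ {u} → ¬ u ≈ᴳ 0ᴳ → E u * E (-ᴳ u) ≈ γ⁻¹ u
      E*E-≈γ⁻¹ {u} u≉0 = R.trans (R.sym (aγ⁻¹≈EE u≉0)) (R.trans (R.*-congʳ a≈1) (R.*-identityˡ (γ⁻¹ u)))

      ƛp≈q : ƛ * p ≈ q
      ƛp≈q = R.trans (R.*-congˡ (R.sym r≈p)) ƛr≈q

      Ẽ : Carrier → ℂ
      Ẽ u = γ u * E u

      Ẽ-cong : Congruent Ẽ
      Ẽ-cong eq = R.*-cong (⟨⟩-cong eq) (E-cong eq)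

      Ê≈ƛẼ : ∀ u → Ê u ≈ ƛ * Ẽ u
      Ê≈ƛẼ u with u ≟ᴳ 0ᴳ
      ... | no  u≉0 = Ê≈ƛγE u≉0
      ... | yes u≈0 = R.trans (Ê-cong u≈0) (R.trans (R.sym ƛp≈q) (R.*-congˡ
        (R.trans (R.sym (R.*-identityˡ p)) (R.trans (R.*-congʳ (R.sym γ0≈1)) (Ẽ-cong (𝔾.sym u≈0))))))

      𝓕Ê : ∀ x → 𝓕 Ê x ≈ E (-ᴳ x)
      𝓕Ê x = R.trans (𝓕-cong Ê-def x) (𝓕-𝓕 E-cong x)

      -- Transform `Ê≈ƛẼ` once more: transforming `E` twice reflects its argument.
      ƛ𝓕Ẽ : ∀ x → ƛ * 𝓕 Ẽ x ≈ E (-ᴳ x)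
      ƛ𝓕Ẽ x = R.trans (R.sym (∫-*ˡ ƛ _)) (R.trans
        (∫-cong λ k → R.trans (R.sym (R.*-assoc ƛ (Ẽ k) (χ k (-ᴳ x)))) (R.*-congʳ (R.sym (Ê≈ƛẼ k)))) (𝓕Ê x))

      ∫-𝓕-0 : ∀ f → 𝓕 f 0ᴳ ≈ ∫ f
      ∫-𝓕-0 f = ∫-cong λ x → R.trans (R.*-congˡ (R.trans (χ-cong 𝔾.refl 𝔾.ε⁻¹≈ε) (χ-0ʳ x))) (R.*-identityʳ (f x))

      ∫Ê≈p : ∫ Ê ≈ p
      ∫Ê≈p = R.trans (R.sym (∫-𝓕-0 Ê)) (R.trans (𝓕Ê 0ᴳ) (E-cong 𝔾.ε⁻¹≈ε))

      -- Both sides are inverse to `χ x y`. Apart from a factor in each variable, the Fourier kernel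
      -- becomes a function of `y +ᴳ x` alone, so summing over `y` separates.
      χ-γ : ∀ x y → χ x (-ᴳ y) ≈ γ x * γ y * γ⁻¹ (y +ᴳ x)
      χ-γ x y = *-cancelˡ (γ≉0 (y +ᴳ x)) (linear
        (χ x (-ᴳ y) · γ-+ y x ⊕ χ x (-ᴳ y) * γ x * γ y · χ-sym y x
          ⊕ γ x * γ y · χ-inverseʳ x y ⊕ γ x * γ y · R.sym (γ-inverse (y +ᴳ x)))
        (R.solve 7 (λ g s gx gy c c′ c⁻ →
           g :* c⁻ :+ (c⁻ :* (c :* (gy :* gx)) :+ c⁻ :* gx :* gy :* c′ :+ gx :* gy :* con 1 :+ gx :* gy :* (g :* s))
             := g :* (gx :* gy :* s) :+ (c⁻ :* g :+ c⁻ :* gx :* gy :* c :+ gx :* gy :* (c⁻ :* c′) :+ gx :* gy :* con 1))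
           R.refl (γ (y +ᴳ x)) (γ⁻¹ (y +ᴳ x)) (γ x) (γ y) (χ y x) (χ x y) (χ x (-ᴳ y))))

      -- Both sides of ƛ E ≈ γ⁻¹ Ê summed over the group.
      ƛ³ : ƛ * (ƛ * ƛ) ≈ ∫ γ⁻¹
      -- The chain is `p ƛ³ = ƛ² q = ƛ * (∫ γ⁻¹ * ∫ Ẽ) = p * ∫ γ⁻¹`.
      ƛ³ = *-cancelˡ p≉0 (linear
        (ƛ * ƛ · ƛp≈q ⊕ ƛ · ƛq ⊕ ∫ γ⁻¹ · ƛ∫Ẽ)
        (R.solve 5 (λ l p q g e →
           p :* (l :* (l :* l)) :+ (l :* l :* q :+ l :* (g :* e) :+ g :* p)
             := p :* g :+ (l :* l :* (l :* p) :+ l :* (l :* q) :+ g :* (l :* e))) R.refl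
           ƛ p q (∫ γ⁻¹) (∫ Ẽ)))
        where
        open SetoidReasoning R.setoid
        ƛ∫Ẽ : ƛ * ∫ Ẽ ≈ p
        ƛ∫Ẽ = R.trans (R.sym (∫-*ˡ ƛ Ẽ)) (R.trans (∫-cong λ x → R.sym (Ê≈ƛẼ x)) ∫Ê≈p)
        ƛE : ∀ y → ƛ * E y ≈ ∫ λ x → Ẽ x * γ⁻¹ (y +ᴳ x)
        ƛE y = *-cancelˡ (γ≉0 y) (begin
          γ y * (ƛ * E y)                         ≈⟨ R.solve 3 (λ g l e → g :* (l :* e) := l :* (g :* e)) R.refl (γ y) ƛ (E y) ⟩
          ƛ * Ẽ y                                 ≈⟨ Ê≈ƛẼ y ⟨
          Ê y                                     ≈⟨ Ê-def y ⟩
          ∫ (λ x → E x * χ x (-ᴳ y))              ≈⟨ ∫-cong (λ x → R.trans (R.*-congˡ (χ-γ x y))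
                                                       (R.solve 4 (λ e gx gy s → e :* (gx :* gy :* s) := gy :* (gx :* e :* s))
                                                         R.refl (E x) (γ x) (γ y) (γ⁻¹ (y +ᴳ x)))) ⟩
          ∫ (λ x → γ y * (Ẽ x * γ⁻¹ (y +ᴳ x)))    ≈⟨ ∫-*ˡ (γ y) _ ⟩
          γ y * ∫ (λ x → Ẽ x * γ⁻¹ (y +ᴳ x))      ∎)
        ƛq : ƛ * q ≈ ∫ γ⁻¹ * ∫ Ẽ
        ƛq = begin
          ƛ * q                                         ≈⟨ R.*-congˡ (R.trans (Ê-def 0ᴳ) (∫-𝓕-0 E)) ⟩
          ƛ * ∫ E                                       ≈⟨ ∫-*ˡ ƛ E ⟨
          ∫ (λ y → ƛ * E y)                             ≈⟨ ∫-cong ƛE ⟩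
          ∫ (λ y → ∫ λ x → Ẽ x * γ⁻¹ (y +ᴳ x))          ≈⟨ ∫-swap _ ⟩
          ∫ (λ x → ∫ λ y → Ẽ x * γ⁻¹ (y +ᴳ x))          ≈⟨ ∫-cong (λ x → R.trans (∫-*ˡ (Ẽ x) _)
                                                             (R.trans (R.*-congˡ (∫-translate {γ⁻¹} γ⁻¹-cong x)) (R.*-comm (Ẽ x) (∫ γ⁻¹)))) ⟩
          ∫ (λ x → ∫ γ⁻¹ * Ẽ x)                         ≈⟨ ∫-*ˡ (∫ γ⁻¹) Ẽ ⟩
          ∫ γ⁻¹ * ∫ Ẽ                                   ∎

      -- Swapping the integrals pairs the weight `g` with `E (z -ᴳ t)` alone. It serves for `g`
      -- constantly 1 and for `g z = Ê (y -ᴳ z)`.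
      ∫-W : ∀ (g : Carrier → ℂ) x → ∫ (λ z → g z * W z x) ≈ 𝓕 (λ t → Ẽ t * ∫ (λ z → g z * E (z -ᴳ t))) x
      ∫-W g x = begin
        ∫ (λ z → g z * W z x)
          ≈⟨ ∫-cong (λ z → R.trans (R.*-congˡ (W-def z x)) (R.sym (∫-*ˡ (g z) _))) ⟩
        ∫ (λ z → ∫ λ t → g z * (h z t * χ t (-ᴳ x)))
          ≈⟨ ∫-swap _ ⟩
        ∫ (λ t → ∫ λ z → g z * (h z t * χ t (-ᴳ x)))
          ≈⟨ ∫-cong (λ t → R.trans (∫-cong λ z →
               R.solve 5 (λ g e e′ γ x → g :* (e :* e′ :* γ :* x) := γ :* e′ :* x :* (g :* e)) R.refl
                 (g z) (E (z -ᴳ t)) (E t) (γ t) (χ t (-ᴳ x)))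
               (∫-*ˡ (Ẽ t * χ t (-ᴳ x)) _)) ⟩
        ∫ (λ t → Ẽ t * χ t (-ᴳ x) * ∫ (λ z → g z * E (z -ᴳ t)))
          ≈⟨ ∫-cong (λ t → R.solve 3 (λ a b c → a :* b :* c := a :* c :* b) R.refl
               (Ẽ t) (χ t (-ᴳ x)) (∫ (λ z → g z * E (z -ᴳ t)))) ⟩
        𝓕 (λ t → Ẽ t * ∫ (λ z → g z * E (z -ᴳ t))) x ∎
        where open SetoidReasoning R.setoid

      ∫-E-shift : ∀ t → ∫ (λ z → E (z -ᴳ t)) ≈ q
      ∫-E-shift t = R.trans (∫-translate {E} E-cong (-ᴳ t)) (R.sym (R.trans (Ê-def 0ᴳ) (∫-𝓕-0 E)))

      -- Integrate the transformed pentagon over its argument `y`. By `ƛ𝓕Ẽ`, `Ê k * 𝓕 Ẽ k` is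
      -- `1# + p * Δ k`, and the quadratic equation for `p` reduces the coefficient of `Δ k` to `ƛ`.
      Ê∗E : ∀ k → ∫ (λ z → Ê (k -ᴳ z) * E z) ≈ q + ƛ * Δ k
      Ê∗E k = begin
        ∫ (λ z → Ê (k -ᴳ z) * E z)
          ≈⟨ ∫-cong (λ z → transformed-pentagon k z) ⟩
        ∫ (λ z → C * Δ k + Ê k * W z k)
          ≈⟨ R.trans (∫-+ _ _) (R.+-cong (∫-constant (C * Δ k)) (∫-*ˡ (Ê k) _)) ⟩
        C * Δ k * √N + Ê k * ∫ (λ z → W z k)
          ≈⟨ R.+-congˡ (R.*-congˡ ∫W) ⟩
        C * Δ k * √N + Ê k * (𝓕 Ẽ k * q)
          ≈⟨ linear
               (q * 𝓕 Ẽ k · Ê≈ƛẼ k ⊕ q * Ẽ k · ƛ𝓕Ẽ k ⊕ q · γEE≈1+pΔ k ⊕ Δ k * √N · C+q≈0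
                 ⊕ Δ k * p · R.sym ƛp≈q ⊕ Δ k * ƛ · pp≈√Np+1 ⊕ Δ k * √N · ƛp≈q)
               (R.solve 11 (λ c δ s f m q l g e e⁻ p →
                  c :* δ :* s :+ f :* (m :* q)
                    :+ (q :* m :* (l :* (g :* e)) :+ q :* (g :* e) :* e⁻ :+ q :* (con 1 :+ p :* δ) :+ δ :* s :* con 0
                      :+ δ :* p :* (l :* p) :+ δ :* l :* (s :* p :+ con 1) :+ δ :* s :* q)
                    := q :+ l :* δ
                      :+ (q :* m :* f :+ q :* (g :* e) :* (l :* m) :+ q :* (g :* (e :* e⁻)) :+ δ :* s :* (c :+ q)
                        :+ δ :* p :* q :+ δ :* l :* (p :* p) :+ δ :* s :* (l :* p))) R.refl
                  C (Δ k) √N (Ê k) (𝓕 Ẽ k) q ƛ (γ k) (E k) (E (-ᴳ k)) p) ⟩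
        q + ƛ * Δ k ∎
        where
        open SetoidReasoning R.setoid
        ∫W : ∫ (λ z → W z k) ≈ 𝓕 Ẽ k * q
        ∫W = begin
          ∫ (λ z → W z k)
            ≈⟨ ∫-cong (λ z → R.sym (R.*-identityˡ (W z k))) ⟩
          ∫ (λ z → 1# * W z k)
            ≈⟨ ∫-W (λ _ → 1#) k ⟩
          𝓕 (λ t → Ẽ t * ∫ (λ z → 1# * E (z -ᴳ t))) k
            ≈⟨ ∫-cong (λ t → R.trans (R.*-congʳ (R.*-congˡ (R.trans
                 (∫-cong λ z → R.*-identityˡ (E (z -ᴳ t))) (∫-E-shift t))))
                 (R.solve 3 (λ a b c → a :* b :* c := a :* c :* b) R.refl (Ẽ t) q (χ t (-ᴳ k)))) ⟩
          ∫ (λ t → Ẽ t * χ t (-ᴳ k) * q)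
            ≈⟨ ∫-*ʳ _ q ⟩
          𝓕 Ẽ k * q ∎

      -- Integrate the pentagon transformed at `x` against `Ê (y -ᴳ z)`. The point mass from `Ê∗E`
      -- produces the right side; the other terms form a multiple of `C + q`.
      Ê-Ê-E : ∀ x y → ∫ (λ z → Ê (y -ᴳ z) * (Ê (x -ᴳ z) * E z)) + C ≈ Ê x * Ê y * χ y (-ᴳ x)
      Ê-Ê-E x y = begin
        ∫ (λ z → Ê (y -ᴳ z) * (Ê (x -ᴳ z) * E z)) + C
          ≈⟨ R.+-congʳ (∫-cong λ z → R.trans (R.*-congˡ (transformed-pentagon x z))
               (R.solve 3 (λ f a b → f :* (a :+ b) := a :* f :+ f :* b) R.refl
                 (Ê (y -ᴳ z)) (C * Δ x) (Ê x * W z x))) ⟩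
        ∫ (λ z → C * Δ x * Ê (y -ᴳ z) + Ê (y -ᴳ z) * (Ê x * W z x)) + C
          ≈⟨ R.+-congʳ (R.trans (∫-+ _ _) (R.+-cong
               (R.trans (∫-*ˡ (C * Δ x) _) (R.*-congˡ (R.trans (∫-reflect {Ê} Ê-cong y) ∫Ê≈p)))
               (R.trans (∫-cong λ z → R.solve 3 (λ a b c → a :* (b :* c) := b :* (a :* c)) R.refl
                   (Ê (y -ᴳ z)) (Ê x) (W z x))
                 (R.trans (∫-*ˡ (Ê x) _) (R.*-congˡ ÊW))))) ⟩
        C * Δ x * p + Ê x * (q * 𝓕 Ẽ x + ƛ * (Ẽ y * χ y (-ᴳ x))) + C
          ≈⟨ linear
               (q * 𝓕 Ẽ x · Ê≈ƛẼ x ⊕ q * Ẽ x · ƛ𝓕Ẽ x ⊕ q · γEE≈1+pΔ x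
                 ⊕ 1# + Δ x * p · C+q≈0 ⊕ Ê x * χ y (-ᴳ x) · R.sym (Ê≈ƛẼ y))
               (R.solve 13 (λ c δ p f q m l g e e⁻ f′ t x →
                  c :* δ :* p :+ f :* (q :* m :+ l :* (t :* x)) :+ c
                    :+ (q :* m :* (l :* (g :* e)) :+ q :* (g :* e) :* e⁻ :+ q :* (con 1 :+ p :* δ)
                      :+ (con 1 :+ δ :* p) :* con 0 :+ f :* x :* f′)
                    := f :* f′ :* x :+ (q :* m :* f :+ q :* (g :* e) :* (l :* m) :+ q :* (g :* (e :* e⁻))
                      :+ (con 1 :+ δ :* p) :* (c :+ q) :+ f :* x :* (l :* t))) R.refl
                  C (Δ x) p (Ê x) q (𝓕 Ẽ x) ƛ (γ x) (E x) (E (-ᴳ x)) (Ê y) (Ẽ y) (χ y (-ᴳ x))) ⟩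
        Ê x * Ê y * χ y (-ᴳ x) ∎
        where
        open SetoidReasoning R.setoid
        ÊW : ∫ (λ z → Ê (y -ᴳ z) * W z x) ≈ q * 𝓕 Ẽ x + ƛ * (Ẽ y * χ y (-ᴳ x))
        ÊW = begin
          ∫ (λ z → Ê (y -ᴳ z) * W z x)
            ≈⟨ ∫-W (λ z → Ê (y -ᴳ z)) x ⟩
          𝓕 (λ t → Ẽ t * ∫ (λ z → Ê (y -ᴳ z) * E (z -ᴳ t))) x
            ≈⟨ ∫-cong (λ t → R.trans (R.*-congʳ (R.*-congˡ (inner t)))
                 (R.solve 5 (λ e q l δ x → e :* (q :+ l :* δ) :* x := q :* (e :* x) :+ l :* (e :* x :* δ)) R.refl
                   (Ẽ t) q ƛ (Δ (y -ᴳ t)) (χ t (-ᴳ x)))) ⟩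
          ∫ (λ t → q * (Ẽ t * χ t (-ᴳ x)) + ƛ * (Ẽ t * χ t (-ᴳ x) * Δ (y -ᴳ t)))
            ≈⟨ R.trans (∫-+ _ _) (R.+-cong (∫-*ˡ q _) (R.trans (∫-*ˡ ƛ _) (R.*-congˡ
                 (∫-sift {λ t → Ẽ t * χ t (-ᴳ x)} (λ eq → R.*-cong (Ẽ-cong eq) (χ-cong eq 𝔾.refl)) y)))) ⟩
          q * 𝓕 Ẽ x + ƛ * (Ẽ y * χ y (-ᴳ x)) ∎
          where
          inner : ∀ t → ∫ (λ z → Ê (y -ᴳ z) * E (z -ᴳ t)) ≈ q + ƛ * Δ (y -ᴳ t)
          inner t = begin
            ∫ (λ z → Ê (y -ᴳ z) * E (z -ᴳ t))
              ≈⟨ ∫-translate {λ z → Ê (y -ᴳ z) * E (z -ᴳ t)}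
                   (λ eq → R.*-cong (Ê-cong (-ᴳ-cong 𝔾.refl eq)) (E-cong (-ᴳ-cong eq 𝔾.refl))) t ⟨
            ∫ (λ z → Ê (y -ᴳ (z +ᴳ t)) * E ((z +ᴳ t) -ᴳ t))
              ≈⟨ ∫-cong (λ z → R.*-cong (Ê-cong (x-[y+z]≈[x-z]-y y z t)) (E-cong ([x+y]-y≈x z t))) ⟩
            ∫ (λ z → Ê (y -ᴳ t -ᴳ z) * E z)
              ≈⟨ Ê∗E (y -ᴳ t) ⟩
            q + ƛ * Δ (y -ᴳ t) ∎

      -- Two factors `ƛ * Ẽ` are values of `Ê` and `Ẽ z * γ⁻¹ z` is `E z`, so this is `Ê-Ê-E`.
      -- Keeping `ƛ * ƛ` on both sides postpones the division.
      dual-pentagon : ∀ x y → ƛ * ƛ * ∫ (λ z → Ẽ (y -ᴳ z) * Ẽ z * γ⁻¹ z * Ẽ (x -ᴳ z)) + C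
                            ≈ ƛ * ƛ * (⟨ x ⨾ y ⟩⁻¹ * Ẽ x * Ẽ y)
      dual-pentagon x y = begin
        ƛ * ƛ * ∫ (λ z → Ẽ (y -ᴳ z) * Ẽ z * γ⁻¹ z * Ẽ (x -ᴳ z)) + C
          ≈⟨ R.+-congʳ (R.trans (R.sym (∫-*ˡ (ƛ * ƛ) _)) (∫-cong integrand)) ⟩
        ∫ (λ z → Ê (y -ᴳ z) * (Ê (x -ᴳ z) * E z)) + C
          ≈⟨ Ê-Ê-E x y ⟩
        Ê x * Ê y * χ y (-ᴳ x)
          ≈⟨ R.*-cong (R.*-cong (Ê≈ƛẼ x) (Ê≈ƛẼ y))
               (R.trans (χ-sym y (-ᴳ x)) (R.trans (χ-neg x y) (χ-inverse-unique x y))) ⟩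
        ƛ * Ẽ x * (ƛ * Ẽ y) * ⟨ x ⨾ y ⟩⁻¹
          ≈⟨ R.solve 4 (λ l a b c → l :* a :* (l :* b) :* c := l :* l :* (c :* a :* b)) R.refl
               ƛ (Ẽ x) (Ẽ y) ⟨ x ⨾ y ⟩⁻¹ ⟩
        ƛ * ƛ * (⟨ x ⨾ y ⟩⁻¹ * Ẽ x * Ẽ y) ∎
        where
        open SetoidReasoning R.setoid
        integrand : ∀ z → ƛ * ƛ * (Ẽ (y -ᴳ z) * Ẽ z * γ⁻¹ z * Ẽ (x -ᴳ z)) ≈ Ê (y -ᴳ z) * (Ê (x -ᴳ z) * E z)
        integrand z = begin
          ƛ * ƛ * (Ẽ (y -ᴳ z) * (γ z * E z) * γ⁻¹ z * Ẽ (x -ᴳ z))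
            ≈⟨ R.solve 6 (λ l a g e s b → l :* l :* (a :* (g :* e) :* s :* b) := g :* s :* (l :* a :* (l :* b :* e)))
                 R.refl ƛ (Ẽ (y -ᴳ z)) (γ z) (E z) (γ⁻¹ z) (Ẽ (x -ᴳ z)) ⟩
          γ z * γ⁻¹ z * (ƛ * Ẽ (y -ᴳ z) * (ƛ * Ẽ (x -ᴳ z) * E z))
            ≈⟨ R.trans (R.*-congʳ (γ-inverse z)) (R.*-identityˡ _) ⟩
          ƛ * Ẽ (y -ᴳ z) * (ƛ * Ẽ (x -ᴳ z) * E z)
            ≈⟨ R.*-cong (Ê≈ƛẼ (y -ᴳ z)) (R.*-congʳ (Ê≈ƛẼ (x -ᴳ z))) ⟨
          Ê (y -ᴳ z) * (Ê (x -ᴳ z) * E z) ∎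

-- Explicit inverses and the assembled statement.

theorem5 : ∀ {c ℓ} (G : MetricGroup c ℓ) → let open MetricGroup G in
    4 ℕ.< N →
    (E : Carrier → ℂ) (C : ℂ) → IsFiniteQuantumDilogarithm G E C →
    let Ê = fourier E
        Ẽ = λ u → ⟨ u ⟩ * E u
    in
      (E 0ᴳ ^ 2 ≈ √N * E 0ᴳ + 1# × C ≈ - Ê 0ᴳ)
    × (∀ u → ¬ (u ≈ᴳ 0ᴳ) → E u * E (-ᴳ u) ≈ ⟨ u ⟩⁻¹)
    × (Σ[ E0-isUnit ∈ IsUnit (E 0ᴳ) ] let ƛ = Ê 0ᴳ * 1/ E0-isUnit in
         (∀ u → Ê u ≈ ƛ * ⟨ u ⟩ * E u)
       × ƛ ^ 3 ≈ 1/√N * (∑[ x ] ⟨ x ⟩⁻¹)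
       × (Σ[ ƛ-isUnit ∈ IsUnit ƛ ] let C̃ = (1/ ƛ-isUnit) ^ 2 * C in
            ∀ x y →
              ⟨ x ⨾ y ⟩⁻¹ * Ẽ x * Ẽ y ≈
                C̃ + 1/√N * (∑[ z ] Ẽ (y -ᴳ z) * Ẽ z * ⟨ z ⟩⁻¹ * Ẽ (x -ᴳ z))))
theorem5 G 4<N E C isFQD =
  (p²≈ , C≈-q) , (λ u → D.E*E-≈γ⁻¹ 4<N) ,
  p-isUnit , Ê≈ , ƛ³≈ , ƛ′-isUnit , dual
  where
  open MetricGroup G renaming (⟨_⟩ to γ; ⟨_⟩⁻¹ to γ⁻¹)
  open IsFiniteQuantumDilogarithm isFQD
  open Characters G
  nonzero = ∃-avoiding (ℕ.<-trans (ℕ.s≤s (ℕ.s≤s ℕ.z≤n)) 4<N) (λ (_ : Fin 1) → 0ᴳ)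
  open Dilogarithm G E C isFQD using (p; q; Ê-def)
  module D = Dilogarithm.Constants G E C isFQD (proj₂ nonzero zero)
  open D using (ƛ)

  fourier≈Ê : ∀ u → fourier E u ≈ Dilogarithm.Ê G E C isFQD u
  fourier≈Ê u = R.trans (fourier≈𝓕 E u) (R.sym (Ê-def u))

  p²≈ : p ^ 2 ≈ √N * p + 1#
  p²≈ = R.trans (R.*-congˡ (R.*-identityʳ p)) (D.pp≈√Np+1 4<N)

  C≈-q : C ≈ - fourier E 0ᴳ
  C≈-q = R.trans (R.+-inverseˡ-unique C q (D.C+q≈0 4<N)) (R.-‿cong (R.sym (fourier≈Ê 0ᴳ)))

  p⁻¹ : ℂ
  -- The quadratic equation for `p` reads `p * (p + - √N) ≈ 1#`.
  p⁻¹ = p + - √N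

  p⁻¹p≈1 : p⁻¹ * p ≈ 1#
  p⁻¹p≈1 = linear (1# · D.pp≈√Np+1 4<N ⊕ p · R.-‿inverseʳ √N)
    (R.solve 3 (λ p s n → (p :+ n) :* p :+ (con 1 :* (s :* p :+ con 1) :+ p :* con 0)
      := con 1 :+ (con 1 :* (p :* p) :+ p :* (s :+ n))) R.refl p √N (- √N))

  p-isUnit : IsUnit p
  p-isUnit = p⁻¹ , p⁻¹p≈1 , R.trans (R.*-comm p p⁻¹) p⁻¹p≈1

  ƛ′ : ℂ
  ƛ′ = fourier E 0ᴳ * p⁻¹

  ƛ′≈ƛ : ƛ′ ≈ ƛ
  ƛ′≈ƛ = linear (p⁻¹ · fourier≈Ê 0ᴳ ⊕ p⁻¹ · R.sym (D.ƛp≈q 4<N) ⊕ ƛ · p⁻¹p≈1)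
    (R.solve 5 (λ f i q l p → f :* i :+ (i :* q :+ i :* (l :* p) :+ l :* con 1)
      := l :+ (i :* f :+ i :* q :+ l :* (i :* p))) R.refl (fourier E 0ᴳ) p⁻¹ q ƛ p)

  ƛ′-isUnit : IsUnit ƛ′
  -- `ƛ′` is `q / p` and `q` is `- C`, so the unit `C` supplies the inverse.
  ƛ′-isUnit = p * - 1/ C-isUnit , inverse , R.trans (R.*-comm ƛ′ (p * - 1/ C-isUnit)) inverse
    where
    C⁻¹ = 1/ C-isUnit
    inverse : p * - C⁻¹ * ƛ′ ≈ 1#
    inverse = linear
      (p * - C⁻¹ · ƛ′≈ƛ ⊕ - C⁻¹ · D.ƛp≈q 4<N ⊕ - C⁻¹ · D.C+q≈0 4<N
        ⊕ 1# · proj₂ (proj₂ C-isUnit) ⊕ C · R.sym (R.-‿inverseʳ C⁻¹))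
      (R.solve 7 (λ p n l′ l q c i →
         p :* n :* l′ :+ (p :* n :* l :+ n :* q :+ n :* con 0 :+ con 1 :* con 1 :+ c :* (i :+ n))
           := con 1 :+ (p :* n :* l′ :+ n :* (l :* p) :+ n :* (c :+ q) :+ con 1 :* (c :* i) :+ c :* con 0))
         R.refl p (- C⁻¹) ƛ′ ƛ q C C⁻¹)

  Ê≈ : ∀ u → fourier E u ≈ ƛ′ * γ u * E u
  Ê≈ u = R.trans (fourier≈Ê u) (R.trans (D.Ê≈ƛẼ 4<N u)
    (R.trans (R.*-congʳ (R.sym ƛ′≈ƛ)) (R.sym (R.*-assoc ƛ′ (γ u) (E u)))))

  ƛ³≈ : ƛ′ ^ 3 ≈ 1/√N * ∑ γ⁻¹
  ƛ³≈ = R.trans (R.*-cong ƛ′≈ƛ (R.*-cong ƛ′≈ƛ (R.trans (R.*-identityʳ ƛ′) ƛ′≈ƛ)))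
    (R.trans (D.ƛ³ 4<N) (∫-def γ⁻¹))

  dual : ∀ x y → ⟨ x ⨾ y ⟩⁻¹ * (γ x * E x) * (γ y * E y) ≈
    (1/ ƛ′-isUnit) ^ 2 * C + 1/√N *
      ∑ (λ z → γ (y -ᴳ z) * E (y -ᴳ z) * (γ z * E z) * γ⁻¹ z * (γ (x -ᴳ z) * E (x -ᴳ z)))
  dual x y = R.trans (linear
    -- After multiplying by `i * i`, the factors `(i ƛ)²` on `P` and `T` are removed through 1 -
    -- (iƛ)² = (1 + iƛ)(1 - iƛ), whence the coefficients `1# + i * ƛ`.
    (i * i · R.sym (D.dual-pentagon 4<N x y) ⊕ P * (1# + i * ƛ) · R.sym iƛ≈1
      ⊕ T * (1# + i * ƛ) · iƛ≈1)
    (R.solve 5 (λ P T i l c →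
       P :+ (i :* i :* (l :* l :* T :+ c) :+ P :* (con 1 :+ i :* l) :* (i :* l)
           :+ T :* (con 1 :+ i :* l) :* con 1)
         := i :* (i :* con 1) :* c :+ T :+ (i :* i :* (l :* l :* P) :+ P :* (con 1 :+ i :* l) :* con 1
           :+ T :* (con 1 :+ i :* l) :* (i :* l))) R.refl P T i ƛ C))
    (R.+-congˡ (∫-def _))
    where
    i P T : ℂ
    i = 1/ ƛ′-isUnit
    P = ⟨ x ⨾ y ⟩⁻¹ * (γ x * E x) * (γ y * E y)
    T = ∫ (λ z → γ (y -ᴳ z) * E (y -ᴳ z) * (γ z * E z) * γ⁻¹ z * (γ (x -ᴳ z) * E (x -ᴳ z)))
    iƛ≈1 : i * ƛ ≈ 1#
    iƛ≈1 = R.trans (R.*-congˡ (R.sym ƛ′≈ƛ)) (proj₁ (proj₂ ƛ′-isUnit))
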